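{- Let $p$ be a prime, let $a\in\mathbb{Z}$ be such that $f(x)=x^p-a$ is irreducible in $\mathbb{Z}[x]$, and let $f^n$ denote the $n$-fold composition of $f$ with itself. For each $n\ge 1$ let $\alpha_n$ be a root of $f^n(x)$ and $K_n=\mathbb{Q}(\alpha_n)$, with ring of integers $\mathcal{O}_{K_n}$. Fix a natural number $N\geq 1$. Then $\mathcal{O}_{K_n}=\mathbb{Z}[\alpha_n]$ for all $1\le n\leq N$ if and only if $a^p\not\equiv a \pmod{p^2}$ and $f^n(0)$ is squarefree for all $1\le n\leq N$.
   Context: $f^n=f\circ f\circ\cdots\circ f$ ($n$ times). Since $f$ is irreducible, every iterate $f^n(x)$ is irreducible in $\mathbb{Z}[x]$, so $K_n$ has degree $p^n$ over $\mathbb{Q}$. -}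

module Defs where

open import Data.Nat as ℕ using (ℕ; zero; suc)
open import Data.Nat.Divisibility as ℕD using ()
open import Data.Integer as ℤ using (ℤ)
open import Data.Integer.Divisibility as ℤD using ()
open import Data.Rational as ℚ using (ℚ)
open import Data.List using (List; []; _∷_; map; replicate; _++_; _∷ʳ_)
open import Data.List.Relation.Unary.All using (All)
open import Data.Product using (Σ; ∃; _×_; _,_)
open import Data.Sum using (_⊎_)
open import Relation.Binary.PropositionalEquality using (_≡_)
open import Relation.Nullary using (¬_)

-- Dense univariate polynomials over a ring-like carrier, as coefficient
-- lists, lowest degree first.  Trailing zeros are allowed; polynomial
-- equality is "the difference has all coefficients zero".

module PolyOps {A : Set} (0# 1# : A) (_+_ _*_ : A → A → A) (-_ : A → A) where

  Poly : Set
  Poly = List A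

  const : A → Poly
  const c = c ∷ []

  addP : Poly → Poly → Poly
  addP []       q        = q
  addP (x ∷ p)  []       = x ∷ p
  addP (x ∷ p)  (y ∷ q)  = (x + y) ∷ addP p q

  negP : Poly → Poly
  negP = map -_

  subP : Poly → Poly → Poly
  subP p q = addP p (negP q)

  scaleP : A → Poly → Poly
  scaleP c = map (c *_)

  mulP : Poly → Poly → Poly
  mulP []      q = []
  mulP (x ∷ p) q = addP (scaleP x q) (0# ∷ mulP p q)

  compP : Poly → Poly → Poly
  compP []      q = []
  compP (c ∷ p) q = addP (const c) (mulP q (compP p q))

  evalP : Poly → A → A
  evalP []      x = 0#
  evalP (c ∷ p) x = c + (x * evalP p x)

  IsZeroP : Poly → Set
  IsZeroP p = All (_≡ 0#) p

  _≈P_ : Poly → Poly → Set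
  p ≈P q = IsZeroP (subP p q)

  Monic : Poly → Set
  Monic h = Σ (List A) λ xs → h ≡ xs ∷ʳ 1#

module ℤP = PolyOps (ℤ.+ 0) (ℤ.+ 1) ℤ._+_ ℤ._*_ ℤ.-_
module ℚP = PolyOps ℚ.0ℚ ℚ.1ℚ ℚ._+_ ℚ._*_ ℚ.-_

open ℤP using () renaming (Poly to ℤ[x])
open ℚP using () renaming (Poly to ℚ[x])

toℚ[x] : ℤ[x] → ℚ[x]
toℚ[x] = map (λ z → z ℚ./ 1)

UnitZ : ℤ[x] → Set
UnitZ g = (g ℤP.≈P ℤP.const (ℤ.+ 1)) ⊎ (g ℤP.≈P ℤP.const (ℤ.- ℤ.+ 1))

IrreducibleZ : ℤ[x] → Set
IrreducibleZ P =
  ¬ ℤP.IsZeroP P × ¬ UnitZ P ×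
  (∀ g h → P ℤP.≈P ℤP.mulP g h → UnitZ g ⊎ UnitZ h)

fPoly : ℕ → ℤ → ℤ[x]
fPoly zero    a = ℤP.const (ℤ.+ 1 ℤ.- a)          -- x^0 - a (unused: p prime)
fPoly (suc k) a = (ℤ.- a) ∷ (replicate k (ℤ.+ 0) ++ (ℤ.+ 1 ∷ []))

fIter : ℕ → ℤ → ℕ → ℤ[x]
fIter p a zero    = ℤ.+ 0 ∷ ℤ.+ 1 ∷ []
fIter p a (suc n) = ℤP.compP (fPoly p a) (fIter p a n)

-- Number field K = ℚ(α) where α is a root of the monic irreducible
-- g ∈ ℤ[x]; K ≅ ℚ[x]/(g), with α the class of x.  Elements of K are
-- represented by rational polynomials β (standing for β(α)).

-- β(α) ≡ γ(α) in K  iff  g ∣ β - γ in ℚ[x]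
CongMod : ℤ[x] → ℚ[x] → ℚ[x] → Set
CongMod g β γ = ∃ λ q → ℚP.subP β γ ℚP.≈P ℚP.mulP q (toℚ[x] g)

IsAlgInt : ℤ[x] → ℚ[x] → Set
IsAlgInt g β = Σ ℤ[x] λ h → ℤP.Monic h ×
  CongMod g (ℚP.compP (toℚ[x] h) β) []

InZα : ℤ[x] → ℚ[x] → Set
InZα g β = Σ ℤ[x] λ r → CongMod g β (toℚ[x] r)

-- 𝒪_K = ℤ[α]  (ℤ[α] ⊆ 𝒪_K always holds, so this is the other inclusion)
RingOfIntegersIsZα : ℤ[x] → Set
RingOfIntegersIsZα g = ∀ β → IsAlgInt g β → InZα g β

-- squarefree: the only d ∈ ℕ with d² ∣ m is d = 1  (so 0 is not squarefree)
Squarefree : ℤ → Set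
Squarefree m = ∀ d → (d ℕ.* d) ℕD.∣ ℤ.∣ m ∣ → d ≡ 1

_≡_[mod_] : ℤ → ℤ → ℕ → Set
a ≡ b [mod m ] = ℤ.+ m ℤD.∣ (a ℤ.- b)

{-# OPTIONS --safe #-}
-- Write R_n = ℤ[x]/(fⁿ), and call C/q almost integral when the powers of C/q have a
-- common integer denominator; unlike integrality, this is visibly stable under sums.
--
-- Necessity.  Expand g = fⁿ at b as g = m + y h(y) with y = x − b.  If d² ∣ m and
-- d ∣ h(0), then β = h(y)/d = −m/(dy) satisfies a monic integral equation, although
-- it lies outside ℤ[α] unless d = 1.  Take b = 0, where h(0) = 0, for squarefreeness of
-- fⁿ(0), and n = 1, b = a, d = p for a^p ≢ a (mod p²).
--
-- Sufficiency.  It is enough to show that, for a prime q, C/q almost integral over R_n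
-- implies q ∣ C in R_n.  If q ∥ g(b), then (q, y) is a regular prime of R_n, and
-- q ∣ yC implies q ∣ C for such C.  For q = p, g ≡ y^{pⁿ} (mod p) with b = na, and
-- g(b) ≡ a^p − a (mod p²), so y can be stripped pⁿ times.  For q ≠ p, induct on n:
-- R_n = R_{n−1}[x]/(x^p − θ), the trace of x^i C is again almost integral, and its
-- divisibility by q gives q ∣ x^{p−1} C; then x is stripped, as q² ∤ fⁿ(0).
module Submission where

open import Defs
open import Algebra.Bundles using (CommutativeRing)
open import Algebra.Solver.Ring.AlmostCommutativeRing using (fromCommutativeRing; _-Raw-AlmostCommutative⟶_)
import Algebra.Solver.Ring
import Algebra.Properties.CommutativeSemiring.Binomial
import Algebra.Properties.CommutativeSemiring.Exp
import Algebra.Properties.Monoid.Sum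
import Algebra.Properties.Ring
import Algebra.Properties.Semiring.Exp
import Algebra.Properties.Semiring.Mult
open import Data.Fin as Fin using (Fin)
import Data.Fin.Properties as Finₚ
open import Data.Integer as ℤ using (ℤ; +_; -[1+_])
open import Data.Integer.Divisibility.Signed using (_∣_; divides; ∣ᵤ⇒∣; ∣⇒∣ᵤ; _∣?_)
import Data.Integer.Properties as ℤₚ
open import Data.List using (List; []; _∷_; map; length; _∷ʳ_; replicate; _++_)
open import Data.List.Relation.Unary.All using (All; []; _∷_)
open import Data.Maybe using (Maybe; just; nothing)
open import Data.Nat as ℕ using (ℕ; zero; suc; s≤s; z≤n; _!)
import Data.Nat.Combinatorics as Comb
open import Data.Nat.Combinatorics using (nCk≡n!/k![n-k]!; nCn≡1; k![n∸k]!∣n!)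
open import Data.Nat.Coprimality using (Coprime; coprime-Bézout; prime⇒coprime)
import Data.Nat.Divisibility as ℕD
import Data.Nat.DivMod as ℕDM
open import Data.Nat.GCD using (module Bézout)
open import Data.Nat.Induction using (<-rec)
open import Data.Nat.ListAction using (product)
open import Data.Nat.Primality using (Prime; prime⇒nonZero; prime⇒nonTrivial; prime⇒irreducible; euclidsLemma)
open import Data.Nat.Primality.Factorisation using (factorise; PrimeFactorisation)
import Data.Nat.Properties as ℕₚ
open import Data.Product using (∃; ∃₂; _×_; _,_; proj₁; proj₂)
open import Data.Rational as ℚ using (ℚ; mkℚ)
import Data.Rational.Properties as ℚₚ
open import Data.Rational.Unnormalised as ℚᵘ using (mkℚᵘ; *≡*)
import Data.Rational.Unnormalised.Properties as ℚᵘₚ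
open import Data.Sum using (_⊎_; inj₁; inj₂; [_,_]′)
open import Function using (_∘_)
open import Function.Bundles using (_⇔_; mk⇔)
open import Level using (0ℓ)
open import Relation.Binary.PropositionalEquality as ≡ using (_≡_; _≢_)
import Relation.Binary.Reasoning.Setoid
open import Relation.Nullary using (¬_; contradiction; yes; no; Dec)

-- Commutative rings, homomorphisms and quotients

-- Regularity takes the place of a field: `g` is monic, so nonzero integers are regular in
-- `ℤ[x]/(g)`, and a fraction `C/q` is only discussed through divisibility of multiples of powers of
-- `C` by powers of `q`. Likewise the valuation at `(q, y)` is replaced by a relation
-- `y^(1+e) k = q w`, with `k` and `w` nonzero modulo `(q, y)`, and a large enough exponent. The
-- trace is the delicate point: almost integrality must be carried to the conjugates of `C`, and
-- these need a p-th root of unity. It is adjoined formally, as `T` with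
-- `1 + T + ... + T^(p-1) = 0`, and a linear retraction brings the result back. The sum of the
-- conjugates is controlled only up to factors `p`; this is harmless for `q ≠ p` and is why `p` is
-- treated separately. The point `b = na` comes from Fermat: modulo `p`, applying `f` to an integer
-- subtracts `a`, so `na` is the root of `f^n` modulo `p`, and modulo `p²` only the last p-th power
-- matters.

Ring : Set₁
Ring = CommutativeRing 0ℓ 0ℓ

module RingKit (R : Ring) where
  open CommutativeRing R public hiding (zero)
  open Algebra.Properties.Ring ring public using (-0#≈0#; -‿distribˡ-*; -‿distribʳ-*; -‿involutive; -‿+-comm)
  open Algebra.Properties.Semiring.Exp semiring public using (_^_; ^-congˡ; ^-congʳ; ^-homo-*; ^-assocʳ)
  open Algebra.Properties.CommutativeSemiring.Exp commutativeSemiring public using (^-distrib-*)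
  open Algebra.Properties.Semiring.Mult semiring public using () renaming
    (_×_ to _·_; ×-homo-+ to ·-homo-+; ×1-homo-* to ·1-homo-*; ×-assoc-* to ·-assoc-*)
  open Relation.Binary.Reasoning.Setoid setoid public

  fromℤ : ℤ → Carrier
  fromℤ (+ n) = n · 1#
  fromℤ -[1+ n ] = - (suc n · 1#)

  private
    cancel-one : ∀ x y → (1# + x) + - (1# + y) ≈ x + - y
    cancel-one x y = begin
      (1# + x) + - (1# + y)  ≈⟨ +-cong (+-comm _ _) (-‿+-comm 1# y) ⟨
      (x + 1#) + (- 1# + - y)  ≈⟨ +-assoc _ _ _ ⟩
      x + (1# + (- 1# + - y))  ≈⟨ +-congˡ (+-assoc _ _ _) ⟨
      x + ((1# + - 1#) + - y)  ≈⟨ +-congˡ (+-congʳ (-‿inverseʳ 1#)) ⟩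
      x + (0# + - y)  ≈⟨ +-congˡ (+-identityˡ _) ⟩
      x + - y  ∎

    ⊖-homo : ∀ m n → fromℤ (m ℤ.⊖ n) ≈ m · 1# + - (n · 1#)
    ⊖-homo zero    zero    = sym (-‿inverseʳ 0#)
    ⊖-homo zero    (suc n) = sym (+-identityˡ _)
    ⊖-homo (suc m) zero    = sym (trans (+-congˡ -0#≈0#) (+-identityʳ _))
    ⊖-homo (suc m) (suc n) = begin
      fromℤ (suc m ℤ.⊖ suc n)  ≡⟨ ≡.cong fromℤ (ℤₚ.[1+m]⊖[1+n]≡m⊖n m n) ⟩
      fromℤ (m ℤ.⊖ n)  ≈⟨ ⊖-homo m n ⟩
      m · 1# + - (n · 1#)  ≈⟨ cancel-one _ _ ⟨
      suc m · 1# + - (suc n · 1#)  ∎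

    +-homo : ∀ i j → fromℤ (i ℤ.+ j) ≈ fromℤ i + fromℤ j
    +-homo (+ m) (+ n) = ·-homo-+ 1# m n
    +-homo (+ m) -[1+ n ] = ⊖-homo m (suc n)
    +-homo -[1+ m ] (+ n) = trans (⊖-homo n (suc m)) (+-comm _ _)
    +-homo -[1+ m ] -[1+ n ] = begin
      - ((suc (suc (m ℕ.+ n))) · 1#)  ≡⟨ ≡.cong (λ k → - (k · 1#)) (≡.sym (≡.cong suc (ℕₚ.+-suc m n))) ⟩
      - ((suc m ℕ.+ suc n) · 1#)  ≈⟨ -‿cong (·-homo-+ 1# (suc m) (suc n)) ⟩
      - (suc m · 1# + suc n · 1#)  ≈⟨ -‿+-comm _ _ ⟨
      - (suc m · 1#) + - (suc n · 1#)  ∎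

    neg-homo : ∀ i → fromℤ (ℤ.- i) ≈ - fromℤ i
    neg-homo (+ zero) = sym -0#≈0#
    neg-homo (+ suc n) = refl
    neg-homo -[1+ n ] = sym (-‿involutive _)

    *-homo⁺ : ∀ m j → fromℤ (+ m ℤ.* j) ≈ m · 1# * fromℤ j
    *-homo⁺ m (+ n) = begin
      fromℤ (+ m ℤ.* + n)  ≡⟨ ≡.cong fromℤ (≡.sym (ℤₚ.pos-* m n)) ⟩
      (m ℕ.* n) · 1#  ≈⟨ ·1-homo-* m n ⟩
      m · 1# * n · 1#  ∎
    *-homo⁺ m -[1+ n ] = begin
      fromℤ (+ m ℤ.* ℤ.- (+ suc n))  ≡⟨ ≡.cong fromℤ (≡.sym (ℤₚ.neg-distribʳ-* (+ m) (+ suc n))) ⟩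
      fromℤ (ℤ.- (+ m ℤ.* + suc n))  ≈⟨ neg-homo (+ m ℤ.* + suc n) ⟩
      - fromℤ (+ m ℤ.* + suc n)  ≈⟨ -‿cong (*-homo⁺ m (+ suc n)) ⟩
      - (m · 1# * suc n · 1#)  ≈⟨ -‿distribʳ-* _ _ ⟩
      m · 1# * - (suc n · 1#)  ∎

    *-homo : ∀ i j → fromℤ (i ℤ.* j) ≈ fromℤ i * fromℤ j
    *-homo (+ m) j = *-homo⁺ m j
    *-homo -[1+ m ] j = begin
      fromℤ (ℤ.- (+ suc m) ℤ.* j)  ≡⟨ ≡.cong fromℤ (≡.sym (ℤₚ.neg-distribˡ-* (+ suc m) j)) ⟩
      fromℤ (ℤ.- (+ suc m ℤ.* j))  ≈⟨ neg-homo (+ suc m ℤ.* j) ⟩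
      - fromℤ (+ suc m ℤ.* j)  ≈⟨ -‿cong (*-homo⁺ (suc m) j) ⟩
      - (suc m · 1# * fromℤ j)  ≈⟨ -‿distribˡ-* _ _ ⟩
      - (suc m · 1#) * fromℤ j  ∎

    morphism : CommutativeRing.rawRing ℤₚ.+-*-commutativeRing -Raw-AlmostCommutative⟶ fromCommutativeRing R
    morphism = record
      { ⟦_⟧ = fromℤ ; +-homo = +-homo ; *-homo = *-homo ; -‿homo = neg-homo
      ; 0-homo = refl ; 1-homo = +-identityʳ 1# }

    -- Unequal integers may have equal images, for instance in a quotient by a prime, so the
    -- comparison only ever answers positively.
    coeff≟ : ∀ i j → Maybe (fromℤ i ≈ fromℤ j)
    coeff≟ i j with i ℤₚ.≟ j
    ... | yes i≡j = just (reflexive (≡.cong fromℤ i≡j))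
    ... | no  _   = nothing

  open Algebra.Solver.Ring (CommutativeRing.rawRing ℤₚ.+-*-commutativeRing) (fromCommutativeRing R) morphism coeff≟ public
    using (solve; _:=_; _:+_; _:*_; :-_; _:-_; con)

-- These identities are needed in `ℤ`, in `ℤ[x]` and in quotients; over an abstract ring their
-- proofs are independent of how polynomials are represented.
module RingFacts (R : Ring) where
  open RingKit R

  1^ : ∀ n → 1# ^ n ≈ 1#
  1^ zero    = refl
  1^ (suc n) = trans (*-identityˡ _) (1^ n)

  cancel-^ : ∀ {z} → (∀ {u v} → z * u ≈ z * v → u ≈ v) → ∀ n {u v} → z ^ n * u ≈ z ^ n * v → u ≈ v
  cancel-^ regular zero    e = trans (sym (*-identityˡ _)) (trans e (*-identityˡ _))
  cancel-^ regular (suc n) e = cancel-^ regular n (regular (trans (sym (*-assoc _ _ _)) (trans e (*-assoc _ _ _))))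

  *-swap : ∀ x y z → x * (y * z) ≈ y * (x * z)
  *-swap x y z = solve 3 (λ x y z → x :* (y :* z) := y :* (x :* z)) refl x y z

  +-cancel-* : ∀ x a l → (x + a) * l + - a * l ≈ x * l
  +-cancel-* x a l = solve 3 (λ x a l → (x :+ a) :* l :+ (:- a) :* l := x :* l) refl x a l

  +-cancel : ∀ x a → x - a + a ≈ x
  +-cancel x a = solve 2 (λ x a → x :- a :+ a := x) refl x a

  -- One step of Horner's division by `x - b`: from remainder `r` and quotient `v` of the higher
  -- coefficients to those of the whole polynomial.
  expand-step : ∀ c x b r v → c + x * (r + (x - b) * v) ≈ (c + b * r) + (x - b) * (r + x * v)
  expand-step c x b r v = solve 5 (λ c x b r v → c :+ x :* (r :+ (x :- b) :* v) := (c :+ b :* r) :+ (x :- b) :* (r :+ x :* v)) refl c x b r v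

  -- In a quotient by `g`, a decomposition of `g` becomes a divisibility relation. It serves for
  -- `m = g(b)` and, with `q` in the role of `y`, for `m = y^(1+e) k`.
  solve-for : ∀ {g m y v} → g ≈ 0# → g ≈ m + y * v → m ≈ y * (- v)
  solve-for {g} {m} {y} {v} g≈0 e = begin
    m  ≈⟨ solve 3 (λ m y v → m := (m :+ y :* v) :+ y :* (:- v)) refl m y v ⟩
    (m + y * v) + y * (- v)  ≈⟨ +-congʳ (trans (sym e) g≈0) ⟩
    0# + y * (- v)  ≈⟨ +-identityˡ _ ⟩
    y * (- v)  ∎

  *-difference-zero : ∀ m u v → m * u ≈ m * v → m * (u - v) ≈ 0#
  *-difference-zero m u v e = begin
    m * (u - v)  ≈⟨ solve 3 (λ m u v → m :* (u :- v) := m :* u :- m :* v) refl m u v ⟩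
    m * u - m * v  ≈⟨ +-congʳ e ⟩
    m * v - m * v  ≈⟨ -‿inverseʳ _ ⟩
    0#  ∎

  difference-zero⁻ : ∀ {u v} → u - v ≈ 0# → u ≈ v
  difference-zero⁻ {u} {v} e = begin
    u  ≈⟨ +-cancel u v ⟨
    u - v + v  ≈⟨ +-congʳ e ⟩
    0# + v  ≈⟨ +-identityˡ v ⟩
    v  ∎

  shift-decomposition : ∀ q c x z k w → q * c + x * (z * k + q * w) ≈ (x * z) * k + q * (c + x * w)
  shift-decomposition q c x z k w = solve 6 (λ q c x z k w → q :* c :+ x :* (z :* k :+ q :* w) := (x :* z) :* k :+ q :*
    (c :+ x :* w)) refl q c x z k w

  subtract-multiple : ∀ {g k q w c} → g ≈ k + q * w → g ≈ c * q → k ≈ (c - w) * q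
  subtract-multiple {g} {k} {q} {w} {c} e e′ = begin
    k  ≈⟨ solve 3 (λ k q w → k := (k :+ q :* w) :- q :* w) refl k q w ⟩
    (k + q * w) - q * w  ≈⟨ +-congʳ (trans (sym e) e′) ⟩
    c * q - q * w  ≈⟨ solve 3 (λ c q w → c :* q :- q :* w := (c :- w) :* q) refl c q w ⟩
    (c - w) * q  ∎

  second-order-difference : ∀ {U V p w c Q} → U ≈ (V + p * (w * (c * p))) + ((c * p) * (c * p)) * Q → U - V ≈ (w * c + c * c * Q) * (p * p)
  second-order-difference {U} {V} {p} {w} {c} {Q} e = trans (+-congʳ e)
    (solve 5 (λ V p w c Q → ((V :+ p :* (w :* (c :* p))) :+ ((c :* p) :* (c :* p)) :* Q) :- V := (w :* c :+ c :* c :* Q) :* (p :* p)) refl V p w c Q)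

  move : ∀ {u v w} → u ≈ v + w → u - v ≈ w
  move {u} {v} {w} e = trans (+-congʳ e) (solve 2 (λ v w → (v :+ w) :- v := w) refl v w)

  cancel-common : ∀ u v a → (u - a) - (v - a) ≈ u - v
  cancel-common u v a = solve 3 (λ u v a → (u :- a) :- (v :- a) := u :- v) refl u v a

  combine : ∀ {B b a s d c p} → B - b ≈ d * p → b - (a + s) ≈ c * p → (B - a) - s ≈ (d + c) * p
  combine {B} {b} {a} {s} {d} {c} {p} e e′ = begin
    (B - a) - s  ≈⟨ solve 4 (λ B b a s → (B :- a) :- s := (B :- b) :+ (b :- (a :+ s))) refl B b a s ⟩
    (B - b) + (b - (a + s))  ≈⟨ +-cong e e′ ⟩
    d * p + c * p  ≈⟨ distribʳ _ _ _ ⟨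
    (d + c) * p  ∎

  difference-of-multiples : ∀ {u v c d m} → u ≈ c * m → u - v ≈ d * m → v ≈ (c - d) * m
  difference-of-multiples {u} {v} {c} {d} {m} e e′ = begin
    v  ≈⟨ solve 2 (λ u v → v := u :- (u :- v)) refl u v ⟩
    u - (u - v)  ≈⟨ +-cong e (-‿cong e′) ⟩
    c * m - d * m  ≈⟨ solve 3 (λ c d m → c :* m :- d :* m := (c :- d) :* m) refl c d m ⟩
    (c - d) * m  ∎

  regroup : ∀ {e₀ Q e c q E} → e₀ ≈ Q * e → e₀ * c ≈ (q * Q) * E → Q * (e * c) ≈ Q * (E * q)
  regroup {e₀} {Q} {e} {c} {q} {E} h eq = begin
    Q * (e * c)  ≈⟨ *-assoc _ _ _ ⟨
    (Q * e) * c  ≈⟨ *-congʳ h ⟨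
    e₀ * c  ≈⟨ eq ⟩
    (q * Q) * E  ≈⟨ solve 3 (λ q Q E → (q :* Q) :* E := Q :* (E :* q)) refl q Q E ⟩
    Q * (E * q)  ∎

  unmove : ∀ {u v w} → u - v ≈ w → u ≈ v + w
  unmove {u} {v} {w} e = trans (solve 2 (λ u v → u := v :+ (u :- v)) refl u v) (+-congˡ e)

  cancel-invertible : ∀ {r d u v} → r * d ≈ 1# → d * u ≈ d * v → u ≈ v
  cancel-invertible {r} {d} {u} {v} rd≈1 e = begin
    u  ≈⟨ *-identityˡ u ⟨
    1# * u  ≈⟨ *-congʳ rd≈1 ⟨
    (r * d) * u  ≈⟨ *-assoc _ _ _ ⟩
    r * (d * u)  ≈⟨ *-congˡ e ⟩
    r * (d * v)  ≈⟨ *-assoc _ _ _ ⟨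
    (r * d) * v  ≈⟨ *-congʳ rd≈1 ⟩
    1# * v  ≈⟨ *-identityˡ v ⟩
    v  ∎

  solve-multiple : ∀ {d r s} → d * r + s ≈ 0# → s ≈ (- r) * d
  solve-multiple {d} {r} {s} e = begin
    s  ≈⟨ solve 3 (λ d r s → s := (d :* r :+ s) :+ (:- r) :* d) refl d r s ⟩
    (d * r + s) + (- r) * d  ≈⟨ trans (+-congʳ e) (+-identityˡ _) ⟩
    (- r) * d  ∎

  factor-out : ∀ d r s → d * r + d * s ≈ (r + s) * d
  factor-out d r s = solve 3 (λ d r s → d :* r :+ d :* s := (r :+ s) :* d) refl d r s

  invert : ∀ {ρ δ} h → ρ * δ ≈ 1# → δ * (ρ * h) ≈ h
  invert {ρ} {δ} h e = begin
    δ * (ρ * h)  ≈⟨ solve 3 (λ d r h → d :* (r :* h) := (r :* d) :* h) refl δ ρ h ⟩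
    (ρ * δ) * h  ≈⟨ trans (*-congʳ e) (*-identityˡ h) ⟩
    h  ∎

  -- Both sides equal `-m`: the left because `δ β = H` and `y H = -m`, the right because
  -- `m = m′ δ²`.
  yβ-relation : ∀ {δ y β H m m′} → δ * β ≈ H → m ≈ y * (- H) → m ≈ m′ * (δ * δ) → δ * (y * β) ≈ δ * - (δ * m′)
  yβ-relation {δ} {y} {β} {H} {m} {m′} δβ m≈ m≈′ = begin
    δ * (y * β)  ≈⟨ solve 3 (λ d y b → d :* (y :* b) := :- (y :* (:- (d :* b)))) refl δ y β ⟩
    - (y * (- (δ * β)))  ≈⟨ -‿cong (*-congˡ (-‿cong δβ)) ⟩
    - (y * (- H))  ≈⟨ -‿cong (trans (sym m≈) m≈′) ⟩
    - (m′ * (δ * δ))  ≈⟨ solve 2 (λ m d → :- (m :* (d :* d)) := d :* (:- (d :* m))) refl m′ δ ⟩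
    δ * - (δ * m′)  ∎

  derivative-base : ∀ u v → u * 0# + v * 1# ≈ 1# * (1# * v)
  derivative-base u v = begin
    u * 0# + v * 1#  ≈⟨ +-cong (zeroʳ u) (*-identityʳ v) ⟩
    0# + v  ≈⟨ +-identityˡ v ⟩
    v  ≈⟨ trans (*-identityˡ _) (*-identityˡ v) ⟨
    1# * (1# * v)  ∎

  derivative-step : ∀ u v n w → u * (n * (w * v)) + v * (u * w) ≈ (1# + n) * ((u * w) * v)
  derivative-step u v n w = begin
    u * (n * (w * v)) + v * (u * w)  ≈⟨ solve 4 (λ u v n w → u :* (n :* (w :* v)) :+ v :* (u :* w) := (u :* w) :* v :+ n :*
      ((u :* w) :* v)) refl u v n w ⟩
    (u * w) * v + n * ((u * w) * v)  ≈⟨ +-congʳ (*-identityˡ _) ⟨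
    1# * ((u * w) * v) + n * ((u * w) * v)  ≈⟨ distribʳ _ _ _ ⟨
    (1# + n) * ((u * w) * v)  ∎

  geometric-unit : ∀ {x n w} → (x - 1#) * n ≈ w - 1# → n ≈ 0# → w ≈ 1#
  geometric-unit {x} {n} {w} e n≈0 = begin
    w  ≈⟨ solve 2 (λ w o → w := (w :- o) :+ o) refl w 1# ⟩
    (w - 1#) + 1#  ≈⟨ +-congʳ e ⟨
    (x - 1#) * n + 1#  ≈⟨ +-congʳ (trans (*-congˡ n≈0) (zeroʳ _)) ⟩
    0# + 1#  ≈⟨ +-identityˡ 1# ⟩
    1#  ∎

  geometric-step : ∀ {x n w} q → (x - 1#) * n ≈ w - 1# → x * (q * n) ≈ q * n + (w * q - q)
  geometric-step {x} {n} {w} q e = begin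
    x * (q * n)  ≈⟨ solve 4 (λ x o q n → x :* (q :* n) := o :* (q :* n) :+ q :* ((x :- o) :* n)) refl x 1# q n ⟩
    1# * (q * n) + q * ((x - 1#) * n)  ≈⟨ +-cong (*-identityˡ _) (*-congˡ e) ⟩
    q * n + q * (w - 1#)  ≈⟨ +-congˡ (solve 3 (λ q w o → q :* (w :- o) := w :* q :- o :* q) refl q w 1#) ⟩
    q * n + (w * q - 1# * q)  ≈⟨ +-congˡ (+-congˡ (-‿cong (*-identityˡ q))) ⟩
    q * n + (w * q - q)  ∎

record Hom (A B : Ring) : Set where
  private
    module A = RingKit A
    module B = RingKit B
  field
    ⟦_⟧    : A.Carrier → B.Carrier
    cong   : ∀ {x y} → x A.≈ y → ⟦ x ⟧ B.≈ ⟦ y ⟧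
    +-homo : ∀ x y → ⟦ x A.+ y ⟧ B.≈ ⟦ x ⟧ B.+ ⟦ y ⟧
    *-homo : ∀ x y → ⟦ x A.* y ⟧ B.≈ ⟦ x ⟧ B.* ⟦ y ⟧
    1-homo : ⟦ A.1# ⟧ B.≈ B.1#

  0-homo : ⟦ A.0# ⟧ B.≈ B.0#
  0-homo = B.begin
    ⟦ A.0# ⟧  B.≈⟨ B.solve 1 (λ z → z B.:= (z B.:+ z) B.:- z) B.refl _ ⟩
    (⟦ A.0# ⟧ B.+ ⟦ A.0# ⟧) B.- ⟦ A.0# ⟧  B.≈⟨ B.+-congʳ (+-homo _ _) ⟨
    ⟦ A.0# A.+ A.0# ⟧ B.- ⟦ A.0# ⟧  B.≈⟨ B.+-congʳ (cong (A.+-identityʳ _)) ⟩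
    ⟦ A.0# ⟧ B.- ⟦ A.0# ⟧  B.≈⟨ B.-‿inverseʳ _ ⟩
    B.0#  B.∎

  neg-homo : ∀ x → ⟦ A.- x ⟧ B.≈ B.- ⟦ x ⟧
  neg-homo x = B.begin
    ⟦ A.- x ⟧  B.≈⟨ B.solve 2 (λ u v → v B.:= (u B.:+ v) B.:- u) B.refl ⟦ x ⟧ _ ⟩
    (⟦ x ⟧ B.+ ⟦ A.- x ⟧) B.- ⟦ x ⟧  B.≈⟨ B.+-congʳ (+-homo _ _) ⟨
    ⟦ x A.+ A.- x ⟧ B.- ⟦ x ⟧  B.≈⟨ B.+-congʳ (B.trans (cong (A.-‿inverseʳ x)) 0-homo) ⟩
    B.0# B.- ⟦ x ⟧  B.≈⟨ B.+-identityˡ _ ⟩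
    B.- ⟦ x ⟧  B.∎

  ^-homo : ∀ x n → ⟦ x A.^ n ⟧ B.≈ ⟦ x ⟧ B.^ n
  ^-homo x zero    = 1-homo
  ^-homo x (suc n) = B.trans (*-homo _ _) (B.*-congˡ (^-homo x n))

idHom : ∀ A → Hom A A
idHom A = record { ⟦_⟧ = λ x → x ; cong = λ e → e ; +-homo = λ _ _ → refl ; *-homo = λ _ _ → refl ; 1-homo = refl }
  where open CommutativeRing A

_∘ₕ_ : ∀ {A B C} → Hom B C → Hom A B → Hom A C
_∘ₕ_ {A} {B} {C} g f = record
  { ⟦_⟧ = λ x → g.⟦ f.⟦ x ⟧ ⟧
  ; cong   = λ e → g.cong (f.cong e)
  ; +-homo = λ x y → trans (g.cong (f.+-homo x y)) (g.+-homo _ _)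
  ; *-homo = λ x y → trans (g.cong (f.*-homo x y)) (g.*-homo _ _)
  ; 1-homo = trans (g.cong f.1-homo) g.1-homo }
  where
  open CommutativeRing C
  module f = Hom f
  module g = Hom g

module _ (R : Ring) (g : CommutativeRing.Carrier R) where
  open RingKit R

  record _≈ᵍ_ (x y : Carrier) : Set where
    constructor _,_
    field
      cofactor : Carrier
      equality : x ≈ y + cofactor * g

  -- The carrier stays that of `R` and only the equality is weakened, so an element is its own
  -- residue class and `project` is the identity on elements.
  Quot : Ring
  Quot = record
    { Carrier = Carrier ; _≈_ = _≈ᵍ_ ; _+_ = _+_ ; _*_ = _*_ ; -_ = -_ ; 0# = 0# ; 1# = 1#
    ; isCommutativeRing = record
      { isRing = record
        { +-isAbelianGroup = record
          { isGroup = record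
            { isMonoid = record
              { isSemigroup = record
                { isMagma = record
                  { isEquivalence = record { refl = lift refl ; sym = sym′ ; trans = trans′ }
                  ; ∙-cong = +-cong′ }
                ; assoc = λ x y z → lift (+-assoc x y z) }
              ; identity = (λ x → lift (+-identityˡ x)) , (λ x → lift (+-identityʳ x)) }
            ; inverse = (λ x → lift (-‿inverseˡ x)) , (λ x → lift (-‿inverseʳ x))
            ; ⁻¹-cong = neg-cong′ }
          ; comm = λ x y → lift (+-comm x y) }
        ; *-cong     = *-cong′
        ; *-assoc    = λ x y z → lift (*-assoc x y z)
        ; *-identity = (λ x → lift (*-identityˡ x)) , (λ x → lift (*-identityʳ x))
        ; distrib    = (λ x y z → lift (distribˡ x y z)) , (λ x y z → lift (distribʳ x y z)) }
      ; *-comm = λ x y → lift (*-comm x y) } }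
    where
    lift : ∀ {x y} → x ≈ y → x ≈ᵍ y
    lift {x} {y} e = 0# , trans e (solve 2 (λ y g → y := y :+ con (+ 0) :* g) refl y g)

    sym′ : ∀ {x y} → x ≈ᵍ y → y ≈ᵍ x
    sym′ {x} {y} (u , e) = - u , (begin
      y  ≈⟨ solve 3 (λ y u g → y := (y :+ u :* g) :+ (:- u) :* g) refl y u g ⟩
      (y + u * g) + - u * g  ≈⟨ +-congʳ e ⟨
      x + - u * g  ∎)

    trans′ : ∀ {x y z} → x ≈ᵍ y → y ≈ᵍ z → x ≈ᵍ z
    trans′ {x} {y} {z} (u , e) (v , e′) = v + u , (begin
      x  ≈⟨ e ⟩
      y + u * g  ≈⟨ +-congʳ e′ ⟩
      (z + v * g) + u * g  ≈⟨ solve 4 (λ z u v g → (z :+ v :* g) :+ u :* g := z :+ (v :+ u) :* g) refl z u v g ⟩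
      z + (v + u) * g  ∎)

    +-cong′ : ∀ {x y u v} → x ≈ᵍ y → u ≈ᵍ v → (x + u) ≈ᵍ (y + v)
    +-cong′ {x} {y} {u} {v} (c , e) (d , e′) = c + d , trans (+-cong e e′)
      (solve 5 (λ y v c d g → (y :+ c :* g) :+ (v :+ d :* g) := (y :+ v) :+ (c :+ d) :* g) refl y v c d g)

    neg-cong′ : ∀ {x y} → x ≈ᵍ y → (- x) ≈ᵍ (- y)
    neg-cong′ {x} {y} (c , e) = - c , trans (-‿cong e) (solve 3 (λ y c g → :- (y :+ c :* g) := :- y :+ (:- c) :* g) refl y c g)

    *-cong′ : ∀ {x y u v} → x ≈ᵍ y → u ≈ᵍ v → (x * u) ≈ᵍ (y * v)
    *-cong′ {x} {y} {u} {v} (c , e) (d , e′) = c * v + y * d + c * d * g , trans (*-cong e e′)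
      (solve 5 (λ y v c d g → (y :+ c :* g) :* (v :+ d :* g) := y :* v :+ (c :* v :+ y :* d :+ c :* d :* g) :* g) refl y v c d g)

  project : Hom R Quot
  project = record
    { ⟦_⟧ = λ x → x ; cong = lift ; +-homo = λ _ _ → Quot.refl ; *-homo = λ _ _ → Quot.refl ; 1-homo = Quot.refl }
    where
    module Quot = CommutativeRing Quot
    lift : ∀ {x y} → x ≈ y → x ≈ᵍ y
    lift {x} {y} e = 0# , trans e (solve 2 (λ y g → y := y :+ con (+ 0) :* g) refl y g)

  modulus≈0 : g ≈ᵍ 0#
  modulus≈0 = 1# , sym (trans (+-identityˡ _) (*-identityˡ _))

  descend : ∀ {B} (h : Hom R B) → CommutativeRing._≈_ B (Hom.⟦_⟧ h g) (CommutativeRing.0# B) → Hom Quot B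
  descend {B} h hg≈0 = record
    { ⟦_⟧ = h.⟦_⟧
    ; cong = λ { {x} {y} (u , e) → B.begin
        h.⟦ x ⟧  B.≈⟨ h.cong e ⟩
        h.⟦ y + u * g ⟧  B.≈⟨ B.trans (h.+-homo _ _) (B.+-congˡ (h.*-homo _ _)) ⟩
        h.⟦ y ⟧ B.+ h.⟦ u ⟧ B.* h.⟦ g ⟧  B.≈⟨ B.+-congˡ (B.trans (B.*-congˡ hg≈0) (B.zeroʳ _)) ⟩
        h.⟦ y ⟧ B.+ B.0#  B.≈⟨ B.+-identityʳ _ ⟩
        h.⟦ y ⟧  B.∎ }
    ; +-homo = h.+-homo ; *-homo = h.*-homo ; 1-homo = h.1-homo }
    where
    module B = RingKit B
    module h = Hom h

-- Polynomial rings

module PolyBase (K : Ring) where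
  open RingKit K
  open PolyOps 0# 1# _+_ _*_ -_ public hiding (_≈P_; IsZeroP; Monic; Poly)

  coeff : List Carrier → ℕ → Carrier
  coeff []      i       = 0#
  coeff (c ∷ p) zero    = c
  coeff (c ∷ p) (suc i) = coeff p i

  infix 4 _≋_
  record _≋_ (p q : List Carrier) : Set where
    constructor coeffwise
    field at : ∀ i → coeff p i ≈ coeff q i
  open _≋_ public

  ≋-refl : ∀ {p} → p ≋ p
  ≋-refl .at i = refl

  ≋-sym : ∀ {p q} → p ≋ q → q ≋ p
  ≋-sym e .at i = sym (at e i)

  ≋-trans : ∀ {p q r} → p ≋ q → q ≋ r → p ≋ r
  ≋-trans e e′ .at i = trans (at e i) (at e′ i)

  ∷-cong : ∀ {c d p q} → c ≈ d → p ≋ q → (c ∷ p) ≋ (d ∷ q)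
  ∷-cong e e′ .at zero    = e
  ∷-cong e e′ .at (suc i) = at e′ i

  ∷-injʳ : ∀ {c d p q} → (c ∷ p) ≋ (d ∷ q) → p ≋ q
  ∷-injʳ e .at i = at e (suc i)

  []-∷ : ∀ {c p} → c ≈ 0# → p ≋ [] → (c ∷ p) ≋ []
  []-∷ e e′ .at zero    = e
  []-∷ e e′ .at (suc i) = at e′ i

  []-∷⁻ : ∀ {c p} → (c ∷ p) ≋ [] → p ≋ []
  []-∷⁻ e .at i = at e (suc i)

  coeff-add : ∀ p q i → coeff (addP p q) i ≈ coeff p i + coeff q i
  coeff-add []      q       i       = sym (+-identityˡ _)
  coeff-add (c ∷ p) []      i       = sym (+-identityʳ _)
  coeff-add (c ∷ p) (d ∷ q) zero    = refl
  coeff-add (c ∷ p) (d ∷ q) (suc i) = coeff-add p q i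

  coeff-neg : ∀ p i → coeff (negP p) i ≈ - coeff p i
  coeff-neg []      i       = sym -0#≈0#
  coeff-neg (c ∷ p) zero    = refl
  coeff-neg (c ∷ p) (suc i) = coeff-neg p i

  coeff-scale : ∀ c p i → coeff (scaleP c p) i ≈ c * coeff p i
  coeff-scale c []      i       = sym (zeroʳ _)
  coeff-scale c (d ∷ p) zero    = refl
  coeff-scale c (d ∷ p) (suc i) = coeff-scale c p i

  add-cong : ∀ {p q r s} → p ≋ q → r ≋ s → addP p r ≋ addP q s
  add-cong {p} {q} {r} {s} e e′ .at i =
    trans (coeff-add p r i) (trans (+-cong (at e i) (at e′ i)) (sym (coeff-add q s i)))

  scale-cong : ∀ {c d p q} → c ≈ d → p ≋ q → scaleP c p ≋ scaleP d q
  scale-cong {c} {d} {p} {q} e e′ .at i =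
    trans (coeff-scale c p i) (trans (*-cong e (at e′ i)) (sym (coeff-scale d q i)))

  neg-cong : ∀ {p q} → p ≋ q → negP p ≋ negP q
  neg-cong {p} {q} e .at i = trans (coeff-neg p i) (trans (-‿cong (at e i)) (sym (coeff-neg q i)))

  add-assoc : ∀ p q r → addP (addP p q) r ≋ addP p (addP q r)
  add-assoc p q r .at i = begin
    coeff (addP (addP p q) r) i  ≈⟨ trans (coeff-add (addP p q) r i) (+-congʳ (coeff-add p q i)) ⟩
    (coeff p i + coeff q i) + coeff r i  ≈⟨ +-assoc _ _ _ ⟩
    coeff p i + (coeff q i + coeff r i)  ≈⟨ trans (coeff-add p (addP q r) i) (+-congˡ (coeff-add q r i)) ⟨
    coeff (addP p (addP q r)) i  ∎

  add-comm : ∀ p q → addP p q ≋ addP q p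
  add-comm p q .at i = trans (coeff-add p q i) (trans (+-comm _ _) (sym (coeff-add q p i)))

  add-[] : ∀ p → addP p [] ≋ p
  add-[] p .at i = trans (coeff-add p [] i) (+-identityʳ _)

  add-negʳ : ∀ p → addP p (negP p) ≋ []
  add-negʳ p .at i = trans (coeff-add p (negP p) i) (trans (+-congˡ (coeff-neg p i)) (-‿inverseʳ _))

  0∷[]≋[] : (0# ∷ []) ≋ []
  0∷[]≋[] = []-∷ refl ≋-refl

  mul-congˡ : ∀ p {q r} → q ≋ r → mulP p q ≋ mulP p r
  mul-congˡ []      e = ≋-refl
  mul-congˡ (c ∷ p) e = add-cong (scale-cong refl e) (∷-cong refl (mul-congˡ p e))

  mul-[] : ∀ p → mulP p [] ≋ []
  mul-[] []      = ≋-refl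
  mul-[] (c ∷ p) = []-∷ refl (mul-[] p)

  mul-∷ : ∀ p d q → mulP p (d ∷ q) ≋ addP (scaleP d p) (0# ∷ mulP p q)
  mul-∷ []      d q .at zero    = refl
  mul-∷ []      d q .at (suc i) = refl
  mul-∷ (c ∷ p) d q .at zero    = +-congʳ (*-comm c d)
  mul-∷ (c ∷ p) d q .at (suc i) = begin
    coeff (addP (scaleP c q) (mulP p (d ∷ q))) i  ≈⟨ coeff-add (scaleP c q) _ i ⟩
    coeff (scaleP c q) i + coeff (mulP p (d ∷ q)) i  ≈⟨ +-congˡ (trans (at (mul-∷ p d q) i) (coeff-add (scaleP d p) _ i)) ⟩
    coeff (scaleP c q) i + (coeff (scaleP d p) i + coeff (0# ∷ mulP p q) i)
      ≈⟨ solve 3 (λ x y z → x :+ (y :+ z) := y :+ (x :+ z)) refl (coeff (scaleP c q) i) (coeff (scaleP d p) i) (coeff (0# ∷ mulP p q) i) ⟩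
    coeff (scaleP d p) i + (coeff (scaleP c q) i + coeff (0# ∷ mulP p q) i)
      ≈⟨ +-congˡ (coeff-add (scaleP c q) (0# ∷ mulP p q) i) ⟨
    coeff (scaleP d p) i + coeff (mulP (c ∷ p) q) i  ≈⟨ coeff-add (scaleP d p) _ i ⟨
    coeff (addP (scaleP d p) (mulP (c ∷ p) q)) i  ∎

  mul-comm : ∀ p q → mulP p q ≋ mulP q p
  mul-comm []      q = ≋-sym (mul-[] q)
  mul-comm (c ∷ p) q = ≋-trans (add-cong ≋-refl (∷-cong refl (mul-comm p q))) (≋-sym (mul-∷ q c p))

  mul-cong : ∀ {p q r s} → p ≋ q → r ≋ s → mulP p r ≋ mulP q s
  mul-cong {p} {q} {r} {s} e e′ =
    ≋-trans (mul-congˡ p e′) (≋-trans (mul-comm p s) (≋-trans (mul-congˡ s e) (mul-comm s q)))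

  scale-add : ∀ c p q → scaleP c (addP p q) ≋ addP (scaleP c p) (scaleP c q)
  scale-add c p q .at i = begin
    coeff (scaleP c (addP p q)) i  ≈⟨ trans (coeff-scale c (addP p q) i) (*-congˡ (coeff-add p q i)) ⟩
    c * (coeff p i + coeff q i)  ≈⟨ distribˡ _ _ _ ⟩
    c * coeff p i + c * coeff q i  ≈⟨ +-cong (coeff-scale c p i) (coeff-scale c q i) ⟨
    coeff (scaleP c p) i + coeff (scaleP c q) i ≈⟨ coeff-add (scaleP c p) _ i ⟨
    coeff (addP (scaleP c p) (scaleP c q)) i  ∎

  add-interchange : ∀ p q r s → addP (addP p q) (addP r s) ≋ addP (addP p r) (addP q s)
  add-interchange p q r s .at i = begin
    coeff (addP (addP p q) (addP r s)) i
      ≈⟨ trans (coeff-add (addP p q) _ i) (+-cong (coeff-add p q i) (coeff-add r s i)) ⟩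
    (coeff p i + coeff q i) + (coeff r i + coeff s i)
      ≈⟨ solve 4 (λ a b c d → (a :+ b) :+ (c :+ d) := (a :+ c) :+ (b :+ d)) refl (coeff p i) (coeff q i) (coeff r i) (coeff s i) ⟩
    (coeff p i + coeff r i) + (coeff q i + coeff s i)
      ≈⟨ trans (coeff-add (addP p r) _ i) (+-cong (coeff-add p r i) (coeff-add q s i)) ⟨
    coeff (addP (addP p r) (addP q s)) i ∎

  shift-add : ∀ p q → (0# ∷ addP p q) ≋ addP (0# ∷ p) (0# ∷ q)
  shift-add p q = ∷-cong (sym (+-identityˡ _)) ≋-refl

  mul-distribˡ : ∀ p q r → mulP p (addP q r) ≋ addP (mulP p q) (mulP p r)
  mul-distribˡ []      q r = ≋-refl
  mul-distribˡ (c ∷ p) q r = ≋-trans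
    (add-cong (scale-add c q r) (≋-trans (∷-cong refl (mul-distribˡ p q r)) (shift-add (mulP p q) (mulP p r))))
    (add-interchange (scaleP c q) _ _ _)

  mul-distribʳ : ∀ p q r → mulP (addP q r) p ≋ addP (mulP q p) (mulP r p)
  mul-distribʳ p q r = ≋-trans (mul-comm (addP q r) p)
    (≋-trans (mul-distribˡ p q r) (add-cong (mul-comm p q) (mul-comm p r)))

  scale-mul : ∀ c p q → mulP (scaleP c p) q ≋ scaleP c (mulP p q)
  scale-mul c []      q = ≋-refl
  scale-mul c (d ∷ p) q = ≋-trans
    (add-cong e (∷-cong (sym (zeroʳ c)) (scale-mul c p q)))
    (≋-sym (scale-add c (scaleP d q) (0# ∷ mulP p q)))
    where
    e : scaleP (c * d) q ≋ scaleP c (scaleP d q)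
    e .at i = begin
      coeff (scaleP (c * d) q) i  ≈⟨ coeff-scale _ q i ⟩
      c * d * coeff q i  ≈⟨ *-assoc _ _ _ ⟩
      c * (d * coeff q i)  ≈⟨ *-congˡ (coeff-scale d q i) ⟨
      c * coeff (scaleP d q) i  ≈⟨ coeff-scale c (scaleP d q) i ⟨
      coeff (scaleP c (scaleP d q)) i ∎

  scale-0 : ∀ p → scaleP 0# p ≋ []
  scale-0 p .at i = trans (coeff-scale 0# p i) (zeroˡ _)

  scale-1 : ∀ p → scaleP 1# p ≋ p
  scale-1 p .at i = trans (coeff-scale 1# p i) (*-identityˡ _)

  shift-mul : ∀ p q → mulP (0# ∷ p) q ≋ (0# ∷ mulP p q)
  shift-mul p q = add-cong (scale-0 q) ≋-refl

  mul-assoc : ∀ p q r → mulP (mulP p q) r ≋ mulP p (mulP q r)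
  mul-assoc []      q r = ≋-refl
  mul-assoc (c ∷ p) q r = ≋-trans (mul-distribʳ r (scaleP c q) (0# ∷ mulP p q))
    (add-cong (scale-mul c q r) (≋-trans (shift-mul (mulP p q) r) (∷-cong refl (mul-assoc p q r))))

  const-mul : ∀ c p → mulP (const c) p ≋ scaleP c p
  const-mul c p = ≋-trans (add-cong ≋-refl 0∷[]≋[]) (add-[] _)

  mul-identityˡ : ∀ p → mulP (const 1#) p ≋ p
  mul-identityˡ p = ≋-trans (const-mul 1# p) (scale-1 p)

  polyRing : Ring
  polyRing = record
    { Carrier = List Carrier ; _≈_ = _≋_ ; _+_ = addP ; _*_ = mulP ; -_ = negP ; 0# = [] ; 1# = const 1#
    ; isCommutativeRing = record
      { isRing = record
        { +-isAbelianGroup = record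
          { isGroup = record
            { isMonoid = record
              { isSemigroup = record
                { isMagma = record
                  { isEquivalence = record { refl = ≋-refl ; sym = ≋-sym ; trans = ≋-trans }
                  ; ∙-cong = add-cong }
                ; assoc = add-assoc }
              ; identity = (λ _ → ≋-refl) , add-[] }
            ; inverse = (λ p → ≋-trans (add-comm (negP p) p) (add-negʳ p)) , add-negʳ
            ; ⁻¹-cong = neg-cong }
          ; comm = add-comm }
        ; *-cong     = mul-cong
        ; *-assoc    = mul-assoc
        ; *-identity = mul-identityˡ , (λ p → ≋-trans (mul-comm p (const 1#)) (mul-identityˡ p))
        ; distrib    = mul-distribˡ , mul-distribʳ }
      ; *-comm = mul-comm } }

  X : List Carrier
  X = 0# ∷ 1# ∷ []

  X-mul : ∀ p → mulP X p ≋ (0# ∷ p)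
  X-mul p = ≋-trans (shift-mul (const 1#) p) (∷-cong refl (mul-identityˡ p))

  ∷-as-sum : ∀ c p → (c ∷ p) ≋ addP (const c) (mulP X p)
  ∷-as-sum c p = ≋-trans (∷-cong (sym (+-identityʳ c)) ≋-refl) (add-cong {const c} ≋-refl (≋-sym (X-mul p)))

  constHom : Hom K polyRing
  constHom = record
    { ⟦_⟧ = const
    ; cong   = λ e → ∷-cong e ≋-refl
    ; +-homo = λ _ _ → ≋-refl
    ; *-homo = λ c d → ∷-cong (sym (+-identityʳ (c * d))) ≋-refl
    ; 1-homo = ≋-refl }

Poly : Ring → Ring
Poly K = PolyBase.polyRing K

module Evaluation {K B : Ring} (ι : Hom K B) (u : CommutativeRing.Carrier B) where
  private
    module K = RingKit K
    module ι = Hom ι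
  open RingKit B
  open PolyBase K

  -- The coefficients pass through `ι` before evaluation, so that composition of polynomials, change
  -- of coefficients and the homomorphisms out of the rings `R_n` all become instances of `evHom`.
  ev : List K.Carrier → Carrier
  ev []      = 0#
  ev (c ∷ p) = ι.⟦ c ⟧ + u * ev p

  ev-[] : ∀ p → p ≋ [] → ev p ≈ 0#
  ev-[] []      e = refl
  ev-[] (c ∷ p) e = begin
    ι.⟦ c ⟧ + u * ev p  ≈⟨ +-cong (trans (ι.cong (at e 0)) ι.0-homo) (*-congˡ (ev-[] p ([]-∷⁻ e))) ⟩
    0# + u * 0#  ≈⟨ solve 1 (λ u → con (+ 0) :+ u :* con (+ 0) := con (+ 0)) refl u ⟩
    0#  ∎

  ev-cong : ∀ {p q} → p ≋ q → ev p ≈ ev q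
  ev-cong {[]}    {q}     e = sym (ev-[] q (≋-sym e))
  ev-cong {c ∷ p} {[]}    e = ev-[] (c ∷ p) e
  ev-cong {c ∷ p} {d ∷ q} e = +-cong (ι.cong (at e 0)) (*-congˡ (ev-cong {p} {q} (∷-injʳ e)))

  ev-add : ∀ p q → ev (addP p q) ≈ ev p + ev q
  ev-add []      q       = sym (+-identityˡ _)
  ev-add (c ∷ p) []      = sym (+-identityʳ _)
  ev-add (c ∷ p) (d ∷ q) = begin
    ι.⟦ c K.+ d ⟧ + u * ev (addP p q)  ≈⟨ +-cong (ι.+-homo c d) (*-congˡ (ev-add p q)) ⟩
    (ι.⟦ c ⟧ + ι.⟦ d ⟧) + u * (ev p + ev q)  ≈⟨ solve 5 (λ c d u p q → (c :+ d) :+ u :* (p :+ q) := (c :+ u :* p) :+ (d :+ u :* q)) refl _ _ _ _ _ ⟩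
    (ι.⟦ c ⟧ + u * ev p) + (ι.⟦ d ⟧ + u * ev q) ∎

  ev-scale : ∀ c p → ev (scaleP c p) ≈ ι.⟦ c ⟧ * ev p
  ev-scale c []      = sym (zeroʳ _)
  ev-scale c (d ∷ p) = begin
    ι.⟦ c K.* d ⟧ + u * ev (scaleP c p)  ≈⟨ +-cong (ι.*-homo c d) (*-congˡ (ev-scale c p)) ⟩
    ι.⟦ c ⟧ * ι.⟦ d ⟧ + u * (ι.⟦ c ⟧ * ev p)  ≈⟨ solve 4 (λ c d u p → c :* d :+ u :* (c :* p) := c :* (d :+ u :* p)) refl _ _ _ _ ⟩
    ι.⟦ c ⟧ * (ι.⟦ d ⟧ + u * ev p)  ∎

  ev-mul : ∀ p q → ev (mulP p q) ≈ ev p * ev q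
  ev-mul []      q = sym (zeroˡ _)
  ev-mul (c ∷ p) q = begin
    ev (addP (scaleP c q) (K.0# ∷ mulP p q))  ≈⟨ ev-add (scaleP c q) (K.0# ∷ mulP p q) ⟩
    ev (scaleP c q) + (ι.⟦ K.0# ⟧ + u * ev (mulP p q))  ≈⟨ +-cong (ev-scale c q) (+-cong ι.0-homo (*-congˡ (ev-mul p q))) ⟩
    ι.⟦ c ⟧ * ev q + (0# + u * (ev p * ev q))  ≈⟨ solve 4 (λ c u p q → c :* q :+ (con (+ 0) :+ u :* (p :* q)) := (c :+ u :* p) :* q) refl _ _ _ _ ⟩
    (ι.⟦ c ⟧ + u * ev p) * ev q  ∎

  ev-const : ∀ c → ev (const c) ≈ ι.⟦ c ⟧
  ev-const c = trans (+-congˡ (zeroʳ u)) (+-identityʳ _)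

  ev-X : ev X ≈ u
  ev-X = begin
    ι.⟦ K.0# ⟧ + u * (ι.⟦ K.1# ⟧ + u * 0#) ≈⟨ +-cong ι.0-homo (*-congˡ (+-congʳ ι.1-homo)) ⟩
    0# + u * (1# + u * 0#)  ≈⟨ +-congˡ (*-congˡ (+-congˡ (zeroʳ u))) ⟩
    0# + u * (1# + 0#)  ≈⟨ trans (+-identityˡ _) (trans (*-congˡ (+-identityʳ _)) (*-identityʳ _)) ⟩
    u  ∎

  evHom : Hom (Poly K) B
  evHom = record
    { ⟦_⟧ = ev ; cong = ev-cong ; +-homo = ev-add ; *-homo = ev-mul
    ; 1-homo = trans (ev-const K.1#) ι.1-homo }

open Evaluation using (ev; evHom; ev-const; ev-X)

ev-congʳ : ∀ {K B} (ι : Hom K B) {u v} → CommutativeRing._≈_ B u v → ∀ p → CommutativeRing._≈_ B (ev ι u p) (ev ι v p)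
ev-congʳ {B = B} ι e []  = CommutativeRing.refl B
ev-congʳ {B = B} ι e (c ∷ p) = +-cong refl (*-cong e (ev-congʳ ι e p))
  where open CommutativeRing B

compP≡ev : ∀ K p β → PolyBase.compP K p β ≡ ev (PolyBase.constHom K) β p
compP≡ev K []      β = ≡.refl
compP≡ev K (c ∷ p) β = ≡.cong (λ z → addP (const c) (mulP β z)) (compP≡ev K p β)
  where open PolyBase K

hom-ev : ∀ {K B C} (ι : Hom K B) (ι′ : Hom K C) (h : Hom B C) →
         (∀ c → CommutativeRing._≈_ C (Hom.⟦_⟧ h (Hom.⟦_⟧ ι c)) (Hom.⟦_⟧ ι′ c)) →
         ∀ u p → CommutativeRing._≈_ C (Hom.⟦_⟧ h (ev ι u p)) (ev ι′ (Hom.⟦_⟧ h u) p)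
hom-ev {C = C} ι ι′ h hι u []  = Hom.0-homo h
hom-ev {C = C} ι ι′ h hι u (c ∷ p) =
  trans (Hom.+-homo h _ _) (+-cong (hι c) (trans (Hom.*-homo h _ _) (*-congˡ (hom-ev ι ι′ h hι u p))))
  where open CommutativeRing C

-- Monic polynomials

module MonicPoly (K : Ring) where
  open RingKit K
  open PolyBase K
  private module K[x] = RingKit (Poly K)

  -- Formulated by coefficients because trailing zeros keep the length of a list from measuring the
  -- degree.
  record MonicOfDegree (k : ℕ) (p : List Carrier) : Set where
    field
      lead  : coeff p k ≈ 1#
      above : ∀ {i} → k ℕ.< i → coeff p i ≈ 0#
  open MonicOfDegree public

  monic-cong : ∀ {k p q} → p ≋ q → MonicOfDegree k p → MonicOfDegree k q
  monic-cong e m .lead = trans (sym (at e _)) (lead m)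
  monic-cong e m .above k<i = trans (sym (at e _)) (above m k<i)

  monic-tail : ∀ {k c p} → MonicOfDegree (suc k) (c ∷ p) → MonicOfDegree k p
  monic-tail m .lead = lead m
  monic-tail m .above k<i = above m (s≤s k<i)

  monic-∷ : ∀ {k c p} → MonicOfDegree k p → MonicOfDegree (suc k) (c ∷ p)
  monic-∷ m .lead = lead m
  monic-∷ m .above (s≤s k<i) = above m k<i

  monic-1 : MonicOfDegree 0 (const 1#)
  monic-1 .lead = refl
  monic-1 .above (s≤s z≤n) = refl

  monic-zero : ∀ {c p} → MonicOfDegree 0 (c ∷ p) → p ≋ []
  monic-zero m .at i = above m (s≤s z≤n)

  monic-+const : ∀ {k p} c → MonicOfDegree (suc k) p → MonicOfDegree (suc k) (addP p (const c))
  monic-+const {k} {p} c m .lead = trans (coeff-add p _ (suc k)) (trans (+-identityʳ _) (lead m))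
  monic-+const {k} {p} c m .above {suc i} k<i = trans (coeff-add p _ (suc i)) (trans (+-identityʳ _) (above m k<i))

  monic-+const′ : ∀ {k p} .{{_ : ℕ.NonZero k}} c → MonicOfDegree k p → MonicOfDegree k (addP p (const c))
  monic-+const′ {suc k} = monic-+const

  coeff-∷-mul : ∀ c p q i → coeff (mulP (c ∷ p) q) i ≈ c * coeff q i + coeff (0# ∷ mulP p q) i
  coeff-∷-mul c p q i = trans (coeff-add (scaleP c q) _ i) (+-congʳ (coeff-scale c q i))

  monic-mul : ∀ {k l p q} → MonicOfDegree k p → MonicOfDegree l q → MonicOfDegree (k ℕ.+ l) (mulP p q)
  monic-mul {p = []} m n .lead    = lead m
  monic-mul {p = []} m n .above _ = refl
  monic-mul {zero} {p = c ∷ p} {q} m n =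
    monic-cong (≋-sym (≋-trans (mul-cong {q = const 1#} (∷-cong (lead m) (monic-zero m)) ≋-refl) (mul-identityˡ q))) n
  monic-mul {suc k} {l} {c ∷ p} {q} m n = record
    { lead = begin
        coeff (mulP (c ∷ p) q) (suc (k ℕ.+ l))  ≈⟨ coeff-∷-mul c p q (suc (k ℕ.+ l)) ⟩
        c * coeff q (suc (k ℕ.+ l)) + coeff (mulP p q) (k ℕ.+ l)  ≈⟨ +-cong (trans (*-congˡ (above n (s≤s (ℕₚ.m≤n+m l k)))) (zeroʳ c)) (lead ih) ⟩
        0# + 1#  ≈⟨ +-identityˡ _ ⟩
        1#  ∎
    ; above = λ { {suc i} (s≤s k+l<i) → begin
        coeff (mulP (c ∷ p) q) (suc i)  ≈⟨ coeff-∷-mul c p q (suc i) ⟩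
        c * coeff q (suc i) + coeff (mulP p q) i  ≈⟨ +-cong (trans (*-congˡ (above n (s≤s (ℕₚ.≤-trans (ℕₚ.m≤n+m l k) (ℕₚ.<⇒≤ k+l<i)))))
          (zeroʳ c)) (above ih k+l<i) ⟩
        0# + 0#  ≈⟨ +-identityˡ _ ⟩
        0#  ∎ } }
    where ih = monic-mul {k} {l} {p} {q} (monic-tail m) n

  monic-^ : ∀ {k p} n → MonicOfDegree k p → MonicOfDegree (n ℕ.* k) (p K[x].^ n)
  monic-^ zero    m = monic-1
  monic-^ (suc n) m = monic-mul m (monic-^ n m)

  monic-comp : ∀ {k γ} p → MonicOfDegree 1 γ → MonicOfDegree k p → MonicOfDegree k (ev constHom γ p)
  monic-comp [] γm m = m
  monic-comp {zero} {γ} (c ∷ p) γm m = monic-cong (≋-sym e) monic-1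
    where
    e : addP (const c) (mulP γ (ev constHom γ p)) ≋ const 1#
    e = ≋-trans (add-cong (∷-cong (lead m) ≋-refl)
          (≋-trans (mul-congˡ γ (Evaluation.ev-[] constHom γ p (monic-zero m))) (mul-[] γ))) ≋-refl
  monic-comp {suc k} {γ} (c ∷ p) γm m = monic-cong (add-comm _ (const c))
    (monic-+const c (monic-mul γm (monic-comp p γm (monic-tail m))))

  -- The highest coefficient of `p` reappears in `p g`, multiplied by the leading coefficient 1 of
  -- `g`, in some degree `≥ k`. So the coefficients of `p` vanish from the top down, even over a
  -- ring with zero divisors. Leaving the degrees below `k` free is what later allows a remainder of
  -- smaller degree.
  monic-regular : ∀ {k g} → MonicOfDegree k g → ∀ p → (∀ {i} → k ℕ.≤ i → coeff (mulP p g) i ≈ 0#) → p ≋ []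
  monic-regular m [] h = ≋-refl
  monic-regular {k} {g} m (c ∷ p) h = []-∷ c≈0 p≋[]
    where
    p≋[] : p ≋ []
    p≋[] = monic-regular m p λ {i} k≤i → begin
      coeff (mulP p g) i  ≈⟨ +-identityˡ _ ⟨
      0# + coeff (mulP p g) i  ≈⟨ +-congʳ (trans (*-congˡ (above m (s≤s k≤i))) (zeroʳ c)) ⟨
      c * coeff g (suc i) + coeff (mulP p g) i  ≈⟨ coeff-∷-mul c p g (suc i) ⟨
      coeff (mulP (c ∷ p) g) (suc i)  ≈⟨ h (ℕₚ.≤-trans k≤i (ℕₚ.n≤1+n i)) ⟩
      0#  ∎
    c≈0 : c ≈ 0#
    c≈0 = begin
      c  ≈⟨ solve 1 (λ c → c := c :* con (+ 1) :+ con (+ 0)) refl c ⟩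
      c * (1# + 0#) + 0#  ≈⟨ +-congʳ (*-congˡ (+-identityʳ 1#)) ⟩
      c * 1# + 0#  ≈⟨ +-cong (*-congˡ (lead m)) (at ([]-∷ refl (≋-trans (mul-cong p≋[] ≋-refl) ≋-refl)) k) ⟨
      c * coeff g k + coeff (0# ∷ mulP p g) k  ≈⟨ coeff-∷-mul c p g k ⟨
      coeff (mulP (c ∷ p) g) k  ≈⟨ h ℕₚ.≤-refl ⟩
      0#  ∎

-- Linear functionals on polynomials and the coordinate at `x^0`

module LinearFunctional {K B : Ring} (ι : Hom K B) where
  private
    module K = RingKit K
    module ι = Hom ι
  open RingKit B
  open PolyBase K

  -- The `K`-linear map with value `s i` on `x^i`; unlike in `ev`, these values need not be the
  -- powers of one element.
  lin : (ℕ → Carrier) → List K.Carrier → Carrier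
  lin s []      = 0#
  lin s (c ∷ p) = ι.⟦ c ⟧ * s 0 + lin (s ∘ suc) p

  lin-[] : ∀ s p → p ≋ [] → lin s p ≈ 0#
  lin-[] s []      e = refl
  lin-[] s (c ∷ p) e = begin
    ι.⟦ c ⟧ * s 0 + lin (s ∘ suc) p  ≈⟨ +-cong (*-congʳ (trans (ι.cong (at e 0)) ι.0-homo)) (lin-[] _ p ([]-∷⁻ e)) ⟩
    0# * s 0 + 0#  ≈⟨ trans (+-identityʳ _) (zeroˡ _) ⟩
    0#  ∎

  lin-cong : ∀ s {p q} → p ≋ q → lin s p ≈ lin s q
  lin-cong s {[]}    {q}     e = sym (lin-[] s q (≋-sym e))
  lin-cong s {c ∷ p} {[]}    e = lin-[] s (c ∷ p) e
  lin-cong s {c ∷ p} {d ∷ q} e = +-cong (*-congʳ (ι.cong (at e 0))) (lin-cong (s ∘ suc) {p} {q} (∷-injʳ e))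

  lin-add : ∀ s p q → lin s (addP p q) ≈ lin s p + lin s q
  lin-add s []      q       = sym (+-identityˡ _)
  lin-add s (c ∷ p) []      = sym (+-identityʳ _)
  lin-add s (c ∷ p) (d ∷ q) = begin
    ι.⟦ c K.+ d ⟧ * s 0 + lin _ (addP p q)  ≈⟨ +-cong (*-congʳ (ι.+-homo c d)) (lin-add _ p q) ⟩
    (ι.⟦ c ⟧ + ι.⟦ d ⟧) * s 0 + (lin _ p + lin _ q)  ≈⟨ solve 5 (λ c d s p q → (c :+ d) :* s :+ (p :+ q) := (c :* s :+ p) :+
      (d :* s :+ q)) refl _ _ _ _ _ ⟩
    (ι.⟦ c ⟧ * s 0 + lin _ p) + (ι.⟦ d ⟧ * s 0 + lin _ q) ∎

  lin-scale : ∀ s c p → lin s (scaleP c p) ≈ ι.⟦ c ⟧ * lin s p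
  lin-scale s c []      = sym (zeroʳ _)
  lin-scale s c (d ∷ p) = begin
    ι.⟦ c K.* d ⟧ * s 0 + lin _ (scaleP c p)  ≈⟨ +-cong (*-congʳ (ι.*-homo c d)) (lin-scale _ c p) ⟩
    ι.⟦ c ⟧ * ι.⟦ d ⟧ * s 0 + ι.⟦ c ⟧ * lin _ p  ≈⟨ solve 4 (λ c d s p → c :* d :* s :+ c :* p := c :* (d :* s :+ p)) refl _ _ _ _ ⟩
    ι.⟦ c ⟧ * (ι.⟦ d ⟧ * s 0 + lin _ p)  ∎

  lin-const : ∀ s c p → lin s (mulP (const c) p) ≈ ι.⟦ c ⟧ * lin s p
  lin-const s c p = trans (lin-cong s (const-mul c p)) (lin-scale s c p)

  lin-congˢ : ∀ {s t} → (∀ i → s i ≈ t i) → ∀ p → lin s p ≈ lin t p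
  lin-congˢ e []      = refl
  lin-congˢ e (c ∷ p) = +-cong (*-congˡ (e 0)) (lin-congˢ (e ∘ suc) p)

  lin-scaleˢ : ∀ θ s p → lin (λ i → θ * s i) p ≈ θ * lin s p
  lin-scaleˢ θ s []      = sym (zeroʳ θ)
  lin-scaleˢ θ s (c ∷ p) = trans (+-congˡ (lin-scaleˢ θ (s ∘ suc) p))
    (solve 4 (λ c θ s p → c :* (θ :* s) :+ θ :* p := θ :* (c :* s :+ p)) refl _ _ _ _)

  lin-X : ∀ s p → lin s (mulP X p) ≈ lin (s ∘ suc) p
  lin-X s p = begin
    lin s (mulP X p)  ≈⟨ lin-cong s (X-mul p) ⟩
    ι.⟦ K.0# ⟧ * s 0 + lin (s ∘ suc) p  ≈⟨ +-congʳ (trans (*-congʳ ι.0-homo) (zeroˡ _)) ⟩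
    0# + lin (s ∘ suc) p  ≈⟨ +-identityˡ _ ⟩
    lin (s ∘ suc) p  ∎

  private module K[x] = RingKit (Poly K)

  lin-X^ : ∀ n s p → lin s (mulP (X K[x].^ n) p) ≈ lin (λ i → s (n ℕ.+ i)) p
  lin-X^ zero    s p = lin-cong s (mul-identityˡ p)
  lin-X^ (suc n) s p = trans (lin-cong s (mul-assoc X (X K[x].^ n) p)) (trans (lin-X s (mulP (X K[x].^ n) p)) (lin-X^ n (s ∘ suc) p))

  -- The K-linear map K[x] → B sending x^i to θ^{i/n} when n divides i and to 0 otherwise:
  -- the coefficient of x^0 in B[x]/(x^n − θ).
  module Coordinate (n : ℕ) .{{_ : ℕ.NonZero n}} (θ : Carrier) where

    weight : ℕ → ℕ → Carrier
    weight zero    j = θ ^ j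
    weight (suc _) j = 0#

    basis : ℕ → Carrier
    basis i = weight (i ℕDM.% n) (i ℕDM./ n)

    basis-period : ∀ i → basis (n ℕ.+ i) ≈ θ * basis i
    basis-period i = trans (reflexive (≡.cong₂ weight (≡.trans (≡.cong (ℕDM._% n) (ℕₚ.+-comm n i)) (ℕDM.[m+n]%n≡m%n i n))
      (≡.trans (ℕDM.m/n≡1+[m∸n]/n (ℕₚ.m≤m+n n i)) (≡.cong (λ j → suc (j ℕDM./ n)) (ℕₚ.m+n∸m≡n n i))))) (step (i ℕDM.% n) (i ℕDM./ n))
      where
      step : ∀ r j → weight r (suc j) ≈ θ * weight r j
      step zero    j = refl
      step (suc r) j = sym (zeroʳ θ)

    coordinate : List K.Carrier → Carrier
    coordinate = lin basis

    coordinate-period : ∀ p → coordinate (mulP (X K[x].^ n) p) ≈ θ * coordinate p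
    coordinate-period p = trans (lin-X^ n basis p) (trans (lin-congˢ basis-period p) (lin-scaleˢ θ basis p))

    basis-zero : basis 0 ≈ 1#
    basis-zero = reflexive (≡.cong₂ weight (ℕDM.m<n⇒m%n≡m (ℕₚ.n≢0⇒n>0 (ℕ.≢-nonZero⁻¹ n))) (ℕDM.0/n≡0 n))

    coordinate-const : ∀ c → coordinate (const c) ≈ ι.⟦ c ⟧
    coordinate-const c = trans (+-identityʳ _) (trans (*-congˡ basis-zero) (*-identityʳ _))

    coordinate-monomial : ∀ c i → coordinate (mulP (X K[x].^ i) (const c)) ≈ ι.⟦ c ⟧ * basis i
    coordinate-monomial c i = begin
      coordinate (mulP (X K[x].^ i) (const c))  ≈⟨ lin-X^ i basis (const c) ⟩
      ι.⟦ c ⟧ * basis (i ℕ.+ 0) + 0#  ≈⟨ +-identityʳ _ ⟩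
      ι.⟦ c ⟧ * basis (i ℕ.+ 0)  ≡⟨ ≡.cong (λ j → ι.⟦ c ⟧ * basis j) (ℕₚ.+-identityʳ i) ⟩
      ι.⟦ c ⟧ * basis i  ∎

-- Almost integral elements and traces

module AlmostIntegral (R : Ring) where
  open RingKit R

  -- u/q is almost integral, with common denominator e for its powers.
  record AlmostInt (q e u : Carrier) : Set where
    field power : ∀ i → ∃ λ E → e * u ^ i ≈ q ^ i * E
  open AlmostInt public

  ai-cong : ∀ {q q′ e e′ u u′} → q ≈ q′ → e ≈ e′ → u ≈ u′ → AlmostInt q e u → AlmostInt q′ e′ u′
  ai-cong q≈ e≈ u≈ h .power i with power h i
  ... | E , eq = E , trans (*-cong (sym e≈) (^-congˡ i (sym u≈))) (trans eq (*-congʳ (^-congˡ i q≈)))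

  ai-* : ∀ {q e u} r → AlmostInt q e u → AlmostInt q e (r * u)
  ai-* {q} {e} {u} r h .power i with power h i
  ... | E , eq = r ^ i * E , (begin
    e * (r * u) ^ i  ≈⟨ *-congˡ (^-distrib-* r u i) ⟩
    e * (r ^ i * u ^ i)  ≈⟨ solve 3 (λ e r u → e :* (r :* u) := r :* (e :* u)) refl _ _ _ ⟩
    r ^ i * (e * u ^ i)  ≈⟨ *-congˡ eq ⟩
    r ^ i * (q ^ i * E)  ≈⟨ solve 3 (λ r q E → r :* (q :* E) := q :* (r :* E)) refl _ _ _ ⟩
    q ^ i * (r ^ i * E)  ∎)

  -- The product `e e′` clears every mixed monomial `(u/q)^i (v/q)^j`, hence every power of the sum.
  -- The induction in `mixed` distributes one factor `u + v` at a time, so no binomial coefficients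
  -- appear.
  ai-+ : ∀ {q e e′ u v} → AlmostInt q e u → AlmostInt q e′ v → AlmostInt q (e * e′) (u + v)
  ai-+ {q} {e} {e′} {u} {v} hu hv .power n with mixed n 0 0
    where
    mixed : ∀ n i j → ∃ λ E → (e * e′) * ((u ^ i * v ^ j) * (u + v) ^ n) ≈ (q ^ i * q ^ j) * q ^ n * E
    mixed zero i j with power hu i | power hv j
    ... | E , eq | E′ , eq′ = E * E′ , (begin
      (e * e′) * ((u ^ i * v ^ j) * 1#)  ≈⟨ *-congˡ (*-identityʳ _) ⟩
      (e * e′) * (u ^ i * v ^ j)  ≈⟨ solve 4 (λ e e′ u v → (e :* e′) :* (u :* v) := (e :* u) :* (e′ :* v)) refl _ _ _ _ ⟩
      (e * u ^ i) * (e′ * v ^ j)  ≈⟨ *-cong eq eq′ ⟩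
      (q ^ i * E) * (q ^ j * E′)  ≈⟨ solve 4 (λ a E b E′ → (a :* E) :* (b :* E′) := (a :* b) :* (E :* E′)) refl _ _ _ _ ⟩
      (q ^ i * q ^ j) * (E * E′)  ≈⟨ *-congʳ (*-identityʳ _) ⟨
      (q ^ i * q ^ j) * 1# * (E * E′)  ∎)
    mixed (suc n) i j with mixed n (suc i) j | mixed n i (suc j)
    ... | E , eq | E′ , eq′ = E + E′ , (begin
      (e * e′) * ((u ^ i * v ^ j) * ((u + v) * (u + v) ^ n))
        ≈⟨ solve 6 (λ ε a b u v w → ε :* ((a :* b) :* ((u :+ v) :* w)) := ε :* (((u :* a) :* b) :* w) :+ ε :* ((a :*
          (v :* b)) :* w)) refl _ _ _ _ _ _ ⟩
      (e * e′) * ((u ^ suc i * v ^ j) * (u + v) ^ n) + (e * e′) * ((u ^ i * v ^ suc j) * (u + v) ^ n)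
        ≈⟨ +-cong eq eq′ ⟩
      (q ^ suc i * q ^ j) * q ^ n * E + (q ^ i * q ^ suc j) * q ^ n * E′
        ≈⟨ solve 6 (λ q a b c E E′ → ((q :* a) :* b) :* c :* E :+ (a :* (q :* b)) :* c :* E′ := (a :* b) :* (q :* c) :* (E :+ E′)) refl _ _ _ _ _ _ ⟩
      (q ^ i * q ^ j) * q ^ suc n * (E + E′) ∎)
  ... | E , eq = E , (begin
    (e * e′) * (u + v) ^ n  ≈⟨ *-congˡ (trans (*-congʳ (*-identityˡ _)) (*-identityˡ _)) ⟨
    (e * e′) * ((1# * 1#) * (u + v) ^ n)  ≈⟨ eq ⟩
    (1# * 1#) * q ^ n * E  ≈⟨ *-congʳ (trans (*-congʳ (*-identityˡ _)) (*-identityˡ _)) ⟩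
    q ^ n * E  ∎)

  sumTo : ℕ → (ℕ → Carrier) → Carrier
  sumTo zero    f = 0#
  sumTo (suc n) f = f n + sumTo n f

  sumTo-cong : ∀ n {f g} → (∀ i → f i ≈ g i) → sumTo n f ≈ sumTo n g
  sumTo-cong zero    e = refl
  sumTo-cong (suc n) e = +-cong (e n) (sumTo-cong n e)

  sumTo-* : ∀ n c f → sumTo n (λ i → c * f i) ≈ c * sumTo n f
  sumTo-* zero    c f = sym (zeroʳ c)
  sumTo-* (suc n) c f = trans (+-congˡ (sumTo-* n c f)) (sym (distribˡ _ _ _))

  sumTo-+ : ∀ n f g → sumTo n (λ i → f i + g i) ≈ sumTo n f + sumTo n g
  sumTo-+ zero    f g = sym (+-identityʳ _)
  sumTo-+ (suc n) f g = trans (+-congˡ (sumTo-+ n f g))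
    (solve 4 (λ a b c d → (a :+ b) :+ (c :+ d) := (a :+ c) :+ (b :+ d)) refl _ _ _ _)

  ai-sum : ∀ n {q e} f → (∀ l → AlmostInt q e (f l)) → AlmostInt q (e ^ n) (sumTo n f)
  ai-sum zero f h .power zero = 1# , refl
  ai-sum zero f h .power (suc i) = 0# , trans (*-congˡ (zeroˡ _)) (trans (zeroʳ _) (sym (zeroʳ _)))
  ai-sum (suc n) f h = ai-+ (h n) (ai-sum n f h)

  geometric : ℕ → Carrier → Carrier
  geometric n u = sumTo n (u ^_)

  geometric-telescope : ∀ n u → (u - 1#) * geometric n u ≈ u ^ n - 1#
  geometric-telescope zero    u = trans (zeroʳ _) (sym (-‿inverseʳ 1#))
  geometric-telescope (suc n) u = begin
    (u - 1#) * (u ^ n + geometric n u)  ≈⟨ distribˡ _ _ _ ⟩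
    (u - 1#) * u ^ n + (u - 1#) * geometric n u  ≈⟨ +-congˡ (geometric-telescope n u) ⟩
    -- The solver reads the integer constant 1 as `1# + 0#`; therefore `1#` enters as a variable
    -- `o`, and the surplus `w - o w` is cancelled in the next step.
    (u - 1#) * u ^ n + (u ^ n - 1#)  ≈⟨ solve 3 (λ u o w → (u :- o) :* w :+ (w :- o) := u :* w :- o :+ (w :- o :* w)) refl u 1# (u ^ n) ⟩
    u * u ^ n - 1# + (u ^ n - 1# * u ^ n)  ≈⟨ +-congˡ (trans (+-congˡ (-‿cong (*-identityˡ _))) (-‿inverseʳ _)) ⟩
    u * u ^ n - 1# + 0#  ≈⟨ +-identityʳ _ ⟩
    u * u ^ n - 1#  ∎

  geometric-fixed : ∀ n {u σ} → u * σ ≈ σ → geometric n u * σ ≈ (n · 1#) * σ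
  geometric-fixed n {u} {σ} uσ≈σ = go n
    where
    fixed^ : ∀ n → u ^ n * σ ≈ σ
    fixed^ zero    = *-identityˡ σ
    fixed^ (suc n) = trans (*-assoc _ _ _) (trans (*-congˡ (fixed^ n)) uσ≈σ)
    go : ∀ n → geometric n u * σ ≈ (n · 1#) * σ
    go zero    = refl
    go (suc n) = begin
      (u ^ n + geometric n u) * σ  ≈⟨ distribʳ _ _ _ ⟩
      u ^ n * σ + geometric n u * σ  ≈⟨ +-cong (trans (fixed^ n) (sym (*-identityˡ σ))) (go n) ⟩
      1# * σ + n · 1# * σ  ≈⟨ distribʳ _ _ _ ⟨
      (1# + n · 1#) * σ  ∎

module Iteration (R : Ring) (p : ℕ) (a : CommutativeRing.Carrier R) where
  open RingKit R

  it : ℕ → Carrier → Carrier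
  it zero    u = u
  it (suc n) u = it n u ^ p - a

  -- `it` adds each new `f` on the outside, whereas the map from one `R_n` to the next substitutes
  -- `f` on the inside.
  it-comm : ∀ n u → it n (u ^ p - a) ≈ it (suc n) u
  it-comm zero    u = refl
  it-comm (suc n) u = +-congʳ (^-congˡ p (it-comm n u))

open Iteration using (it; it-comm)

it-cong₂ : ∀ (R : Ring) → let open CommutativeRing R in ∀ p n {a b u v} → a ≈ b → u ≈ v → it R p a n u ≈ it R p b n v
it-cong₂ R p zero    a≈b u≈v = u≈v
it-cong₂ R p (suc n) a≈b u≈v = +-cong (^-congˡ p (it-cong₂ R p n a≈b u≈v)) (-‿cong a≈b)
  where open RingKit R

hom-it : ∀ {A B} (h : Hom A B) → let open Hom h in ∀ p a n u →
         CommutativeRing._≈_ B ⟦ it A p a n u ⟧ (it B p ⟦ a ⟧ n ⟦ u ⟧)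
hom-it {A} {B} h p a zero    u = CommutativeRing.refl B
hom-it {A} {B} h p a (suc n) u = begin
  ⟦ it A p a n u A.^ p A.- a ⟧  ≈⟨ trans (+-homo _ _) (+-cong (^-homo _ p) (neg-homo a)) ⟩
  ⟦ it A p a n u ⟧ ^ p - ⟦ a ⟧  ≈⟨ +-congʳ (^-congˡ p (hom-it h p a n u)) ⟩
  it B p ⟦ a ⟧ n ⟦ u ⟧ ^ p - ⟦ a ⟧  ∎
  where
  open Hom h
  module A = RingKit A
  open RingKit B

ℤᴿ : Ring
ℤᴿ = ℤₚ.+-*-commutativeRing

module ℤK = RingKit ℤᴿ

ℤ-·1 : ∀ n → n ℤK.· (+ 1) ≡ + n
ℤ-·1 zero    = ≡.refl
ℤ-·1 (suc n) = ≡.cong ℤ.suc (ℤ-·1 n)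

hom-·1 : ∀ {A B} (h : Hom A B) n → CommutativeRing._≈_ B (Hom.⟦_⟧ h (RingKit._·_ A n (CommutativeRing.1# A))) (RingKit._·_ B n (CommutativeRing.1# B))
hom-·1 h zero = Hom.0-homo h
hom-·1 {B = B} h (suc n) = trans (Hom.+-homo h _ _) (+-cong (Hom.1-homo h) (hom-·1 h n))
  where open CommutativeRing B

ai-hom : ∀ {A B} (h : Hom A B) → let open Hom h in ∀ {q e u} →
  AlmostIntegral.AlmostInt A q e u → AlmostIntegral.AlmostInt B ⟦ q ⟧ ⟦ e ⟧ ⟦ u ⟧
ai-hom {A} {B} h {q} {e} {u} ai .AlmostIntegral.AlmostInt.power i with AlmostIntegral.AlmostInt.power ai i
... | E , eq = ⟦ E ⟧ , (begin
  ⟦ e ⟧ * ⟦ u ⟧ ^ i  ≈⟨ *-congˡ (^-homo u i) ⟨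
  ⟦ e ⟧ * ⟦ u A.^ i ⟧  ≈⟨ *-homo _ _ ⟨
  ⟦ e A.* u A.^ i ⟧  ≈⟨ cong eq ⟩
  ⟦ q A.^ i A.* E ⟧  ≈⟨ *-homo _ _ ⟩
  ⟦ q A.^ i ⟧ * ⟦ E ⟧  ≈⟨ *-congʳ (^-homo q i) ⟩
  ⟦ q ⟧ ^ i * ⟦ E ⟧  ∎)
  where
  open Hom h
  module A = RingKit A
  open RingKit B

-- Sums over the p-th roots of unity

module RootOfUnity (S : Ring) {p : ℕ} (p-prime : Prime p) (T : CommutativeRing.Carrier S) where
  open RingKit S
  open AlmostIntegral S
  open RingFacts S using (1^)

  module Primitive (T^p≈1 : T ^ p ≈ 1#) (sum≈0 : geometric p T ≈ 0#) where

    private instance _ = prime⇒nonZero p-prime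

    T^[pn]≈1 : ∀ n → T ^ (p ℕ.* n) ≈ 1#
    T^[pn]≈1 n = trans (sym (^-assocʳ T p n)) (trans (^-congˡ n T^p≈1) (1^ n))

    T^[np]≈1 : ∀ n → T ^ (n ℕ.* p) ≈ 1#
    T^[np]≈1 n = trans (^-congʳ T (ℕₚ.*-comm n p)) (T^[pn]≈1 n)

    -- Multiplying by p replaces p-torsion-freeness of ℤ[T].
    sum-of-powers≈0 : ∀ k → Coprime k p → (p · 1#) * geometric p (T ^ k) ≈ 0#
    sum-of-powers≈0 k k⊥p = begin
      -- `T^k` fixes `σ` because `(T^k - 1) σ = T^(kp) - 1 = 0`. By Bézout `T` is a power of `T^k`,
      -- so it fixes `σ` too; then `1 + T + ... + T^(p-1)`, which is zero, acts on `σ` as `p`.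
      (p · 1#) * σ  ≈⟨ geometric-fixed p (Tσ≈σ (coprime-Bézout k⊥p)) ⟨
      geometric p T * σ  ≈⟨ trans (*-congʳ sum≈0) (zeroˡ σ) ⟩
      0#  ∎
      where
      σ = geometric p (T ^ k)
      T^kσ≈σ : T ^ k * σ ≈ σ
      T^kσ≈σ = begin
        T ^ k * σ  ≈⟨ +-identityʳ _ ⟨
        T ^ k * σ + 0#  ≈⟨ +-congˡ (-‿inverseˡ _) ⟨
        T ^ k * σ + (- (1# * σ) + 1# * σ)  ≈⟨ solve 3 (λ t o s → t :* s :+ ((:- (o :* s)) :+ o :* s) := (t :- o) :* s :+ o :* s) refl (T ^ k) 1# σ ⟩
        (T ^ k - 1#) * σ + 1# * σ  ≈⟨ +-cong (geometric-telescope p (T ^ k)) (*-identityˡ σ) ⟩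
        ((T ^ k) ^ p - 1#) + σ  ≈⟨ +-congʳ (trans (+-congʳ (trans (^-assocʳ T k p) (T^[np]≈1 k))) (-‿inverseʳ 1#)) ⟩
        0# + σ  ≈⟨ +-identityˡ σ ⟩
        σ  ∎
      T^[xk]σ≈σ : ∀ x → T ^ (x ℕ.* k) * σ ≈ σ
      T^[xk]σ≈σ zero    = *-identityˡ σ
      T^[xk]σ≈σ (suc x) = begin
        T ^ (k ℕ.+ x ℕ.* k) * σ  ≈⟨ *-congʳ (^-homo-* T k (x ℕ.* k)) ⟩
        T ^ k * T ^ (x ℕ.* k) * σ  ≈⟨ *-assoc _ _ _ ⟩
        T ^ k * (T ^ (x ℕ.* k) * σ)  ≈⟨ trans (*-congˡ (T^[xk]σ≈σ x)) T^kσ≈σ ⟩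
        σ  ∎
      Tσ≈σ : Bézout.Identity 1 k p → T * σ ≈ σ
      Tσ≈σ (Bézout.+- x y 1+yp≡xk) = begin
        T * σ  ≈⟨ *-congʳ (trans (*-congˡ (T^[np]≈1 y)) (*-identityʳ T)) ⟨
        T ^ (1 ℕ.+ y ℕ.* p) * σ  ≈⟨ *-congʳ (^-congʳ T 1+yp≡xk) ⟩
        T ^ (x ℕ.* k) * σ  ≈⟨ T^[xk]σ≈σ x ⟩
        σ  ∎
      Tσ≈σ (Bézout.-+ x y 1+xk≡yp) = begin
        T * σ  ≈⟨ *-congˡ (T^[xk]σ≈σ x) ⟨
        T * (T ^ (x ℕ.* k) * σ)  ≈⟨ *-assoc _ _ _ ⟨
        T ^ (1 ℕ.+ x ℕ.* k) * σ  ≈⟨ *-congʳ (trans (^-congʳ T 1+xk≡yp) (T^[np]≈1 y)) ⟩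
        1# * σ  ≈⟨ *-identityˡ σ ⟩
        σ  ∎

    geometric-1 : ∀ n → geometric n 1# ≈ n · 1#
    geometric-1 zero    = refl
    geometric-1 (suc n) = +-cong (1^ n) (geometric-1 n)

    module _ {K : Ring} (ι : Hom K S) (u : Carrier) where
      private
        module ι = Hom ι
        ev[_] : ℕ → List (CommutativeRing.Carrier K) → Carrier
        ev[ l ] = ev ι (u * T ^ l)
      open LinearFunctional ι
      open Coordinate p (u ^ p)

      private
        T^k≈1 : ∀ k → k ℕDM.% p ≡ 0 → T ^ k ≈ 1#
        T^k≈1 k k%p≡0 = trans (^-congʳ T (ℕD._∣_.equality (ℕD.m%n≡0⇒n∣m k p k%p≡0))) (T^[np]≈1 (k ℕDM./ p))

        -- Orthogonality of characters: the sum is `u^k` times the sum of the `(T^k)^l`, which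
        -- contributes `p` when `p ∣ k` and otherwise vanishes after multiplication by `p`. One
        -- factor `p` on the right is this contribution, the other is the multiplier from
        -- `sum-of-powers≈0`.
        monomials : ∀ k → (p · 1#) * sumTo p (λ l → (u * T ^ l) ^ k) ≈ ((p · 1#) * (p · 1#)) * basis k
        monomials k = trans (*-congˡ (trans (sumTo-cong p powers) (sumTo-* p (u ^ k) ((T ^ k) ^_)))) (by-residue (k ℕDM.% p) ≡.refl)
          where
          powers : ∀ l → (u * T ^ l) ^ k ≈ u ^ k * (T ^ k) ^ l
          powers l = trans (^-distrib-* u (T ^ l) k) (*-congˡ (trans (^-assocʳ T l k) (trans (^-congʳ T (ℕₚ.*-comm l k)) (sym (^-assocʳ T k l)))))
          by-residue : ∀ r → k ℕDM.% p ≡ r → (p · 1#) * (u ^ k * geometric p (T ^ k)) ≈ ((p · 1#) * (p · 1#)) * weight r (k ℕDM./ p)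
          by-residue zero k%p≡0 = begin
            (p · 1#) * (u ^ k * geometric p (T ^ k))
              ≈⟨ *-congˡ (*-cong (trans (^-congʳ u k≡) (sym (^-assocʳ u p (k ℕDM./ p)))) (trans (sumTo-cong p (λ l → ^-congˡ l
                (T^k≈1 k k%p≡0))) (geometric-1 p))) ⟩
            (p · 1#) * ((u ^ p) ^ (k ℕDM./ p) * (p · 1#))
              ≈⟨ solve 2 (λ p w → p :* (w :* p) := (p :* p) :* w) refl _ _ ⟩
            ((p · 1#) * (p · 1#)) * (u ^ p) ^ (k ℕDM./ p) ∎
            where
            k≡ : k ≡ p ℕ.* (k ℕDM./ p)
            k≡ = ≡.trans (ℕDM.m≡m%n+[m/n]*n k p) (≡.trans (≡.cong (ℕ._+ (k ℕDM./ p) ℕ.* p) k%p≡0) (ℕₚ.*-comm (k ℕDM./ p) p))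
          by-residue (suc r) k%p≡ = begin
            (p · 1#) * (u ^ k * geometric p (T ^ k))  ≈⟨ solve 3 (λ p u g → p :* (u :* g) := u :* (p :* g)) refl _ _ _ ⟩
            u ^ k * ((p · 1#) * geometric p (T ^ k))  ≈⟨ *-congˡ (sum-of-powers≈0 k k⊥p) ⟩
            u ^ k * 0#  ≈⟨ trans (zeroʳ _) (sym (zeroʳ _)) ⟩
            ((p · 1#) * (p · 1#)) * 0#  ∎
            where
            k⊥p : Coprime k p
            k⊥p {d} (d∣k , d∣p) = prime⇒coprime p-prime {{ℕ.nonZero}} r<p
              (d∣p , ≡.subst (d ℕD.∣_) k%p≡ (ℕD.%-presˡ-∣ d∣k d∣p))
              where
              r<p : suc r ℕ.< p
              r<p = ≡.subst (ℕ._< p) k%p≡ (ℕDM.m%n<n k p)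

        -- The exponent `k` counts the coefficients already consumed by Horner's recursion; the case
        -- of interest is `k = 0`.
        shifted : ∀ k C → (p · 1#) * sumTo p (λ l → (u * T ^ l) ^ k * ev[ l ] C) ≈ ((p · 1#) * (p · 1#)) * lin (λ i → basis (k ℕ.+ i)) C
        shifted k []  = begin
          (p · 1#) * sumTo p (λ l → (u * T ^ l) ^ k * 0#)  ≈⟨ *-congˡ (trans (sumTo-cong p (λ l → *-comm _ _)) (trans (sumTo-* p 0# _) (zeroˡ _))) ⟩
          (p · 1#) * 0#  ≈⟨ trans (zeroʳ _) (sym (zeroʳ _)) ⟩
          ((p · 1#) * (p · 1#)) * 0#  ∎
        shifted k (c ∷ C) = begin
          P * sumTo p (λ l → v l ^ k * (ι.⟦ c ⟧ + v l * ev[ l ] C))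
            ≈⟨ *-congˡ (sumTo-cong p (λ l → solve 4 (λ w c v e → w :* (c :+ v :* e) := c :* w :+ (v :* w) :* e) refl _ _ _ _)) ⟩
          P * sumTo p (λ l → ι.⟦ c ⟧ * v l ^ k + v l ^ suc k * ev[ l ] C)
            ≈⟨ *-congˡ (trans (sumTo-+ p _ _) (+-congʳ (sumTo-* p _ _))) ⟩
          P * (ι.⟦ c ⟧ * sumTo p (λ l → v l ^ k) + sumTo p (λ l → v l ^ suc k * ev[ l ] C))
            ≈⟨ solve 4 (λ P c s t → P :* (c :* s :+ t) := c :* (P :* s) :+ P :* t) refl _ _ _ _ ⟩
          ι.⟦ c ⟧ * (P * sumTo p (λ l → v l ^ k)) + P * sumTo p (λ l → v l ^ suc k * ev[ l ] C)
            ≈⟨ +-cong (*-congˡ (monomials k)) (shifted (suc k) C) ⟩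
          ι.⟦ c ⟧ * ((P * P) * basis k) + (P * P) * lin (λ i → basis (suc k ℕ.+ i)) C
            ≈⟨ solve 4 (λ c P b t → c :* ((P :* P) :* b) :+ (P :* P) :* t := (P :* P) :* (c :* b :+ t)) refl _ _ _ _ ⟩
          (P * P) * (ι.⟦ c ⟧ * basis k + lin (λ i → basis (suc k ℕ.+ i)) C)
            ≈⟨ *-congˡ (+-cong (*-congˡ (reflexive (≡.cong basis (≡.sym (ℕₚ.+-identityʳ k))))) (lin-congˢ (λ i → reflexive (≡.cong basis
              (≡.sym (ℕₚ.+-suc k i)))) C)) ⟩
          (P * P) * lin (λ i → basis (k ℕ.+ i)) (c ∷ C) ∎
          where
          P = p · 1#
          v : ℕ → Carrier
          v l = u * T ^ l

      -- The trace formula for `x^p = θ` with `θ = u^p`: the trace is `p` times the coordinate at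
      -- `x^0`. A further `p` stands on both sides.
      sum-of-conjugates : ∀ C → (p · 1#) * sumTo p (λ l → ev ι (u * T ^ l) C) ≈ ((p · 1#) * (p · 1#)) * coordinate C
      sum-of-conjugates C = trans (*-congˡ (sumTo-cong p (λ l → sym (*-identityˡ _)))) (shifted 0 C)

hom-coordinate : ∀ {K A B} (ι : Hom K A) (ι′ : Hom K B) (h : Hom A B) →
  (∀ c → CommutativeRing._≈_ B (Hom.⟦_⟧ h (Hom.⟦_⟧ ι c)) (Hom.⟦_⟧ ι′ c)) →
  ∀ n .{{_ : ℕ.NonZero n}} {θ θ′} → CommutativeRing._≈_ B (Hom.⟦_⟧ h θ) θ′ → ∀ p →
  CommutativeRing._≈_ B (Hom.⟦_⟧ h (LinearFunctional.Coordinate.coordinate ι n θ p))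
                        (LinearFunctional.Coordinate.coordinate ι′ n θ′ p)
hom-coordinate {K} {A} {B} ι ι′ h hι n {θ} {θ′} hθ = go (λ i → weights (i ℕDM.% n) (i ℕDM./ n))
  where
  open RingKit B
  open Hom h
  weights : ∀ r j → ⟦ LinearFunctional.Coordinate.weight ι n θ r j ⟧ ≈ LinearFunctional.Coordinate.weight ι′ n θ′ r j
  weights zero    j = trans (^-homo θ j) (^-congˡ j hθ)
  weights (suc r) j = 0-homo
  go : ∀ {s t} → (∀ i → ⟦ s i ⟧ ≈ t i) → ∀ p → ⟦ LinearFunctional.lin ι s p ⟧ ≈ LinearFunctional.lin ι′ t p
  go e []      = 0-homo
  go e (c ∷ p) = trans (+-homo _ _) (+-cong (trans (*-homo _ _) (*-cong (hι c) (e 0))) (go (e ∘ suc) p))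

hom-geometric : ∀ {A B} (h : Hom A B) → let open Hom h in ∀ n u →
  CommutativeRing._≈_ B ⟦ AlmostIntegral.geometric A n u ⟧ (AlmostIntegral.geometric B n ⟦ u ⟧)
hom-geometric h zero u = Hom.0-homo h
hom-geometric {B = B} h (suc n) u = trans (Hom.+-homo h _ _) (+-cong (Hom.^-homo h u n) (hom-geometric h n u))
  where open CommutativeRing B

-- Multiplicativity of `κ` is not asked for: almost integrality of an element of `R` says that
-- certain elements of `R` are divisible by `q^i`, and linearity carries such a divisibility from
-- `S` back to `R`.
record Retraction {R S : Ring} (c : Hom R S) : Set where
  private
    module R = RingKit R
    module c = Hom c
  open RingKit S
  field
    κ  : Carrier → R.Carrier
    κ-cong   : ∀ {x y} → x ≈ y → κ x R.≈ κ y
    κ-linear : ∀ r x → κ (c.⟦ r ⟧ * x) R.≈ r R.* κ x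
    κ-1  : κ 1# R.≈ R.1#

  ai-retract : ∀ {q e u} → AlmostIntegral.AlmostInt S c.⟦ q ⟧ c.⟦ e ⟧ c.⟦ u ⟧ → AlmostIntegral.AlmostInt R q e u
  ai-retract {q} {e} {u} ai .AlmostIntegral.AlmostInt.power i with AlmostIntegral.AlmostInt.power ai i
  ... | E , eq = κ E , (R.begin
    e R.* u R.^ i  R.≈⟨ R.*-identityʳ _ ⟨
    e R.* u R.^ i R.* R.1#  R.≈⟨ R.*-congˡ κ-1 ⟨
    e R.* u R.^ i R.* κ 1#  R.≈⟨ κ-linear _ _ ⟨
    κ (c.⟦ e R.* u R.^ i ⟧ * 1#)  R.≈⟨ κ-cong (trans (*-identityʳ _) (trans (c.*-homo e (u R.^ i)) (*-congˡ (c.^-homo u i)))) ⟩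
    κ (c.⟦ e ⟧ * c.⟦ u ⟧ ^ i)  R.≈⟨ κ-cong eq ⟩
    κ (c.⟦ q ⟧ ^ i * E)  R.≈⟨ κ-cong (*-congʳ (c.^-homo q i)) ⟨
    κ (c.⟦ q R.^ i ⟧ * E)  R.≈⟨ κ-linear _ E ⟩
    q R.^ i R.* κ E  R.∎)

-- The retraction κ of R[T]/(1 + T + ⋯ + T^{p−1}) onto R takes the coordinate at T^0 minus
-- the coordinate at T^{−1}, which is zero on multiples of 1 + T + ⋯ + T^{p−1}.
module Cyclotomic (R : Ring) (p : ℕ) (p-prime : Prime p) where
  private
    instance _ = prime⇒nonZero p-prime
    module R    = RingKit R
    module R[T] = RingKit (Poly R)
    module ΣT   = AlmostIntegral (Poly R)
  open PolyBase R

  N : List R.Carrier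
  N = ΣT.geometric p X

  S : Ring
  S = Quot (Poly R) N

  open RingKit S
  open AlmostIntegral S using (geometric; geometric-telescope)

  constant : Hom R S
  constant = project (Poly R) N ∘ₕ constHom

  sum≈0 : geometric p X ≈ 0#
  sum≈0 = trans (sym (hom-geometric (project (Poly R) N) p X)) (modulus≈0 (Poly R) N)

  T^p≈1 : X ^ p ≈ 1#
  T^p≈1 = RingFacts.geometric-unit S {X} {geometric p X} {X ^ p} (geometric-telescope p X) sum≈0

  private
    open LinearFunctional (idHom R)
    open Coordinate p R.1#
    ε = coordinate

    κ : List R.Carrier → R.Carrier
    κ P = ε P R.- ε (mulP X P)

    ε-periodic : ∀ P → ε (mulP (X R[T].^ p) P) R.≈ ε P
    ε-periodic P = R.trans (coordinate-period P) (R.*-identityˡ _)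

    -- Since `(X - 1) N = X^p - 1`, the product `X Q N` differs from `Q N` by `X^p Q - Q`, on which
    -- `ε` vanishes by periodicity.
    κ-N : ∀ Q → κ (mulP Q N) R.≈ R.0#
    κ-N Q = R.begin
      ε QN R.- ε (mulP X QN)  R.≈⟨ R.+-congˡ (R.-‿cong XQN) ⟩
      ε QN R.- ε QN  R.≈⟨ R.-‿inverseʳ _ ⟩
      R.0#  R.∎
      where
      QN = mulP Q N
      XQN≋ : mulP X QN R[T].≈ QN R[T].+ (mulP (X R[T].^ p) Q R[T].- Q)
      XQN≋ = RingFacts.geometric-step (Poly R) {X} {N} {X R[T].^ p} Q (ΣT.geometric-telescope p X)
      ε-neg : ∀ P → ε (negP P) R.≈ R.- ε P
      ε-neg P = R.begin
        ε (negP P)  R.≈⟨ R.solve 2 (λ a b → a R.:= (a R.:+ b) R.:- b) R.refl _ (ε P) ⟩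
        (ε (negP P) R.+ ε P) R.- ε P  R.≈⟨ R.+-congʳ (lin-add basis (negP P) P) ⟨
        ε (addP (negP P) P) R.- ε P  R.≈⟨ R.+-congʳ (lin-[] basis _ (R[T].-‿inverseˡ P)) ⟩
        R.0# R.- ε P  R.≈⟨ R.+-identityˡ _ ⟩
        R.- ε P  R.∎
      XQN : ε (mulP X QN) R.≈ ε QN
      XQN = R.begin
        ε (mulP X QN)  R.≈⟨ lin-cong basis XQN≋ ⟩
        ε (addP QN (addP (mulP (X R[T].^ p) Q) (negP Q)))  R.≈⟨ lin-add basis QN _ ⟩
        ε QN R.+ ε (addP (mulP (X R[T].^ p) Q) (negP Q))  R.≈⟨ R.+-congˡ (lin-add basis (mulP (X R[T].^ p) Q) (negP Q)) ⟩
        ε QN R.+ (ε (mulP (X R[T].^ p) Q) R.+ ε (negP Q))  R.≈⟨ R.+-congˡ (R.+-cong (ε-periodic Q) (ε-neg Q)) ⟩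
        ε QN R.+ (ε Q R.- ε Q)  R.≈⟨ R.+-congˡ (R.-‿inverseʳ _) ⟩
        ε QN R.+ R.0#  R.≈⟨ R.+-identityʳ _ ⟩
        ε QN  R.∎

    κ-cong : ∀ {P Q} → P R[T].≈ Q → κ P R.≈ κ Q
    κ-cong e = R.+-cong (lin-cong basis e) (R.-‿cong (lin-cong basis (mul-congˡ X e)))

    κ-add : ∀ P Q → κ (addP P Q) R.≈ κ P R.+ κ Q
    κ-add P Q = R.begin
      ε (addP P Q) R.- ε (mulP X (addP P Q))
        R.≈⟨ R.+-cong (lin-add basis P Q) (R.-‿cong (R.trans (lin-cong basis (mul-distribˡ X P Q)) (lin-add basis (mulP X P) (mulP X Q)))) ⟩
      (ε P R.+ ε Q) R.- (ε (mulP X P) R.+ ε (mulP X Q))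
        R.≈⟨ R.solve 4 (λ a b c d → (a R.:+ b) R.:- (c R.:+ d) R.:= (a R.:- c) R.:+ (b R.:- d)) R.refl _ _ _ _ ⟩
      κ P R.+ κ Q R.∎

    κ-descends : ∀ {P Q} → P ≈ Q → κ P R.≈ κ Q
    κ-descends {P} {Q} (U , e) = R.begin
      κ P  R.≈⟨ κ-cong e ⟩
      κ (addP Q (mulP U N))  R.≈⟨ κ-add Q (mulP U N) ⟩
      κ Q R.+ κ (mulP U N)  R.≈⟨ R.+-congˡ (κ-N U) ⟩
      κ Q R.+ R.0#  R.≈⟨ R.+-identityʳ _ ⟩
      κ Q  R.∎

    κ-const* : ∀ c P → κ (mulP (const c) P) R.≈ c R.* κ P
    κ-const* c P = R.begin
      ε (mulP (const c) P) R.- ε (mulP X (mulP (const c) P))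
        R.≈⟨ R.+-cong (lin-const basis c P) (R.-‿cong (R.trans (lin-cong basis (RingFacts.*-swap (Poly R) X (const c) P)) (lin-const basis c
          (mulP X P)))) ⟩
      c R.* ε P R.- c R.* ε (mulP X P)
        R.≈⟨ R.solve 3 (λ c a b → c R.:* a R.:- c R.:* b R.:= c R.:* (a R.:- b)) R.refl _ _ _ ⟩
      c R.* κ P R.∎

    κ-1 : κ (const R.1#) R.≈ R.1#
    κ-1 = R.begin
      (R.1# R.* basis 0 R.+ R.0#) R.- ε (mulP X (const R.1#))
        R.≈⟨ R.+-cong (R.trans (R.+-identityʳ _) (R.trans (R.*-identityˡ _) basis-zero)) (R.-‿cong εX) ⟩
      R.1# R.- R.0#  R.≈⟨ R.trans (R.+-congˡ R.-0#≈0#) (R.+-identityʳ _) ⟩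
      R.1#  R.∎
      where
      -- Needed for the coordinate of `X` to vanish; for `p = 1` every exponent would be a multiple
      -- of `p`.
      1<p : 1 ℕ.< p
      1<p = ℕ.nonTrivial⇒n>1 p {{prime⇒nonTrivial p-prime}}
      basis-1 : basis 1 R.≈ R.0#
      basis-1 = R.reflexive (≡.cong (λ r → weight r (1 ℕDM./ p)) (ℕDM.m<n⇒m%n≡m 1<p))
      εX : ε (mulP X (const R.1#)) R.≈ R.0#
      εX = R.begin
        ε (mulP X (const R.1#))  R.≈⟨ lin-X basis (const R.1#) ⟩
        R.1# R.* basis 1 R.+ R.0#  R.≈⟨ R.+-identityʳ _ ⟩
        R.1# R.* basis 1  R.≈⟨ R.trans (R.*-identityˡ _) basis-1 ⟩
        R.0#  R.∎

  retraction : Retraction constant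
  retraction = record { κ = κ ; κ-cong = κ-descends ; κ-linear = κ-const* ; κ-1 = κ-1 }

record CyclotomicExtension (R : Ring) (p : ℕ) : Set₁ where
  field
    S  : Ring
    constant   : Hom R S
    retraction : Retraction constant
    T  : CommutativeRing.Carrier S
    T^p≈1  : CommutativeRing._≈_ S (RingKit._^_ S T p) (CommutativeRing.1# S)
    sum≈0  : CommutativeRing._≈_ S (AlmostIntegral.geometric S p T) (CommutativeRing.0# S)

cyclotomicExtension : ∀ R p → Prime p → CyclotomicExtension R p
cyclotomicExtension R p p-prime = record
  { S = S ; constant = constant ; retraction = retraction ; T = PolyBase.X R ; T^p≈1 = T^p≈1 ; sum≈0 = sum≈0 }
  where open Cyclotomic R p p-prime

-- G plays the role of the projection of A = A₀[x]/(x^p − θ) onto A₀.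
module Reconstruction (A : Ring) (p : ℕ) (x : CommutativeRing.Carrier A) where
  open RingKit A

  module Projection (G : Carrier → Carrier) (G-cong : ∀ {u v} → u ≈ v → G u ≈ G v)
    (G-add : ∀ u v → G (u + v) ≈ G u + G v)
    (G-period : ∀ u → G (x ^ p * u) ≈ x ^ p * G u) where

    -- This is the sum of `x^(j-1-i) G(x^i u)` over `i < j`. For `u = c x^m` with `c` from the base
    -- ring and `0 ≤ m < p`, exactly one of the terms with `i < p` survives, and it equals
    -- `x^(p-1) u`: hence the later formula `partialSum p u = x^(p-1) u`.
    partialSum : ℕ → Carrier → Carrier
    partialSum zero    u = 0#
    partialSum (suc j) u = x * partialSum j u + G (x ^ j * u)

    partialSum-cong : ∀ j {u v} → u ≈ v → partialSum j u ≈ partialSum j v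
    partialSum-cong zero    e = refl
    partialSum-cong (suc j) e = +-cong (*-congˡ (partialSum-cong j e)) (G-cong (*-congˡ e))

    partialSum-add : ∀ j u v → partialSum j (u + v) ≈ partialSum j u + partialSum j v
    partialSum-add zero    u v = sym (+-identityˡ 0#)
    partialSum-add (suc j) u v = begin
      x * partialSum j (u + v) + G (x ^ j * (u + v))
        ≈⟨ +-cong (*-congˡ (partialSum-add j u v)) (trans (G-cong (distribˡ _ _ _)) (G-add _ _)) ⟩
      x * (partialSum j u + partialSum j v) + (G (x ^ j * u) + G (x ^ j * v))
        ≈⟨ solve 5 (λ x a b c d → x :* (a :+ b) :+ (c :+ d) := (x :* a :+ c) :+ (x :* b :+ d)) refl _ _ _ _ _ ⟩
      partialSum (suc j) u + partialSum (suc j) v ∎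

    partialSum-shift : ∀ j u → partialSum (suc j) u ≈ x ^ j * G u + partialSum j (x * u)
    partialSum-shift zero    u = begin
      x * 0# + G (1# * u)  ≈⟨ +-cong (zeroʳ x) (G-cong (*-identityˡ u)) ⟩
      0# + G u  ≈⟨ +-comm _ _ ⟩
      G u + 0#  ≈⟨ +-congʳ (*-identityˡ _) ⟨
      1# * G u + 0#  ∎
    partialSum-shift (suc j) u = begin
      x * partialSum (suc j) u + G (x ^ suc j * u)
        ≈⟨ +-cong (*-congˡ (partialSum-shift j u)) (G-cong (solve 3 (λ x w u → (x :* w) :* u := w :* (x :* u)) refl _ _ _)) ⟩
      x * (x ^ j * G u + partialSum j (x * u)) + G (x ^ j * (x * u))
        ≈⟨ solve 5 (λ x w g s h → x :* (w :* g :+ s) :+ h := (x :* w) :* g :+ (x :* s :+ h)) refl _ _ _ _ _ ⟩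
      x ^ suc j * G u + partialSum (suc j) (x * u) ∎

    -- The sum with `p + 1` terms is computed twice, by splitting off its last term and by splitting
    -- off its first; by `G-period` the two split-off terms agree.
    partialSum-x : ∀ u → partialSum p (x * u) ≈ x * partialSum p u
    partialSum-x u = begin
      partialSum p (x * u)
        ≈⟨ solve 2 (λ a b → a := (b :+ a) :- b) refl _ (x ^ p * G u) ⟩
      (x ^ p * G u + partialSum p (x * u)) - x ^ p * G u
        ≈⟨ +-congʳ (partialSum-shift p u) ⟨
      (x * partialSum p u + G (x ^ p * u)) - x ^ p * G u
        ≈⟨ +-congʳ (+-congˡ (G-period u)) ⟩
      (x * partialSum p u + x ^ p * G u) - x ^ p * G u
        ≈⟨ solve 2 (λ a b → (a :+ b) :- b := a) refl _ _ ⟩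
      x * partialSum p u ∎

    partialSum-base : ∀ u → G u ≈ u → (∀ j → suc j ℕ.< p → G (x ^ suc j * u) ≈ 0#) → ∀ j → j ℕ.< p → partialSum (suc j) u ≈ x ^ j * u
    partialSum-base u G₀ G₊ zero    _   = trans (+-cong (zeroʳ x) (trans (G-cong (*-identityˡ u)) G₀)) (trans (+-identityˡ u) (sym (*-identityˡ u)))
    partialSum-base u G₀ G₊ (suc j) j<p = begin
      x * partialSum (suc j) u + G (x ^ suc j * u)  ≈⟨ +-cong (*-congˡ (partialSum-base u G₀ G₊ j (ℕₚ.<-trans (ℕₚ.n<1+n j) j<p))) (G₊ j j<p) ⟩
      x * (x ^ j * u) + 0#  ≈⟨ trans (+-identityʳ _) (sym (*-assoc _ _ _)) ⟩
      x ^ suc j * u  ∎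

    partialSum-multiple : ∀ q u → (∀ j → ∃ λ D → G (x ^ j * u) ≈ q * D) → ∀ j → ∃ λ D → partialSum j u ≈ q * D
    partialSum-multiple q u h zero    = 0# , sym (zeroʳ q)
    partialSum-multiple q u h (suc j) with partialSum-multiple q u h j | h j
    ... | D , e | D′ , e′ = x * D + D′ , trans (+-cong (*-congˡ e) e′)
      (solve 4 (λ x q d d′ → x :* (q :* d) :+ q :* d′ := q :* (x :* d :+ d′)) refl _ _ _ _)

-- The tower of the rings R_n

ℤ[x]ᴿ : Ring
ℤ[x]ᴿ = Poly ℤᴿ

module Zx = RingKit ℤ[x]ᴿ

infix 9 ℤ[x]/_
ℤ[x]/_ : List ℤ → Ring
ℤ[x]/ g = Quot ℤ[x]ᴿ g

π/ : ∀ g → Hom ℤ[x]ᴿ (ℤ[x]/ g)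
π/ g = project ℤ[x]ᴿ g

const/ : ∀ g → Hom ℤᴿ (ℤ[x]/ g)
const/ g = π/ g ∘ₕ PolyBase.constHom ℤᴿ

-- The iterate is taken at the element `X` of the ring `ℤ[x]`, so that `hom-it` computes its image
-- under any homomorphism.
F : ℕ → ℤ → ℕ → List ℤ
F p a n = it ℤ[x]ᴿ p (PolyBase.const ℤᴿ a) n (PolyBase.X ℤᴿ)

module Tower (p : ℕ) (p-prime : Prime p) (a : ℤ) where
  instance p≢0 = prime⇒nonZero p-prime

  open PolyBase ℤᴿ hiding (polyRing)
  ev-F : ∀ {B} (ι : Hom ℤᴿ B) v n → CommutativeRing._≈_ B (ev ι v (F p a n)) (it B p (Hom.⟦_⟧ ι a) n v)
  ev-F {B} ι v n = CommutativeRing.trans B (hom-it (evHom ι v) p (const a) n X) (it-cong₂ B p n (ev-const ι v a) (ev-X ι v))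

  it≈0 : ∀ n → CommutativeRing._≈_ (ℤ[x]/ F p a n) (it (ℤ[x]/ F p a n) p (const a) n X) []
  it≈0 n = trans (sym (hom-it (π/ (F p a n)) p (const a) n X)) (modulus≈0 ℤ[x]ᴿ (F p a n))
    where open CommutativeRing (ℤ[x]/ F p a n)

  f : List ℤ
  f = (X Zx.^ p) Zx.- const a

  module Step (n : ℕ) where
    private
      module A₀ = RingKit (ℤ[x]/ F p a n)
      module A  = RingKit (ℤ[x]/ F p a (suc n))

    -- If `α` is a root of `f^(n+1)`, then `f(α)` is a root of `f^n`; thus substituting `f` for `x`
    -- realises the inclusion of `R_n` in `R_(n+1)`.
    φ₀ : Hom ℤ[x]ᴿ ℤ[x]ᴿ
    φ₀ = evHom constHom f

    module φ₀ = Hom φ₀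

    φ₀-F : φ₀.⟦ F p a n ⟧ ≋ F p a (suc n)
    φ₀-F = ≋-trans (ev-F constHom f n) (it-comm ℤ[x]ᴿ p (const a) n X)

    φ : Hom (ℤ[x]/ F p a n) (ℤ[x]/ F p a (suc n))
    φ = descend ℤ[x]ᴿ (F p a n) (π/ (F p a (suc n)) ∘ₕ φ₀) (A.trans (Hom.cong (π/ (F p a (suc n))) φ₀-F) (modulus≈0 ℤ[x]ᴿ (F p a (suc n))))

    module φ = Hom φ

    φ-const : ∀ c → φ.⟦ const c ⟧ A.≈ const c
    φ-const c = Hom.cong (π/ (F p a (suc n))) (ev-const constHom f c)

    -- The generator of `R_n` becomes `x^p - a` in `R_(n+1)`, so adding `a` gives the element whose
    -- p-th root is adjoined.
    θ : List ℤ
    θ = addP X (const a)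

    φ-θ : φ.⟦ θ ⟧ A.≈ X A.^ p
    φ-θ = A.trans (φ.+-homo X (const a)) (A.trans
      (A.+-cong (A.trans (Hom.cong (π/ (F p a (suc n))) (ev-X constHom f)) (A.+-congʳ (Hom.^-homo (π/ (F p a (suc n))) X p))) (φ-const a))
      (RingFacts.+-cancel (ℤ[x]/ F p a (suc n)) (X A.^ p) (const a)))

    open LinearFunctional (const/ (F p a n))
    open Coordinate p θ

    -- The projection of `R_(n+1)`, the direct sum of the `x^i R_n` for `i < p`, onto the summand
    -- `i = 0`; the trace is `p` times it. It is defined on representatives and descends to the
    -- quotient by `L-cong`.
    L : List ℤ → List ℤ
    L = coordinate

    L-f : ∀ B → L (mulP f B) A₀.≈ X A₀.* L B
    L-f B = begin
      L (mulP f B)  ≈⟨ lin-cong basis (mul-distribʳ B (X Zx.^ p) (const (ℤ.- a))) ⟩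
      L (addP (mulP (X Zx.^ p) B) (mulP (const (ℤ.- a)) B))  ≈⟨ lin-add basis (mulP (X Zx.^ p) B) (mulP (const (ℤ.- a)) B) ⟩
      L (mulP (X Zx.^ p) B) + L (mulP (const (ℤ.- a)) B)  ≈⟨ +-cong (coordinate-period B) (lin-const basis (ℤ.- a) B) ⟩
      θ * L B + - const a * L B  ≈⟨ RingFacts.+-cancel-* (ℤ[x]/ F p a n) X (const a) (L B) ⟩
      X * L B  ∎
      where open A₀

    L-φ : ∀ P B → L (mulP φ₀.⟦ P ⟧ B) A₀.≈ P A₀.* L B
    L-φ []      B = A₀.refl
    L-φ (c ∷ P) B = begin
      L (mulP (addP (const c) (mulP f φ₀.⟦ P ⟧)) B)
        ≈⟨ lin-cong basis (≋-trans (mul-distribʳ B (const c) (mulP f φ₀.⟦ P ⟧)) (add-cong (≋-refl {mulP (const c) B}) (mul-assoc f φ₀.⟦ P ⟧ B))) ⟩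
      L (addP (mulP (const c) B) (mulP f (mulP φ₀.⟦ P ⟧ B)))
        ≈⟨ lin-add basis (mulP (const c) B) (mulP f (mulP φ₀.⟦ P ⟧ B)) ⟩
      L (mulP (const c) B) + L (mulP f (mulP φ₀.⟦ P ⟧ B))
        ≈⟨ +-cong (lin-const basis c B) (trans (L-f (mulP φ₀.⟦ P ⟧ B)) (*-congˡ {x = X} (L-φ P B))) ⟩
      const c * L B + X * (P * L B)
        ≈⟨ +-congˡ {x = const c * L B} (*-assoc X P (L B)) ⟨
      const c * L B + X * P * L B
        ≈⟨ distribʳ (L B) (const c) (X * P) ⟨
      (const c + X * P) * L B
        ≈⟨ *-congʳ {x = L B} (Hom.cong (π/ (F p a n)) (∷-as-sum c P)) ⟨
      (c ∷ P) * L B ∎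
      where open A₀

    -- The modulus of `R_(n+1)` is the image under `φ₀` of the modulus of `R_n`, so by `L-φ` its
    -- multiples are sent to multiples of the latter.
    L-cong : ∀ {B C} → B A.≈ C → L B A₀.≈ L C
    L-cong {B} {C} (U , e) = begin
      L B  ≈⟨ lin-cong basis e ⟩
      L (addP C (mulP U (F p a (suc n))))  ≈⟨ lin-add basis C (mulP U (F p a (suc n))) ⟩
      L C + L (mulP U (F p a (suc n)))  ≈⟨ +-congˡ {x = L C} (lin-cong basis (≋-trans (mul-comm U (F p a (suc n))) (mul-cong (≋-sym φ₀-F)
        (≋-refl {U})))) ⟩
      L C + L (mulP φ₀.⟦ F p a n ⟧ U)  ≈⟨ +-congˡ {x = L C} (L-φ (F p a n) U) ⟩
      L C + F p a n * L U  ≈⟨ +-congˡ {x = L C} (trans (*-congʳ {x = L U} (modulus≈0 ℤ[x]ᴿ (F p a n))) (zeroˡ (L U))) ⟩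
      L C + 0#  ≈⟨ +-identityʳ (L C) ⟩
      L C  ∎
      where open A₀

    L-const : ∀ c → L (const c) A₀.≈ const c
    L-const = coordinate-const

    retractionL : Retraction φ
    retractionL = record { κ = L ; κ-cong = L-cong ; κ-linear = L-φ ; κ-1 = L-const (+ 1) }

    p² : ∀ A → CommutativeRing.Carrier A
    p² A = RingKit._*_ A (RingKit._·_ A p (CommutativeRing.1# A)) (RingKit._·_ A p (CommutativeRing.1# A))

    hom-p² : ∀ {A B} (h : Hom A B) → CommutativeRing._≈_ B (Hom.⟦_⟧ h (p² A)) (p² B)
    hom-p² {A} {B} h = CommutativeRing.trans B (Hom.*-homo h _ _) (CommutativeRing.*-cong B (hom-·1 h p) (hom-·1 h p))

    module Trace (ext : CyclotomicExtension (ℤ[x]/ F p a (suc n)) p) (q e : ℤ) {C : List ℤ}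
                 (ai : AlmostIntegral.AlmostInt (ℤ[x]/ F p a (suc n)) (const q) (const e) C) where
      private
        module Ext = CyclotomicExtension ext
        open Ext using (S; constant; retraction; T)
        module c = Hom constant
        open RingKit S
        open AlmostIntegral S
        open RootOfUnity.Primitive S p-prime T Ext.T^p≈1 Ext.sum≈0 using (sum-of-conjugates; T^[np]≈1)

        ιS : Hom ℤᴿ S
        ιS = constant ∘ₕ const/ (F p a (suc n))

        x : Carrier
        x = c.⟦ X ⟧

        -- `f^(n+1)(x)` depends on `x` only through `x^p`, and `(x T^l)^p = x^p`. This makes `x`
        -- going to `x T^l` a homomorphism on `R_(n+1)`, namely the conjugation `ρ l`.
        kills : ∀ l → ev ιS (x * T ^ l) (F p a (suc n)) ≈ 0#
        kills l = begin
          ev ιS (x * T ^ l) (F p a (suc n))  ≈⟨ ev-F ιS (x * T ^ l) (suc n) ⟩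
          it S p c.⟦ const a ⟧ (suc n) (x * T ^ l)  ≈⟨ it-comm S p c.⟦ const a ⟧ n (x * T ^ l) ⟨
          it S p c.⟦ const a ⟧ n ((x * T ^ l) ^ p - c.⟦ const a ⟧)
            ≈⟨ it-cong₂ S p n refl (+-congʳ same-power) ⟩
          it S p c.⟦ const a ⟧ n (x ^ p - c.⟦ const a ⟧) ≈⟨ it-comm S p c.⟦ const a ⟧ n x ⟩
          it S p c.⟦ const a ⟧ (suc n) x  ≈⟨ hom-it constant p (const a) (suc n) X ⟨
          c.⟦ it (ℤ[x]/ F p a (suc n)) p (const a) (suc n) X ⟧  ≈⟨ trans (c.cong (it≈0 (suc n))) c.0-homo ⟩
          0#  ∎
          where
          same-power : (x * T ^ l) ^ p ≈ x ^ p
          same-power = trans (^-distrib-* x (T ^ l) p)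
            (trans (*-congˡ (trans (^-assocʳ T l p) (T^[np]≈1 l))) (*-identityʳ _))

        ρ : ℕ → Hom (ℤ[x]/ F p a (suc n)) S
        ρ l = descend ℤ[x]ᴿ (F p a (suc n)) (evHom ιS (x * T ^ l)) (kills l)

        conjugate : ∀ l → AlmostInt c.⟦ const q ⟧ c.⟦ const e ⟧ (ev ιS (x * T ^ l) C)
        conjugate l = ai-cong (ev-const ιS (x * T ^ l) q) (ev-const ιS (x * T ^ l) e) refl (ai-hom (ρ l) ai)

        coordA : List ℤ
        coordA = LinearFunctional.Coordinate.coordinate (const/ (F p a (suc n))) p (X A.^ p) C

        trace-in-S : p² S * LinearFunctional.Coordinate.coordinate ιS p (x ^ p) C ≈ c.⟦ p² (ℤ[x]/ F p a (suc n)) A.* coordA ⟧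
        trace-in-S = sym (trans (c.*-homo (p² (ℤ[x]/ F p a (suc n))) coordA) (*-cong (hom-p² constant) (hom-coordinate (const/ (F p a
          (suc n))) ιS constant (λ _ → refl) p (c.^-homo X p) C)))

        trace-in-A : p² (ℤ[x]/ F p a (suc n)) A.* coordA A.≈ φ.⟦ p² (ℤ[x]/ F p a n) A₀.* L C ⟧
        trace-in-A = A.sym (A.trans (φ.*-homo (p² (ℤ[x]/ F p a n)) (L C)) (A.*-cong (hom-p² φ) (hom-coordinate (const/ (F p a n)) (const/
          (F p a (suc n))) φ φ-const p φ-θ C)))

      -- Each conjugate of `C` has denominator `e`, so the sum of the `p` conjugates has denominator
      -- `e^p`. Multiplied by `p` it equals `p² L C`, an element of `R_n`, and two retractions bring
      -- its almost integrality from `S` through `R_(n+1)` down to `R_n`.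
      ai-trace : AlmostIntegral.AlmostInt (ℤ[x]/ F p a n) (const q) (const (e ℤK.^ p)) (p² (ℤ[x]/ F p a n) A₀.* L C)
      ai-trace = Retraction.ai-retract retractionL
        (AlmostIntegral.ai-cong (ℤ[x]/ F p a (suc n)) (A.sym (φ-const q)) (A.trans (A.sym (Hom.^-homo (const/ (F p a (suc n))) e p)) (A.sym
          (φ-const (e ℤK.^ p)))) trace-in-A
          (Retraction.ai-retract retraction
            (ai-cong refl (sym (c.^-homo (const e) p)) (trans (sum-of-conjugates ιS x C) trace-in-S)
              (ai-* (p · 1#) (ai-sum p _ conjugate)))))

    ai-L : ∀ (q e : ℤ) {C} → AlmostIntegral.AlmostInt (ℤ[x]/ F p a (suc n)) (const q) (const e) C →
           AlmostIntegral.AlmostInt (ℤ[x]/ F p a n) (const q) (const (e ℤK.^ p)) (p² (ℤ[x]/ F p a n) A₀.* L C)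
    ai-L q e ai = Trace.ai-trace (cyclotomicExtension (ℤ[x]/ F p a (suc n)) p p-prime) q e ai

    private
      G : List ℤ → List ℤ
      G u = φ.⟦ L u ⟧

      G-add : ∀ u v → G (u A.+ v) A.≈ G u A.+ G v
      G-add u v = A.trans (φ.cong (lin-add basis u v)) (φ.+-homo (L u) (L v))

      X^-project : ∀ j → X Zx.^ j A.≈ X A.^ j
      X^-project j = Hom.^-homo (π/ (F p a (suc n))) X j

      G-period : ∀ u → G ((X A.^ p) A.* u) A.≈ (X A.^ p) A.* G u
      G-period u = A.trans (φ.cong (A₀.trans (L-cong (A.*-congʳ {x = u} (A.sym (X^-project p)))) (coordinate-period u)))
        (A.trans (φ.*-homo θ (L u)) (A.*-congʳ {x = G u} φ-θ))

      G-monomial : ∀ c j → suc j ℕ.< p → G ((X A.^ suc j) A.* const c) A.≈ A.0#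
      G-monomial c j j<p = A.trans (φ.cong (A₀.trans (L-cong (A.*-congʳ {x = const c} (A.sym (X^-project (suc j)))))
          (A₀.trans (coordinate-monomial c (suc j)) (A₀.trans (A₀.*-congˡ {x = const c} basis≈0) (A₀.zeroʳ (const c)))))) φ.0-homo
        where
        basis≈0 : basis (suc j) A₀.≈ A₀.0#
        basis≈0 = A₀.reflexive (≡.cong (λ r → weight r (suc j ℕDM./ p)) (ℕDM.m<n⇒m%n≡m j<p))

      open Reconstruction.Projection (ℤ[x]/ F p a (suc n)) p X G (λ e → φ.cong (L-cong e)) G-add G-period

      reconstruct-const : ∀ c → partialSum p (const c) A.≈ (X A.^ ℕ.pred p) A.* const c
      reconstruct-const c = ≡.subst (λ j → partialSum j (const c) A.≈ (X A.^ ℕ.pred p) A.* const c) (ℕₚ.suc-pred p)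
        (partialSum-base (const c) (A.trans (φ.cong (L-const c)) (φ-const c)) (G-monomial c) (ℕ.pred p) (ℕₚ.≤-reflexive (ℕₚ.suc-pred p)))

      -- Both sides are additive, commute with multiplication by `X` and agree on constants, so they
      -- agree along the Horner form of `B`.
      reconstruct : ∀ B → partialSum p B A.≈ (X A.^ ℕ.pred p) A.* B
      reconstruct []  = A.trans (partialSum-cong p {[]} {const (+ 0)} e) (A.trans (reconstruct-const (+ 0)) (A.*-congˡ
        {x = X A.^ ℕ.pred p} (A.sym e)))
        where
        e : [] A.≈ const (+ 0)
        e = Hom.cong (π/ (F p a (suc n))) (≋-sym 0∷[]≋[])
      reconstruct (c ∷ B) = begin
        partialSum p (c ∷ B)  ≈⟨ partialSum-cong p e ⟩
        partialSum p (const c + X * B)  ≈⟨ partialSum-add p (const c) (X * B) ⟩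
        partialSum p (const c) + partialSum p (X * B)  ≈⟨ +-cong (reconstruct-const c) (trans (partialSum-x B) (*-congˡ {x = X} (reconstruct B))) ⟩
        W * const c + X * (W * B)  ≈⟨ +-congˡ {x = W * const c} (RingFacts.*-swap (ℤ[x]/ F p a (suc n)) X W B) ⟩
        W * const c + W * (X * B)  ≈⟨ distribˡ W (const c) (X * B) ⟨
        W * (const c + X * B)  ≈⟨ *-congˡ {x = W} e ⟨
        W * (c ∷ B)  ∎
        where
        open A
        W = X ^ ℕ.pred p
        e : (c ∷ B) ≈ const c + X * B
        e = Hom.cong (π/ (F p a (suc n))) (∷-as-sum c B)

    -- The elements `L (x^j B)` determine `x^(p-1) B` by a linear formula with coefficients in the
    -- ring. Recovering `B` itself would require dividing by powers of `x`, which is left to the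
    -- stripping argument.
    L-multiple⇒multiple : ∀ q B → (∀ j → ∃ λ D → L ((X A.^ j) A.* B) A₀.≈ const q A₀.* D) →
                          ∃ λ D → (X A.^ ℕ.pred p) A.* B A.≈ const q A.* D
    L-multiple⇒multiple q B h = proj₁ total , A.trans (A.sym (reconstruct B)) (proj₂ total)
      where
      push : ∀ u → (∃ λ D → L u A₀.≈ const q A₀.* D) → ∃ λ D → G u A.≈ const q A.* D
      push u (D , e) = φ.⟦ D ⟧ , A.trans (φ.cong e) (A.trans (φ.*-homo (const q) D) (A.*-congʳ {x = φ.⟦ D ⟧} (φ-const q)))
      total : ∃ λ D → partialSum p B A.≈ const q A.* D
      total = partialSum-multiple (const q) B (λ j → push ((X A.^ j) A.* B) (h j)) p

-- Stripping a regular prime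

prime≢0 : ∀ {q} → Prime q → q ≢ 0
prime≢0 {q} q-prime = ℕ.≢-nonZero⁻¹ q {{prime⇒nonZero q-prime}}

prime≢1 : ∀ {q} → Prime q → q ≢ 1
prime≢1 q-prime = ℕ.nonTrivial⇒≢1 {{prime⇒nonTrivial q-prime}}

∤1 : ∀ {q} → Prime q → ¬ (+ q) ∣ + 1
∤1 q-prime q∣1 = prime≢1 q-prime (ℕD.∣1⇒≡1 (∣⇒∣ᵤ q∣1))

prime∣* : ∀ {q} → Prime q → ∀ i j → (+ q) ∣ i ℤ.* j → (+ q) ∣ i ⊎ (+ q) ∣ j
prime∣* {q} q-prime i j q∣ij with euclidsLemma ℤ.∣ i ∣ ℤ.∣ j ∣ q-prime (≡.subst (q ℕD.∣_) (ℤₚ.abs-* i j) (∣⇒∣ᵤ q∣ij))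
... | inj₁ q∣i = inj₁ (∣ᵤ⇒∣ q∣i)
... | inj₂ q∣j = inj₂ (∣ᵤ⇒∣ q∣j)

prime∣^ : ∀ {q} → Prime q → ∀ i n → (+ q) ∣ i ℤK.^ n → (+ q) ∣ i
prime∣^ {q} q-prime i zero q∣1 = contradiction q∣1 (∤1 q-prime)
prime∣^ q-prime i (suc n) q∣i^ = [ (λ h → h) , prime∣^ q-prime i n ]′ (prime∣* q-prime i (i ℤK.^ n) q∣i^)

prime-Bézout : ∀ {q} → Prime q → ∀ i → ¬ (+ q) ∣ i → ∃₂ λ u v → u ℤ.* i ℤ.+ v ℤ.* (+ q) ≡ + 1
prime-Bézout {q} q-prime i q∤i = signed i (natural (coprime-Bézout coprime))
  where
  coprime : Coprime ℤ.∣ i ∣ q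
  coprime (d∣i , d∣q) with prime⇒irreducible q-prime d∣q
  ... | inj₁ d≡1    = d≡1
  ... | inj₂ ≡.refl = contradiction (∣ᵤ⇒∣ d∣i) q∤i
  natural : ∀ {n} → Bézout.Identity 1 n q → ∃₂ λ u v → u ℤ.* (+ n) ℤ.+ v ℤ.* (+ q) ≡ + 1
  natural {n} (Bézout.+- x y eq) = + x , ℤ.- (+ y) , (begin
    (+ x) ℤ.* (+ n) ℤ.+ (ℤ.- (+ y)) ℤ.* (+ q)  ≡⟨ ≡.cong (ℤ._+ (ℤ.- (+ y)) ℤ.* (+ q)) (≡.sym (ℤₚ.pos-* x n)) ⟩
    + (x ℕ.* n) ℤ.+ (ℤ.- (+ y)) ℤ.* (+ q)  ≡⟨ ≡.cong (λ z → + z ℤ.+ (ℤ.- (+ y)) ℤ.* (+ q)) (≡.sym eq) ⟩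
    (+ 1 ℤ.+ + (y ℕ.* q)) ℤ.+ (ℤ.- (+ y)) ℤ.* (+ q)  ≡⟨ ≡.cong (λ z → (+ 1 ℤ.+ z) ℤ.+ (ℤ.- (+ y)) ℤ.* (+ q)) (ℤₚ.pos-* y q) ⟩
    (+ 1 ℤ.+ (+ y) ℤ.* (+ q)) ℤ.+ (ℤ.- (+ y)) ℤ.* (+ q)  ≡⟨ ℤK.solve 3 (λ o y q → (o ℤK.:+ y ℤK.:* q) ℤK.:+
      (ℤK.:- y) ℤK.:* q ℤK.:= o) ≡.refl (+ 1) (+ y) (+ q) ⟩
    + 1  ∎)
    where open ≡.≡-Reasoning
  natural {n} (Bézout.-+ x y eq) = ℤ.- (+ x) , + y , (begin
    (ℤ.- (+ x)) ℤ.* (+ n) ℤ.+ (+ y) ℤ.* (+ q)  ≡⟨ ≡.cong (λ z → (ℤ.- (+ x)) ℤ.* (+ n) ℤ.+ z) (≡.trans (≡.sym (ℤₚ.pos-* y q)) (≡.cong +_ (≡.sym eq))) ⟩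
    (ℤ.- (+ x)) ℤ.* (+ n) ℤ.+ (+ 1 ℤ.+ + (x ℕ.* n))  ≡⟨ ≡.cong (λ z → (ℤ.- (+ x)) ℤ.* (+ n) ℤ.+ (+ 1 ℤ.+ z)) (ℤₚ.pos-* x n) ⟩
    (ℤ.- (+ x)) ℤ.* (+ n) ℤ.+ (+ 1 ℤ.+ (+ x) ℤ.* (+ n))  ≡⟨ ℤK.solve 3 (λ o x n → (ℤK.:- x) ℤK.:* n ℤK.:+
      (o ℤK.:+ x ℤK.:* n) ℤK.:= o) ≡.refl (+ 1) (+ x) (+ n) ⟩
    + 1  ∎)
    where open ≡.≡-Reasoning
  signed : ∀ i → (∃₂ λ u v → u ℤ.* (+ ℤ.∣ i ∣) ℤ.+ v ℤ.* (+ q) ≡ + 1) → ∃₂ λ u v → u ℤ.* i ℤ.+ v ℤ.* (+ q) ≡ + 1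
  signed (+ n) h = h
  signed -[1+ n ] (u , v , e) = ℤ.- u , v , ≡.trans (≡.cong (ℤ._+ v ℤ.* (+ q)) (ℤK.solve 2 (λ u i → (ℤK.:- u) ℤK.:*
    (ℤK.:- i) ℤK.:= u ℤK.:* i) ≡.refl u (+ suc n))) e

prime-part : ∀ {q} → Prime q → ∀ n → n ≢ 0 → ∃₂ λ s m → n ≡ q ℕ.^ s ℕ.* m × ¬ q ℕD.∣ m
prime-part {q} q-prime = <-rec _ λ n rec n≢0 → split n rec n≢0
  where
  split : ∀ n → (∀ {m} → m ℕ.< n → m ≢ 0 → ∃₂ λ s k → m ≡ q ℕ.^ s ℕ.* k × ¬ q ℕD.∣ k) → n ≢ 0 → ∃₂ λ s m → n ≡ q ℕ.^ s ℕ.* m × ¬ q ℕD.∣ m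
  split n rec n≢0 with q ℕD.∣? n
  ... | no q∤n = 0 , n , ≡.sym (ℕₚ.+-identityʳ n) , q∤n
  ... | yes q∣n@(ℕD.divides m n≡mq) with rec (ℕD.quotient-< q∣n {{prime⇒nonTrivial q-prime}} {{ℕ.≢-nonZero n≢0}}) (λ m≡0 → n≢0
    (≡.trans n≡mq (≡.cong (ℕ._* q) m≡0)))
  ...   | s , k , m≡ , q∤k = suc s , k , (begin
    n  ≡⟨ n≡mq ⟩
    m ℕ.* q  ≡⟨ ≡.cong (ℕ._* q) m≡ ⟩
    q ℕ.^ s ℕ.* k ℕ.* q  ≡⟨ ℕₚ.*-comm _ q ⟩
    q ℕ.* (q ℕ.^ s ℕ.* k)  ≡⟨ ℕₚ.*-assoc q _ k ⟨
    q ℕ.* q ℕ.^ s ℕ.* k  ∎) , q∤k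
    where open ≡.≡-Reasoning

pos-^ : ∀ m n → (+ m) ℤK.^ n ≡ + (m ℕ.^ n)
pos-^ m zero    = ≡.refl
pos-^ m (suc n) = ≡.trans (≡.cong ((+ m) ℤ.*_) (pos-^ m n)) (≡.sym (ℤₚ.pos-* m (m ℕ.^ n)))

∣⇒≈0 : ∀ {m i} → m ∣ i → CommutativeRing._≈_ (Quot ℤᴿ m) i (+ 0)
∣⇒≈0 (divides c e) = c , ≡.trans e (≡.sym (ℤₚ.+-identityˡ _))

≈0⇒∣ : ∀ {m i} → CommutativeRing._≈_ (Quot ℤᴿ m) i (+ 0) → m ∣ i
≈0⇒∣ (c , e) = divides c (≡.trans e (ℤₚ.+-identityˡ _))

MultipleOf : (A : Ring) → let open CommutativeRing A in Carrier → Carrier → Set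
MultipleOf A Q u = ∃ λ D → u ≈ Q * D
  where open CommutativeRing A

module Multiples (A : Ring) (ι : Hom ℤᴿ A) {q : ℕ} (q-prime : Prime q) where
  open RingKit A
  open RingFacts A using (cancel-^)
  private module ι = Hom ι

  Q : Carrier
  Q = ι.⟦ + q ⟧

  MultipleOfQ : Carrier → Set
  MultipleOfQ = MultipleOf A Q

  cancel-unit : ∀ {ω} → ¬ (+ q) ∣ ω → ∀ C → MultipleOfQ (ι.⟦ ω ⟧ * C) → MultipleOfQ C
  cancel-unit {ω} q∤ω C (D , ωC≈QD) with prime-Bézout q-prime ω q∤ω
  ... | u , v , e = ι.⟦ u ⟧ * D + ι.⟦ v ⟧ * C , (begin
    C  ≈⟨ *-identityˡ C ⟨
    1# * C  ≈⟨ *-congʳ bézout ⟨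
    (ι.⟦ u ⟧ * ι.⟦ ω ⟧ + ι.⟦ v ⟧ * Q) * C  ≈⟨ solve 5 (λ u w v q c → (u :* w :+ v :* q) :* c := u :* (w :* c) :+ q :* (v :* c)) refl _ _ _ _ _ ⟩
    ι.⟦ u ⟧ * (ι.⟦ ω ⟧ * C) + Q * (ι.⟦ v ⟧ * C)  ≈⟨ +-congʳ (*-congˡ ωC≈QD) ⟩
    ι.⟦ u ⟧ * (Q * D) + Q * (ι.⟦ v ⟧ * C)  ≈⟨ solve 4 (λ u q d w → u :* (q :* d) :+ q :* w := q :* (u :* d :+ w)) refl _ _ _ _ ⟩
    Q * (ι.⟦ u ⟧ * D + ι.⟦ v ⟧ * C)  ∎)
    where
    bézout : ι.⟦ u ⟧ * ι.⟦ ω ⟧ + ι.⟦ v ⟧ * Q ≈ 1#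
    bézout = begin
      ι.⟦ u ⟧ * ι.⟦ ω ⟧ + ι.⟦ v ⟧ * Q  ≈⟨ +-cong (ι.*-homo u ω) (ι.*-homo v (+ q)) ⟨
      ι.⟦ u ℤ.* ω ⟧ + ι.⟦ v ℤ.* + q ⟧  ≈⟨ ι.+-homo _ _ ⟨
      ι.⟦ u ℤ.* ω ℤ.+ v ℤ.* + q ⟧  ≈⟨ ι.cong e ⟩
      ι.⟦ + 1 ⟧  ≈⟨ ι.1-homo ⟩
      1#  ∎

  -- Divisibility by q may be tested after multiplying by y if y is invertible modulo q …
  strip-unit : ∀ {m y h} → ¬ (+ q) ∣ m → ι.⟦ m ⟧ ≈ y * h → ∀ C → MultipleOfQ (y * C) → MultipleOfQ C
  strip-unit {m} {y} {h} q∤m m≈yh C (D , yC≈QD) = cancel-unit q∤m C (h * D , (begin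
    ι.⟦ m ⟧ * C  ≈⟨ *-congʳ m≈yh ⟩
    (y * h) * C  ≈⟨ solve 3 (λ y h c → (y :* h) :* c := h :* (y :* c)) refl _ _ _ ⟩
    h * (y * C)  ≈⟨ *-congˡ yC≈QD ⟩
    h * (Q * D)  ≈⟨ solve 3 (λ h q d → h :* (q :* d) := q :* (h :* d)) refl _ _ _ ⟩
    Q * (h * D)  ∎))

  -- … or if C/q is almost integral and (q, y) is a regular prime: q is locally associate to y^{1+e}.
  module StripRegular
    (torsion-free : ∀ m → m ≢ + 0 → ∀ {u v} → ι.⟦ m ⟧ * u ≈ ι.⟦ m ⟧ * v → u ≈ v)
    {y h : Carrier} {m : ℤ} (m≢0 : m ≢ + 0) (m≈yh : ι.⟦ m ⟧ ≈ y * h)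
    {F : Ring} (χ : Hom A F)
    where
    private
      module F = RingKit F
      module χ = Hom χ

    module _
      (F-integral : ∀ u v → u F.* v F.≈ F.0# → u F.≈ F.0# ⊎ v F.≈ F.0#) (F-nontrivial : ¬ F.1# F.≈ F.0#)
      (χ-Q : χ.⟦ Q ⟧ F.≈ F.0#) (χ-kernel : ∀ r → χ.⟦ ι.⟦ r ⟧ ⟧ F.≈ F.0# → (+ q) ∣ r)
      (χ-y : χ.⟦ y ⟧ F.≈ F.0#)
      (expand : ∀ u → ∃₂ λ r v → u ≈ ι.⟦ r ⟧ + y * v)
      (e : ℕ) (k w : Carrier) (y^k≈Qw : y ^ suc e * k ≈ Q * w)
      (χ-k : ¬ χ.⟦ k ⟧ F.≈ F.0#) (χ-w : ¬ χ.⟦ w ⟧ F.≈ F.0#)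
      where
      private
        q≢0 : + q ≢ + 0
        q≢0 q≡0 = prime≢0 q-prime (ℤₚ.+-injective q≡0)

      -- `y` divides the nonzero integer `m`, which is regular.
      y-regular : ∀ {u v} → y * u ≈ y * v → u ≈ v
      y-regular {u} {v} yu≈yv = torsion-free m m≢0 (begin
        ι.⟦ m ⟧ * u  ≈⟨ *-congʳ m≈yh ⟩
        (y * h) * u  ≈⟨ solve 3 (λ y h c → (y :* h) :* c := h :* (y :* c)) refl _ _ _ ⟩
        h * (y * u)  ≈⟨ *-congˡ yu≈yv ⟩
        h * (y * v)  ≈⟨ solve 3 (λ y h c → h :* (y :* c) := (y :* h) :* c) refl _ _ _ ⟩
        (y * h) * v  ≈⟨ *-congʳ m≈yh ⟨
        ι.⟦ m ⟧ * v  ∎)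

      Q-regular : ∀ {u v} → Q * u ≈ Q * v → u ≈ v
      Q-regular = torsion-free (+ q) q≢0

      χ-residue : ∀ {u r v} → u ≈ ι.⟦ r ⟧ + y * v → χ.⟦ u ⟧ F.≈ χ.⟦ ι.⟦ r ⟧ ⟧
      χ-residue {u} {r} {v} e = F.begin
        χ.⟦ u ⟧  F.≈⟨ χ.cong e ⟩
        χ.⟦ ι.⟦ r ⟧ + y * v ⟧  F.≈⟨ F.trans (χ.+-homo _ _) (F.+-congˡ (χ.*-homo y v)) ⟩
        χ.⟦ ι.⟦ r ⟧ ⟧ F.+ χ.⟦ y ⟧ F.* χ.⟦ v ⟧  F.≈⟨ F.+-congˡ (F.trans (F.*-congʳ χ-y) (F.zeroˡ _)) ⟩
        χ.⟦ ι.⟦ r ⟧ ⟧ F.+ F.0#  F.≈⟨ F.+-identityʳ _ ⟩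
        χ.⟦ ι.⟦ r ⟧ ⟧  F.∎

      F-reduced : ∀ u n → u F.^ n F.≈ F.0# → u F.≈ F.0#
      F-reduced u zero    e = contradiction e F-nontrivial
      F-reduced u (suc n) e = [ (λ u≈0 → u≈0) , F-reduced u n ]′ (F-integral u (u F.^ n) e)

      module _ {e₀ : ℕ} (e₀≢0 : e₀ ≢ 0) {C D : Carrier}
               (ai : AlmostIntegral.AlmostInt A Q ι.⟦ + e₀ ⟧ C) (yC≈QD : y * C ≈ Q * D) where

        private
          -- Formally `D/y = C/q`, so the common denominator `e₀` also serves for the powers of
          -- `D/y`.
          power-of-D : ∀ i → ∃ λ E → ι.⟦ + e₀ ⟧ * D ^ i ≈ y ^ i * E
          power-of-D i with AlmostIntegral.AlmostInt.power ai i
          ... | E , eq = E , cancel-^ Q-regular i (begin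
            Q ^ i * (ι.⟦ + e₀ ⟧ * D ^ i)  ≈⟨ solve 3 (λ q e d → q :* (e :* d) := e :* (q :* d)) refl _ _ _ ⟩
            ι.⟦ + e₀ ⟧ * (Q ^ i * D ^ i)  ≈⟨ *-congˡ (^-distrib-* Q D i) ⟨
            ι.⟦ + e₀ ⟧ * (Q * D) ^ i  ≈⟨ *-congˡ (^-congˡ i yC≈QD) ⟨
            ι.⟦ + e₀ ⟧ * (y * C) ^ i  ≈⟨ *-congˡ (^-distrib-* y C i) ⟩
            ι.⟦ + e₀ ⟧ * (y ^ i * C ^ i)  ≈⟨ solve 3 (λ e y c → e :* (y :* c) := y :* (e :* c)) refl _ _ _ ⟩
            y ^ i * (ι.⟦ + e₀ ⟧ * C ^ i)  ≈⟨ *-congˡ eq ⟩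
            y ^ i * (Q ^ i * E)  ≈⟨ solve 3 (λ y q E → y :* (q :* E) := q :* (y :* E)) refl _ _ _ ⟩
            Q ^ i * (y ^ i * E)  ∎)

          -- Locally `q` is `y^(1+e)` up to a unit, so the factor `q^s` of `e₀` absorbs only
          -- `(1+e) s` powers of `y`. Hence `k^s e′ D^i` is still a multiple of `y`, and modulo
          -- `(q, y)` neither `k` nor `e′` vanishes, which leaves `D`.
          residue-vanishes : ∀ s e′ → e₀ ≡ q ℕ.^ s ℕ.* e′ → ¬ q ℕD.∣ e′ →
            (∃ λ E → ι.⟦ + e₀ ⟧ * D ^ suc (suc e ℕ.* s) ≈ y ^ suc (suc e ℕ.* s) * E) → χ.⟦ D ⟧ F.≈ F.0#
          residue-vanishes s e′ e₀≡ q∤e′ (E , eq) = D-divisible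
            where
            N = suc e ℕ.* s
            -- One more than the power of `y` hidden in `e₀`, so that a single factor `y` survives
            -- the cancellation of `y^N`.
            i = suc N
            e₀-split : ι.⟦ + e₀ ⟧ ≈ Q ^ s * ι.⟦ + e′ ⟧
            e₀-split = begin
              ι.⟦ + e₀ ⟧  ≈⟨ ι.cong (≡.trans (≡.cong +_ e₀≡) (ℤₚ.pos-* (q ℕ.^ s) e′)) ⟩
              ι.⟦ + (q ℕ.^ s) ℤ.* + e′ ⟧  ≈⟨ ι.*-homo _ _ ⟩
              ι.⟦ + (q ℕ.^ s) ⟧ * ι.⟦ + e′ ⟧  ≈⟨ *-congʳ (ι.cong (≡.sym (pos-^ q s))) ⟩
              ι.⟦ (+ q) ℤK.^ s ⟧ * ι.⟦ + e′ ⟧  ≈⟨ *-congʳ (ι.^-homo (+ q) s) ⟩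
              Q ^ s * ι.⟦ + e′ ⟧  ∎
            Qw^s : Q ^ s * w ^ s ≈ y ^ N * k ^ s
            Qw^s = begin
              Q ^ s * w ^ s  ≈⟨ ^-distrib-* Q w s ⟨
              (Q * w) ^ s  ≈⟨ ^-congˡ s y^k≈Qw ⟨
              (y ^ suc e * k) ^ s  ≈⟨ ^-distrib-* (y ^ suc e) k s ⟩
              (y ^ suc e) ^ s * k ^ s  ≈⟨ *-congʳ (^-assocʳ y (suc e) s) ⟩
              y ^ N * k ^ s  ∎
            vanishing : k ^ s * ι.⟦ + e′ ⟧ * D ^ i ≈ y * (w ^ s * E)
            vanishing = cancel-^ y-regular N (begin
              y ^ N * (k ^ s * ι.⟦ + e′ ⟧ * D ^ i)  ≈⟨ solve 4 (λ y k e d → y :* (k :* e :* d) := (y :* k) :* (e :* d)) refl _ _ _ _ ⟩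
              (y ^ N * k ^ s) * (ι.⟦ + e′ ⟧ * D ^ i)  ≈⟨ *-congʳ Qw^s ⟨
              (Q ^ s * w ^ s) * (ι.⟦ + e′ ⟧ * D ^ i)  ≈⟨ solve 4 (λ q w e d → (q :* w) :* (e :* d) := w :* ((q :* e) :* d)) refl _ _ _ _ ⟩
              w ^ s * ((Q ^ s * ι.⟦ + e′ ⟧) * D ^ i)  ≈⟨ *-congˡ (*-congʳ e₀-split) ⟨
              w ^ s * (ι.⟦ + e₀ ⟧ * D ^ i)  ≈⟨ *-congˡ eq ⟩
              w ^ s * (y * y ^ N * E)  ≈⟨ solve 4 (λ w y z E → w :* (y :* z :* E) := z :* (y :* (w :* E))) refl _ _ _ _ ⟩
              y ^ N * (y * (w ^ s * E))  ∎)
            χ-vanishing : (χ.⟦ k ⟧ F.^ s F.* χ.⟦ ι.⟦ + e′ ⟧ ⟧) F.* χ.⟦ D ⟧ F.^ i F.≈ F.0#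
            χ-vanishing = F.begin
              (χ.⟦ k ⟧ F.^ s F.* χ.⟦ ι.⟦ + e′ ⟧ ⟧) F.* χ.⟦ D ⟧ F.^ i  F.≈⟨ F.*-cong (F.*-congʳ (χ.^-homo k s)) (χ.^-homo D i) ⟨
              (χ.⟦ k ^ s ⟧ F.* χ.⟦ ι.⟦ + e′ ⟧ ⟧) F.* χ.⟦ D ^ i ⟧  F.≈⟨ F.trans (χ.*-homo _ _) (F.*-congʳ (χ.*-homo _ _)) ⟨
              χ.⟦ k ^ s * ι.⟦ + e′ ⟧ * D ^ i ⟧  F.≈⟨ χ.cong vanishing ⟩
              χ.⟦ y * (w ^ s * E) ⟧  F.≈⟨ χ.*-homo _ _ ⟩
              χ.⟦ y ⟧ F.* χ.⟦ w ^ s * E ⟧  F.≈⟨ F.trans (F.*-congʳ χ-y) (F.zeroˡ _) ⟩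
              F.0#  F.∎
            D-divisible : χ.⟦ D ⟧ F.≈ F.0#
            D-divisible = [ (λ ke≈0 → [ (λ k^s≈0 → contradiction (F-reduced χ.⟦ k ⟧ s k^s≈0) χ-k)
                                      , (λ e′≈0 → contradiction (∣⇒∣ᵤ (χ-kernel (+ e′) e′≈0)) q∤e′) ]′ (F-integral _ _ ke≈0))
                          , F-reduced χ.⟦ D ⟧ i ]′ (F-integral _ _ χ-vanishing)

          residue-of-D : χ.⟦ D ⟧ F.≈ F.0#
          residue-of-D = from-prime-part (prime-part q-prime e₀ e₀≢0)
            where
            from-prime-part : (∃₂ λ s m → e₀ ≡ q ℕ.^ s ℕ.* m × ¬ q ℕD.∣ m) → χ.⟦ D ⟧ F.≈ F.0#
            from-prime-part (s , e′ , e₀≡ , q∤e′) = residue-vanishes s e′ e₀≡ q∤e′ (power-of-D (suc (suc e ℕ.* s)))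
          -- Now `D = q r′ + y D₂`. Multiplying `y C = Q D` by `y^e k` and using `y^(1+e) k = Q w`
          -- on both sides shows that `Q` divides `w C`. As `y C` is a multiple of `Q` anyway, `w`
          -- may be replaced by its residue `ω`, an integer prime to `q`.
          strip-expanded : ∀ {r D₂ ω w₂} → D ≈ ι.⟦ r ⟧ + y * D₂ → w ≈ ι.⟦ ω ⟧ + y * w₂ → (+ q) ∣ r → MultipleOfQ C
          strip-expanded {r} {D₂} {ω} {w₂} D≈ w≈ (divides r′ r≡) = cancel-unit q∤ω C (Z - w₂ * D , (begin
            ι.⟦ ω ⟧ * C  ≈⟨ solve 4 (λ o y w c → o :* c := (o :+ y :* w) :* c :- w :* (y :* c)) refl ι.⟦ ω ⟧ y w₂ C ⟩
            (ι.⟦ ω ⟧ + y * w₂) * C - w₂ * (y * C)  ≈⟨ +-cong (*-congʳ (sym w≈)) (-‿cong (*-congˡ yC≈QD)) ⟩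
            w * C - w₂ * (Q * D)  ≈⟨ +-congʳ wC ⟩
            Q * Z - w₂ * (Q * D)  ≈⟨ solve 4 (λ q z w d → q :* z :- w :* (q :* d) := q :* (z :- w :* d)) refl _ _ _ _ ⟩
            Q * (Z - w₂ * D)  ∎))
            where
            Z = y ^ e * k * ι.⟦ r′ ⟧ + w * D₂
            D≈′ : D ≈ Q * ι.⟦ r′ ⟧ + y * D₂
            D≈′ = trans D≈ (+-congʳ (trans (ι.cong r≡) (trans (ι.*-homo r′ (+ q)) (*-comm _ _))))
            wC : w * C ≈ Q * Z
            wC = Q-regular (begin
              Q * (w * C)  ≈⟨ *-assoc _ _ _ ⟨
              Q * w * C  ≈⟨ *-congʳ y^k≈Qw ⟨
              y * y ^ e * k * C  ≈⟨ solve 4 (λ y z k c → y :* z :* k :* c := (z :* k) :* (y :* c)) refl _ _ _ _ ⟩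
              (y ^ e * k) * (y * C)  ≈⟨ *-congˡ yC≈QD ⟩
              (y ^ e * k) * (Q * D)  ≈⟨ *-congˡ (*-congˡ D≈′) ⟩
              (y ^ e * k) * (Q * (Q * ι.⟦ r′ ⟧ + y * D₂))
                ≈⟨ solve 6 (λ z k q r y d → (z :* k) :* (q :* (q :* r :+ y :* d)) := q :* (q :* (z :* k :* r) :+
                  (y :* z :* k) :* d)) refl _ _ _ _ _ _ ⟩
              Q * (Q * (y ^ e * k * ι.⟦ r′ ⟧) + (y * y ^ e * k) * D₂)
                ≈⟨ *-congˡ (+-congˡ (*-congʳ y^k≈Qw)) ⟩
              Q * (Q * (y ^ e * k * ι.⟦ r′ ⟧) + (Q * w) * D₂)
                ≈⟨ solve 4 (λ q a w d → q :* (q :* a :+ (q :* w) :* d) := q :* (q :* (a :+ w :* d))) refl _ _ _ _ ⟩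
              Q * (Q * Z)  ∎)
            q∤ω : ¬ (+ q) ∣ ω
            q∤ω (divides c ω≡) = χ-w (F.begin
              χ.⟦ w ⟧  F.≈⟨ χ-residue w≈ ⟩
              χ.⟦ ι.⟦ ω ⟧ ⟧  F.≈⟨ χ.cong (trans (ι.cong ω≡) (ι.*-homo c (+ q))) ⟩
              χ.⟦ ι.⟦ c ⟧ * Q ⟧  F.≈⟨ χ.*-homo _ _ ⟩
              χ.⟦ ι.⟦ c ⟧ ⟧ F.* χ.⟦ Q ⟧  F.≈⟨ F.trans (F.*-congˡ χ-Q) (F.zeroʳ _) ⟩
              F.0#  F.∎)

        strip : MultipleOfQ C
        strip = from-expansions (expand D) (expand w)
          where
          from-expansions : (∃₂ λ r v → D ≈ ι.⟦ r ⟧ + y * v) → (∃₂ λ r v → w ≈ ι.⟦ r ⟧ + y * v) → MultipleOfQ C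
          from-expansions (r , D₂ , D≈) (ω , w₂ , w≈) = strip-expanded D≈ w≈ (χ-kernel r (F.trans (F.sym (χ-residue D≈)) residue-of-D))

-- Frobenius and congruences modulo p²

prime∣! : ∀ {p} → Prime p → ∀ n → p ℕD.∣ n ! → p ℕ.≤ n
prime∣! p-prime zero    p∣1  = contradiction (ℕD.∣1⇒≡1 p∣1) (prime≢1 p-prime)
prime∣! p-prime (suc n) p∣n! with euclidsLemma (suc n) (n !) p-prime p∣n!
... | inj₁ p∣1+n = ℕD.∣⇒≤ p∣1+n
... | inj₂ p∣n!  = ℕₚ.m≤n⇒m≤1+n (prime∣! p-prime n p∣n!)

-- `p` divides `p!`, the product of the binomial coefficient with `k!` and `(p-k)!`, but neither of
-- these factorials.
prime∣binomial : ∀ {p} → Prime p → ∀ {k} → 0 ℕ.< k → k ℕ.< p → p ℕD.∣ p Comb.C k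
prime∣binomial {p} p-prime {k} 0<k k<p with euclidsLemma (p Comb.C k) (k ! ℕ.* (p ℕ.∸ k) !) p-prime p∣C*d
  where
  instance _ = k ℕₚ.!* (p ℕ.∸ k) !≢0
  C*d≡p! : (p Comb.C k) ℕ.* (k ! ℕ.* (p ℕ.∸ k) !) ≡ p !
  C*d≡p! = ≡.trans (≡.cong (ℕ._* (k ! ℕ.* (p ℕ.∸ k) !)) (nCk≡n!/k![n-k]! (ℕₚ.<⇒≤ k<p))) (ℕDM.m/n*n≡m (k![n∸k]!∣n! (ℕₚ.<⇒≤ k<p)))
  p∣p! : ∀ p → 0 ℕ.< p → p ℕD.∣ p !
  p∣p! (suc n) _ = ℕD.m∣m*n (n !)
  p∣C*d : p ℕD.∣ (p Comb.C k) ℕ.* (k ! ℕ.* (p ℕ.∸ k) !)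
  p∣C*d = ≡.subst (p ℕD.∣_) (≡.sym C*d≡p!) (p∣p! p (ℕₚ.<-trans 0<k k<p))
... | inj₁ p∣C = p∣C
... | inj₂ p∣d with euclidsLemma (k !) ((p ℕ.∸ k) !) p-prime p∣d
... | inj₁ p∣k!  = contradiction (prime∣! p-prime k p∣k!) (ℕₚ.<⇒≱ k<p)
... | inj₂ p∣k′! = contradiction (prime∣! p-prime (p ℕ.∸ k) p∣k′!) (ℕₚ.<⇒≱ (ℕₚ.∸-monoʳ-< 0<k (ℕₚ.<⇒≤ k<p)))

module Frobenius (R : Ring) {p : ℕ} (p-prime : Prime p) where
  open RingKit R

  module _ (char : p · 1# ≈ 0#) where
    private
      open Algebra.Properties.Semiring.Mult semiring using (×-congʳ; ×-assocˡ; ×-congˡ)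
      open Algebra.Properties.Monoid.Sum +-monoid using (sum; sum-init-last)
      module B = Algebra.Properties.CommutativeSemiring.Binomial commutativeSemiring

      multiple≈0 : ∀ {m} z → p ℕD.∣ m → m · z ≈ 0#
      multiple≈0 {m} z (ℕD.divides c m≡cp) = begin
        m · z  ≈⟨ ×-congˡ (≡.trans m≡cp (ℕₚ.*-comm c p)) ⟩
        (p ℕ.* c) · z  ≈⟨ ×-assocˡ z p c ⟨
        p · (c · z)  ≈⟨ ×-congʳ p (*-identityˡ _) ⟨
        p · (1# * (c · z))  ≈⟨ ·-assoc-* p 1# _ ⟨
        p · 1# * (c · z)  ≈⟨ *-congʳ char ⟩
        0# * (c · z)  ≈⟨ zeroˡ _ ⟩
        0#  ∎

      sum≈0 : ∀ n (t : Fin n → Carrier) → (∀ i → t i ≈ 0#) → sum t ≈ 0#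
      sum≈0 zero    t e = refl
      sum≈0 (suc n) t e = trans (+-cong (e Fin.zero) (sum≈0 n (t ∘ Fin.suc) (e ∘ Fin.suc))) (+-identityˡ 0#)

      expansion : ∀ n → suc n ≡ p → ∀ u v → B.binomialExpansion u v (suc n) ≈ u ^ suc n + v ^ suc n
      expansion n 1+n≡p u v = begin
        term Fin.zero + sum (term ∘ Fin.suc)
          ≈⟨ +-congˡ (sum-init-last (term ∘ Fin.suc)) ⟩
        term Fin.zero + (sum (term ∘ Fin.suc ∘ Fin.inject₁) + term (Fin.suc (Fin.fromℕ n)))
          ≈⟨ +-cong first (+-cong (sum≈0 n _ middle) last) ⟩
        v ^ suc n + (0# + u ^ suc n)
          ≈⟨ solve 2 (λ u v → v :+ (con (+ 0) :+ u) := u :+ v) refl _ _ ⟩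
        u ^ suc n + v ^ suc n ∎
        where
        term = B.binomialTerm u v (suc n)
        first : term Fin.zero ≈ v ^ suc n
        first = trans (+-identityʳ _) (*-identityˡ _)
        last : term (Fin.suc (Fin.fromℕ n)) ≈ u ^ suc n
        last = begin
          term (Fin.suc (Fin.fromℕ n))
            ≡⟨ ≡.cong (λ k → (suc n Comb.C k) · (u ^ k * v ^ (suc n ℕ.∸ k))) (≡.cong suc (Finₚ.toℕ-fromℕ n)) ⟩
          (suc n Comb.C suc n) · (u ^ suc n * v ^ (suc n ℕ.∸ suc n))
            ≡⟨ ≡.cong₂ (λ m k → m · (u ^ suc n * v ^ k)) (nCn≡1 (suc n)) (ℕₚ.n∸n≡0 n) ⟩
          u ^ suc n * 1# + 0#
            ≈⟨ trans (+-identityʳ _) (*-identityʳ _) ⟩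
          u ^ suc n ∎
        middle : ∀ i → term (Fin.suc (Fin.inject₁ i)) ≈ 0#
        middle i = multiple≈0 _ (≡.subst (λ m → p ℕD.∣ (m Comb.C suc (Fin.toℕ (Fin.inject₁ i)))) (≡.sym 1+n≡p)
          (prime∣binomial p-prime (s≤s z≤n) (≡.subst (suc (Fin.toℕ (Fin.inject₁ i)) ℕ.<_) 1+n≡p
            (s≤s (≡.subst (ℕ._< n) (≡.sym (Finₚ.toℕ-inject₁ i)) (Finₚ.toℕ<n i))))))

    frobenius-+ : ∀ u v → (u + v) ^ p ≈ u ^ p + v ^ p
    frobenius-+ u v = from p ≡.refl
      where
      from : ∀ m → m ≡ p → (u + v) ^ m ≈ u ^ m + v ^ m
      from zero    0≡p   = contradiction (≡.sym 0≡p) (prime≢0 p-prime)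
      from (suc n) 1+n≡p = trans (B.theorem (suc n) u v) (expansion n 1+n≡p u v)

    0^p : 0# ^ p ≈ 0#
    0^p = from p (prime≢0 p-prime)
      where
      from : ∀ m → m ≢ 0 → 0# ^ m ≈ 0#
      from zero    0≢0 = contradiction ≡.refl 0≢0
      from (suc m) _   = zeroˡ _

    frobenius-neg : ∀ u → (- u) ^ p ≈ - (u ^ p)
    frobenius-neg u = begin
      (- u) ^ p  ≈⟨ solve 2 (λ a b → a := (a :+ b) :- b) refl _ (u ^ p) ⟩
      ((- u) ^ p + u ^ p) - u ^ p  ≈⟨ +-congʳ (frobenius-+ (- u) u) ⟨
      (- u + u) ^ p - u ^ p  ≈⟨ +-congʳ (trans (^-congˡ p (-‿inverseˡ u)) 0^p) ⟩
      0# - u ^ p  ≈⟨ +-identityˡ _ ⟩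
      - (u ^ p)  ∎

    module _ (ι : Hom ℤᴿ R) where
      private module ι = Hom ι

      fermat-ℕ : ∀ n → ι.⟦ + n ⟧ ^ p ≈ ι.⟦ + n ⟧
      fermat-ℕ zero    = trans (^-congˡ p ι.0-homo) (trans 0^p (sym ι.0-homo))
      fermat-ℕ (suc n) = begin
        ι.⟦ + 1 ℤ.+ + n ⟧ ^ p  ≈⟨ ^-congˡ p (trans (ι.+-homo (+ 1) (+ n)) (+-congʳ ι.1-homo)) ⟩
        (1# + ι.⟦ + n ⟧) ^ p  ≈⟨ frobenius-+ _ _ ⟩
        1# ^ p + ι.⟦ + n ⟧ ^ p  ≈⟨ +-cong (RingFacts.1^ R p) (fermat-ℕ n) ⟩
        1# + ι.⟦ + n ⟧  ≈⟨ trans (ι.+-homo (+ 1) (+ n)) (+-congʳ ι.1-homo) ⟨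
        ι.⟦ + 1 ℤ.+ + n ⟧  ∎

      fermat : ∀ i → ι.⟦ i ⟧ ^ p ≈ ι.⟦ i ⟧
      fermat (+ n) = fermat-ℕ n
      fermat -[1+ n ] = begin
        ι.⟦ ℤ.- (+ suc n) ⟧ ^ p  ≈⟨ ^-congˡ p (ι.neg-homo (+ suc n)) ⟩
        (- ι.⟦ + suc n ⟧) ^ p  ≈⟨ frobenius-neg _ ⟩
        - (ι.⟦ + suc n ⟧ ^ p)  ≈⟨ -‿cong (fermat-ℕ (suc n)) ⟩
        - ι.⟦ + suc n ⟧  ≈⟨ ι.neg-homo (+ suc n) ⟨
        ι.⟦ ℤ.- (+ suc n) ⟧  ∎

      -- In characteristic p, x ↦ x^p − a is Frobenius followed by a translation.
      it-frobenius : ∀ a n u → it R p ι.⟦ a ⟧ n u ≈ (u - ι.⟦ (+ n) ℤ.* a ⟧) ^ (p ℕ.^ n)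
      it-frobenius a zero    u = begin
        u  ≈⟨ solve 1 (λ u → u := u :- con (+ 0)) refl u ⟩
        u - 0#  ≈⟨ +-congˡ (-‿cong (trans (ι.cong (ℤₚ.*-zeroˡ a)) ι.0-homo)) ⟨
        u - ι.⟦ (+ 0) ℤ.* a ⟧  ≈⟨ *-identityʳ _ ⟨
        (u - ι.⟦ (+ 0) ℤ.* a ⟧) * 1#  ∎
      it-frobenius a (suc n) u = begin
        it R p α (suc n) u  ≈⟨ it-comm R p α n u ⟨
        it R p α n (u ^ p - α)  ≈⟨ it-frobenius a n (u ^ p - α) ⟩
        ((u ^ p - α) - ι.⟦ (+ n) ℤ.* a ⟧) ^ (p ℕ.^ n)  ≈⟨ ^-congˡ (p ℕ.^ n) inner ⟨
        ((u - ι.⟦ (+ suc n) ℤ.* a ⟧) ^ p) ^ (p ℕ.^ n)  ≈⟨ ^-assocʳ _ p (p ℕ.^ n) ⟩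
        (u - ι.⟦ (+ suc n) ℤ.* a ⟧) ^ (p ℕ.* p ℕ.^ n)  ∎
        where
        α = ι.⟦ a ⟧
        -- Frobenius fixes the integer `(n+1) a` by Fermat, so the translation passes through it
        -- unchanged and one `a` of it is spent on `f`.
        inner : (u - ι.⟦ (+ suc n) ℤ.* a ⟧) ^ p ≈ (u ^ p - α) - ι.⟦ (+ n) ℤ.* a ⟧
        inner = begin
          (u - ι.⟦ (+ suc n) ℤ.* a ⟧) ^ p  ≈⟨ frobenius-+ u _ ⟩
          u ^ p + (- ι.⟦ (+ suc n) ℤ.* a ⟧) ^ p  ≈⟨ +-congˡ (trans (frobenius-neg _) (-‿cong (fermat _))) ⟩
          u ^ p - ι.⟦ (+ suc n) ℤ.* a ⟧  ≈⟨ +-congˡ (-‿cong (trans (ι.cong (ℤₚ.suc-* (+ n) a)) (ι.+-homo _ _))) ⟩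
          u ^ p - (α + ι.⟦ (+ n) ℤ.* a ⟧)  ≈⟨ solve 3 (λ u a b → u :- (a :+ b) := (u :- a) :- b) refl _ _ _ ⟩
          (u ^ p - α) - ι.⟦ (+ n) ℤ.* a ⟧  ∎

module TaylorSquare (R : Ring) where
  open RingKit R

  -- Taylor expansion to first order; of the remainder only its divisibility by `t²` matters, so `Q`
  -- stays existential.
  ^-second-order : ∀ n v t → ∃ λ Q → (v + t) ^ suc n ≈ (v ^ suc n + (suc n · 1#) * (v ^ n * t)) + (t * t) * Q
  ^-second-order zero    v t = 0# , (begin
    (v + t) * 1#  ≈⟨ *-identityʳ _ ⟩
    v + t  ≈⟨ +-cong (*-identityʳ v) (trans (*-congˡ (*-identityˡ t)) (*-identityˡ t)) ⟨
    v * 1# + 1# * (1# * t)  ≈⟨ +-congˡ (*-congʳ (+-identityʳ 1#)) ⟨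
    v * 1# + (1# + 0#) * (1# * t)  ≈⟨ trans (+-congˡ (zeroʳ (t * t))) (+-identityʳ _) ⟨
    (v * 1# + (1# + 0#) * (1# * t)) + (t * t) * 0#  ∎)
  ^-second-order (suc n) v t = step (^-second-order n v t)
    where
    N = suc n · 1#
    step : (∃ λ Q → (v + t) ^ suc n ≈ (v ^ suc n + N * (v ^ n * t)) + (t * t) * Q) →
           ∃ λ Q → (v + t) * (v + t) ^ suc n ≈ (v * v ^ suc n + (1# + N) * (v ^ suc n * t)) + (t * t) * Q
    step (Q , e) = (v + t) * Q + N * v ^ n , (begin
      (v + t) * (v + t) ^ suc n  ≈⟨ *-congˡ e ⟩
      (v + t) * ((v * v ^ n + N * (v ^ n * t)) + (t * t) * Q)
        ≈⟨ solve 6 (λ v t w N Q o → (v :+ t) :* ((v :* w :+ N :* (w :* t)) :+ (t :* t) :* Q)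
             := ((v :* (v :* w) :+ (o :+ N) :* ((v :* w) :* t)) :+ (t :* t) :* ((v :+ t) :* Q :+ N :* w)) :+ ((v :* w) :* t :- o :*
               ((v :* w) :* t))) refl v t (v ^ n) N Q 1# ⟩
      ((v * (v * v ^ n) + (1# + N) * ((v * v ^ n) * t)) + (t * t) * ((v + t) * Q + N * v ^ n)) + ((v * v ^ n) * t - 1# * ((v * v ^ n) * t))
        ≈⟨ +-congˡ (trans (+-congˡ (-‿cong (*-identityˡ _))) (-‿inverseʳ _)) ⟩
      ((v * (v * v ^ n) + (1# + N) * ((v * v ^ n) * t)) + (t * t) * ((v + t) * Q + N * v ^ n)) + 0#
        ≈⟨ +-identityʳ _ ⟩
      (v * (v * v ^ n) + (1# + N) * ((v * v ^ n) * t)) + (t * t) * ((v + t) * Q + N * v ^ n) ∎)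

-- Closedness of R_n at a prime

coeff-Quot : ∀ K D p i → PolyBase.coeff (Quot K D) p i ≡ PolyBase.coeff K p i
coeff-Quot K D []      i       = ≡.refl
coeff-Quot K D (c ∷ p) zero    = ≡.refl
coeff-Quot K D (c ∷ p) (suc i) = coeff-Quot K D p i

open PolyBase ℤᴿ
open MonicPoly ℤᴿ

monic-mod : ∀ D {k g} → MonicOfDegree k g → MonicPoly.MonicOfDegree (Quot ℤᴿ D) k g
monic-mod D {k} {g} m = record
  { lead  = Hom.cong (project ℤᴿ D) (≡.trans (coeff-Quot ℤᴿ D g k) (lead m))
  ; above = λ {i} k<i → Hom.cong (project ℤᴿ D) (≡.trans (coeff-Quot ℤᴿ D g i) (above m k<i)) }

≋0-mod⇒multiple : ∀ D p → PolyBase._≋_ (Quot ℤᴿ D) p [] → ∃ λ r → p ≋ scaleP D r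
≋0-mod⇒multiple D []      e = [] , ≋-refl
≋0-mod⇒multiple D (c ∷ p) e = head , tail-case (PolyBase.at e 0) (≋0-mod⇒multiple D p (PolyBase.[]-∷⁻ (Quot ℤᴿ D) e))
  where
  head : List ℤ
  head = _≈ᵍ_.cofactor (PolyBase.at e 0) ∷ proj₁ (≋0-mod⇒multiple D p (PolyBase.[]-∷⁻ (Quot ℤᴿ D) e))
  tail-case : (h : CommutativeRing._≈_ (Quot ℤᴿ D) c (+ 0)) (t : ∃ λ r → p ≋ scaleP D r) → (c ∷ p) ≋ scaleP D (_≈ᵍ_.cofactor h ∷ proj₁ t)
  tail-case (u , eq) (r , er) = ∷-cong (≡.trans eq (≡.trans (ℤₚ.+-identityˡ (u ℤ.* D)) (ℤₚ.*-comm u D))) er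

-- A monic polynomial stays regular modulo D.
monic-cofactor-divisible : ∀ D {k g} → MonicOfDegree k g → ∀ p → (∀ {i} → k ℕ.≤ i → D ∣ coeff (mulP p g) i) → ∃ λ r → p ≋ scaleP D r
monic-cofactor-divisible D {k} {g} m p h = ≋0-mod⇒multiple D p
  (MonicPoly.monic-regular (Quot ℤᴿ D) (monic-mod D m) p (λ {i} k≤i →
    ≡.subst (λ z → CommutativeRing._≈_ (Quot ℤᴿ D) z (+ 0)) (≡.sym (coeff-Quot ℤᴿ D (mulP p g) i)) (∣⇒≈0 (h k≤i))))

scale-cancel : ∀ D → D ≢ + 0 → ∀ {p r} → scaleP D p ≋ scaleP D r → p ≋ r
scale-cancel D D≢0 {p} {r} e .at i = ℤₚ.*-cancelˡ-≡ D (coeff p i) (coeff r i) {{ℤ.≢-nonZero D≢0}}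
  (≡.trans (≡.sym (coeff-scale D p i)) (≡.trans (at e i) (coeff-scale D r i)))

eval : ℤ → List ℤ → ℤ
eval = ev (idHom ℤᴿ)

expand-at : ∀ b u → ∃ λ v → u ≋ addP (const (eval b u)) (mulP (X Zx.- const b) v)
expand-at b []      = [] , ≋-sym (≋-trans (add-cong {const (+ 0)} {[]} 0∷[]≋[] (mul-[] (X Zx.- const b))) ≋-refl)
expand-at b (c ∷ u) = extend (expand-at b u)
  where
  r = eval b u
  y = X Zx.- const b
  extend : (∃ λ v → u ≋ addP (const r) (mulP y v)) → ∃ λ v → (c ∷ u) ≋ addP (const (c ℤ.+ b ℤ.* r)) (mulP y v)
  extend (v , e) = addP (const r) (mulP X v) , (Zx.begin
    c ∷ u  Zx.≈⟨ ∷-as-sum c u ⟩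
    const c Zx.+ X Zx.* u  Zx.≈⟨ Zx.+-congˡ {x = const c} (mul-congˡ X e) ⟩
    const c Zx.+ X Zx.* (const r Zx.+ y Zx.* v)  Zx.≈⟨ RingFacts.expand-step ℤ[x]ᴿ (const c) X (const b) (const r) v ⟩
    (const c Zx.+ const b Zx.* const r) Zx.+ y Zx.* (const r Zx.+ X Zx.* v)
      Zx.≈⟨ Zx.+-congʳ {x = y Zx.* (const r Zx.+ X Zx.* v)} (Zx.trans (Hom.+-homo constHom c (b ℤ.* r)) (Zx.+-congˡ {x = const c}
        (Hom.*-homo constHom b r))) ⟨
    const (c ℤ.+ b ℤ.* r) Zx.+ y Zx.* (const r Zx.+ X Zx.* v) Zx.∎)

evℤ : ℤ → Hom ℤ[x]ᴿ ℤᴿ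
evℤ b = evHom (idHom ℤᴿ) b

evℤ-y : ∀ b → eval b (X Zx.- const b) ≡ + 0
evℤ-y b = ≡.trans (Hom.+-homo (evℤ b) X (const (ℤ.- b))) (≡.trans (≡.cong₂ ℤ._+_ (ev-X (idHom ℤᴿ) b) (ev-const (idHom ℤᴿ) b (ℤ.- b)))
  (ℤₚ.+-inverseʳ b))

module MonicQuotient {k : ℕ} {g : List ℤ} (g-monic : MonicOfDegree k g) where
  private module A = RingKit (ℤ[x]/ g)

  lift : ∀ {u v} → u ≋ v → u A.≈ v
  lift = Hom.cong (π/ g)

  -- If `m u = U g`, then `m` divides all coefficients of `U g`. Modulo `m` the monic `g` is
  -- regular, so `U = m r`, and cancelling `m` in `ℤ[x]` gives `u = r g`.
  torsion-free₀ : ∀ m → m ≢ + 0 → ∀ u → const m A.* u A.≈ [] → u A.≈ []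
  torsion-free₀ m m≢0 u (U , e) = finish (monic-cofactor-divisible m g-monic U (λ {i} _ → divides (coeff u i) (≡.trans (≡.sym (at Ug i))
    (≡.trans (coeff-scale m u i) (ℤₚ.*-comm m (coeff u i))))))
    where
    Ug : scaleP m u ≋ mulP U g
    Ug = ≋-trans (≋-sym (const-mul m u)) e
    finish : (∃ λ r → U ≋ scaleP m r) → u A.≈ []
    finish (r , eU) = r , scale-cancel m m≢0 (≋-trans Ug (≋-trans (mul-cong eU (≋-refl {g})) (scale-mul m r g)))

  torsion-free : ∀ m → m ≢ + 0 → ∀ {u v} → const m A.* u A.≈ const m A.* v → u A.≈ v
  torsion-free m m≢0 {u} {v} e = RingFacts.difference-zero⁻ (ℤ[x]/ g) (torsion-free₀ m m≢0 (u A.- v) (RingFacts.*-difference-zero (ℤ[x]/ g)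
    (const m) u v e))

  expand : ∀ b u → ∃₂ λ r v → u A.≈ const r A.+ (X Zx.- const b) A.* v
  expand b u = eval b u , proj₁ (expand-at b u) , lift (proj₂ (expand-at b u))

  root-relation : ∀ b → ∃ λ h → const (eval b g) A.≈ (X Zx.- const b) A.* h
  root-relation b = from (expand-at b g)
    where
    from : (∃ λ v → g ≋ addP (const (eval b g)) (mulP (X Zx.- const b) v)) → ∃ λ h → const (eval b g) A.≈ (X Zx.- const b) A.* h
    from (v , e) = A.- v , RingFacts.solve-for (ℤ[x]/ g) {g} {const (eval b g)} {X Zx.- const b} {v} (modulus≈0 ℤ[x]ᴿ g) (lift e)

  module _ {q : ℕ} (q-prime : Prime q) where
    open Multiples (ℤ[x]/ g) (const/ g) q-prime
    private module F = RingKit (Quot ℤᴿ (+ q))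

    -- Covers both situations, `y` invertible modulo `q` and `(q, y)` a regular prime, under one
    -- interface.
    record Strippable (b : ℤ) : Set where
      field
        strip : ∀ {e₀} C → e₀ ≢ 0 → AlmostIntegral.AlmostInt (ℤ[x]/ g) (const (+ q)) (const (+ e₀)) C →
                MultipleOfQ ((X Zx.- const b) A.* C) → MultipleOfQ C

    strip-coprime : ∀ b → ¬ (+ q) ∣ eval b g → Strippable b
    strip-coprime b q∤gb .Strippable.strip C _ _ = strip-unit {eval b g} {X Zx.- const b} {proj₁ (root-relation b)} q∤gb (proj₂
      (root-relation b)) C

    -- Evaluation at `b` gives `g(b) = q w(b)`, so `q² ∤ g(b)` makes `w(b)` prime to `q`. Thus `k`
    -- and `w` are both units at `(q, y)`, and `y^(1+e) k = -q w` shows that `y` alone generates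
    -- this prime locally.
    strip-regular : ∀ b e k w → g ≋ addP (mulP ((X Zx.- const b) Zx.^ suc e) k) (mulP (const (+ q)) w) →
                    ¬ (+ q) ∣ eval b k → ¬ ((+ q) ℤ.* (+ q)) ∣ eval b g → Strippable b
    strip-regular b e k w g≋ q∤kb q²∤gb .Strippable.strip C e₀≢0 ai (D , yC≈QD) =
      StripRegular.strip torsion-free {y} {proj₁ (root-relation b)} {m} m≢0 (proj₂ (root-relation b))
        {Quot ℤᴿ (+ q)} χ F-integral (λ 1≈0 → ∤1 q-prime (≈0⇒∣ 1≈0)) χ-Q χ-kernel χ-y (expand b) e k (A.- w) relation
        (λ k≈0 → q∤kb (≈0⇒∣ k≈0)) (λ w≈0 → q∤wb (≈0⇒∣ (F.trans (F.sym (F.-‿involutive wb)) (F.-‿cong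
          (F.trans (F.sym (Hom.neg-homo χ w)) w≈0))))) e₀≢0 ai yC≈QD
      where
      y = X Zx.- const b
      m = eval b g
      wb = eval b w
      m≡ : m ≡ (+ q) ℤ.* wb
      m≡ = ≡.trans (Hom.cong (evℤ b) g≋) (≡.trans (Hom.+-homo (evℤ b) (mulP (y Zx.^ suc e) k) (mulP (const (+ q)) w))
        (≡.trans (≡.cong₂ ℤ._+_ yk (≡.trans (Hom.*-homo (evℤ b) (const (+ q)) w) (≡.cong (ℤ._* wb) (ev-const (idHom ℤᴿ) b (+ q)))))
        (ℤₚ.+-identityˡ _)))
        where
        yk : eval b (mulP (y Zx.^ suc e) k) ≡ + 0
        yk = ≡.trans (Hom.*-homo (evℤ b) (y Zx.^ suc e) k) (≡.trans (≡.cong (ℤ._* eval b k)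
              (≡.trans (Hom.*-homo (evℤ b) y (y Zx.^ e)) (≡.trans (≡.cong (ℤ._* eval b (y Zx.^ e)) (evℤ-y b)) (ℤₚ.*-zeroˡ (ev
                (idHom ℤᴿ) b (y Zx.^ e)))))) (ℤₚ.*-zeroˡ (eval b k)))
      m≢0 : m ≢ + 0
      m≢0 m≡0 = q²∤gb (divides (+ 0) m≡0)
      q∤wb : ¬ (+ q) ∣ wb
      q∤wb (divides c wb≡) = q²∤gb (divides c (≡.trans m≡ (≡.trans (≡.cong ((+ q) ℤ.*_) wb≡) (RingFacts.*-swap ℤᴿ (+ q) c (+ q)))))
      F-integral : ∀ u v → u F.* v F.≈ F.0# → u F.≈ F.0# ⊎ v F.≈ F.0#
      F-integral u v uv≈0 = [ inj₁ ∘ ∣⇒≈0 , inj₂ ∘ ∣⇒≈0 ]′ (prime∣* q-prime u v (≈0⇒∣ uv≈0))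
      χ : Hom (ℤ[x]/ g) (Quot ℤᴿ (+ q))
      χ = descend ℤ[x]ᴿ g (project ℤᴿ (+ q) ∘ₕ evℤ b) (∣⇒≈0 (divides wb (≡.trans m≡ (ℤₚ.*-comm (+ q) wb))))
      χ-const : ∀ r → Hom.⟦_⟧ χ (const r) ≡ r
      χ-const = ev-const (idHom ℤᴿ) b
      χ-Q : Hom.⟦_⟧ χ (const (+ q)) F.≈ F.0#
      χ-Q = ∣⇒≈0 (divides (+ 1) (≡.trans (χ-const (+ q)) (≡.sym (ℤₚ.*-identityˡ (+ q)))))
      χ-kernel : ∀ r → Hom.⟦_⟧ χ (const r) F.≈ F.0# → (+ q) ∣ r
      χ-kernel r e = ≡.subst ((+ q) ∣_) (χ-const r) (≈0⇒∣ e)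
      χ-y : Hom.⟦_⟧ χ y F.≈ F.0#
      χ-y = Hom.cong (project ℤᴿ (+ q)) (evℤ-y b)
      relation : (y A.^ suc e) A.* k A.≈ const (+ q) A.* (A.- w)
      relation = A.trans (A.*-congʳ {x = k} (A.sym (Hom.^-homo (π/ g) y (suc e))))
        (RingFacts.solve-for (ℤ[x]/ g) {g} {mulP (y Zx.^ suc e) k} {const (+ q)} {w} (modulus≈0 ℤ[x]ᴿ g) (lift g≋))

    strip-^ : ∀ b → Strippable b → ∀ n {e₀ C} → e₀ ≢ 0 → AlmostIntegral.AlmostInt (ℤ[x]/ g) (const (+ q)) (const (+ e₀)) C →
              MultipleOfQ (((X Zx.- const b) A.^ n) A.* C) → MultipleOfQ C
    strip-^ b strippable zero    {C = C} e₀≢0 ai (D , e) = D , A.trans (A.sym (A.*-identityˡ C)) e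
    strip-^ b strippable (suc n) {C = C} e₀≢0 ai (D , e) = strip-^ b strippable n e₀≢0 ai
      (Strippable.strip strippable ((y A.^ n) A.* C) e₀≢0 (AlmostIntegral.ai-* (ℤ[x]/ g) (y A.^ n) ai) (D , A.trans (A.sym (A.*-assoc y
        (y A.^ n) C)) e))
      where y = X Zx.- const b

at-0 : List ℤ → ℤ
at-0 = eval (+ 0)

module _ {q : ℕ} (q-prime : Prime q) where

  Decomposition : List ℤ → Set
  Decomposition g = ∃₂ λ e k → ∃ λ w → g ≋ addP (mulP (X Zx.^ e) k) (mulP (const (+ q)) w) × ¬ (+ q) ∣ at-0 k

  -- Low coefficients divisible by `q` are moved into `w` until the first one that is not; the
  -- leading coefficient 1 stops this at the latest. So `e` is the multiplicity of the root 0 modulo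
  -- `q`.
  decompose : ∀ d g → MonicOfDegree d g → Decomposition g
  decompose d    []      m = contradiction (lead m) λ ()
  decompose zero (c ∷ g) m = 0 , c ∷ g , [] , ≋-sym (≋-trans (add-cong (mul-identityˡ (c ∷ g)) (mul-[] (const (+ q)))) (add-[] (c ∷ g))) ,
    λ q∣c → ∤1 q-prime (≡.subst ((+ q) ∣_) (≡.trans (ℤₚ.+-identityʳ c) (lead m)) q∣c)
  decompose (suc d) (c ∷ g) m = by-cases (+ q ∣? c) (decompose d g (monic-tail m))
    where
    by-cases : Dec ((+ q) ∣ c) → Decomposition g → Decomposition (c ∷ g)
    by-cases (no q∤c) _ = 0 , c ∷ g , [] , ≋-sym (≋-trans (add-cong (mul-identityˡ (c ∷ g)) (mul-[] (const (+ q)))) (add-[] (c ∷ g))) ,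
      λ q∣c → q∤c (≡.subst ((+ q) ∣_) (ℤₚ.+-identityʳ c) q∣c)
    by-cases (yes (divides c′ c≡)) (e , k , w , g≋ , q∤k) = suc e , k , addP (const c′) (mulP X w) , (Zx.begin
      c ∷ g  Zx.≈⟨ ∷-as-sum c g ⟩
      const c Zx.+ X Zx.* g  Zx.≈⟨ Zx.+-cong {const c} (Zx.trans (Hom.cong constHom (≡.trans c≡ (ℤₚ.*-comm c′ (+ q)))) (Hom.*-homo constHom
        (+ q) c′)) (mul-congˡ X g≋) ⟩
      const (+ q) Zx.* const c′ Zx.+ X Zx.* ((X Zx.^ e) Zx.* k Zx.+ const (+ q) Zx.* w)
        Zx.≈⟨ RingFacts.shift-decomposition ℤ[x]ᴿ (const (+ q)) (const c′) X (X Zx.^ e) k w ⟩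
      (X Zx.* (X Zx.^ e)) Zx.* k Zx.+ const (+ q) Zx.* (const c′ Zx.+ X Zx.* w) Zx.∎) , q∤k

  strippable-at-0 : ∀ {d g} (m : MonicOfDegree d g) → ¬ ((+ q) ℤ.* (+ q)) ∣ at-0 g → MonicQuotient.Strippable m q-prime (+ 0)
  strippable-at-0 {d} {g} m q²∤g0 = by-cases (+ q ∣? at-0 g) (decompose d g m)
    where
    by-cases : Dec ((+ q) ∣ at-0 g) → Decomposition g → MonicQuotient.Strippable m q-prime (+ 0)
    by-cases (no q∤g0) _ = MonicQuotient.strip-coprime m q-prime (+ 0) q∤g0
    by-cases (yes q∣g0) (suc e , k , w , g≋ , q∤k) = MonicQuotient.strip-regular m q-prime (+ 0) e k w g≋ q∤k q²∤g0
    -- Multiplicity 0 would give `g(0) ≡ k(0)` modulo `q`, although `q` divides only the former.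
    by-cases (yes (divides c g0≡)) (zero , k , w , g≋ , q∤k) = contradiction (divides (c ℤ.- at-0 w) k0≡) q∤k
      where
      k0≡ : at-0 k ≡ (c ℤ.- at-0 w) ℤ.* (+ q)
      k0≡ = RingFacts.subtract-multiple ℤᴿ {at-0 g} {at-0 k} {+ q} {at-0 w} {c} (≡.trans (Hom.cong (evℤ (+ 0)) g≋)
        (≡.trans (Hom.+-homo (evℤ (+ 0)) (mulP (const (+ 1)) k) (mulP (const (+ q)) w))
          (≡.cong₂ ℤ._+_ (Hom.cong (evℤ (+ 0)) (mul-identityˡ k)) (≡.trans (Hom.*-homo (evℤ (+ 0)) (const (+ q)) w) (≡.cong (ℤ._* at-0 w)
            (ev-const (idHom ℤᴿ) (+ 0) (+ q))))))) g0≡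

-- The iterates modulo p and p², and closedness at p and away from p

module _ (p : ℕ) (p-prime : Prime p) (a : ℤ) where
  private instance _ = prime⇒nonZero p-prime

  -- Put `u = v + c p`. In the expansion of `u^p` the linear term has one factor `p` from its
  -- coefficient and one from `c p`, and the remainder has two from `(c p)²`.
  lift-congruence : ∀ {u v} → (+ p) ∣ u ℤ.- v → ((+ p) ℤ.* (+ p)) ∣ u ℤK.^ p ℤ.- v ℤK.^ p
  lift-congruence {u} {v} (divides c u-v≡) = from p ≡.refl
    where
    from : ∀ m → m ≡ p → ((+ p) ℤ.* (+ p)) ∣ u ℤK.^ m ℤ.- v ℤK.^ m
    from zero    0≡p   = contradiction (≡.sym 0≡p) (ℕ.≢-nonZero⁻¹ p)
    from (suc n) 1+n≡p = finish (TaylorSquare.^-second-order ℤᴿ n v (c ℤ.* (+ p)))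
      where
      finish : (∃ λ Q → (v ℤ.+ c ℤ.* (+ p)) ℤK.^ suc n ≡ (v ℤK.^ suc n ℤ.+ (suc n ℤK.· (+ 1)) ℤ.* (v ℤK.^ n ℤ.* (c ℤ.* (+ p)))) ℤ.+ ((c ℤ.*
        (+ p)) ℤ.* (c ℤ.* (+ p))) ℤ.* Q) →
               ((+ p) ℤ.* (+ p)) ∣ u ℤK.^ suc n ℤ.- v ℤK.^ suc n
      finish (Q , e) = divides (v ℤK.^ n ℤ.* c ℤ.+ c ℤ.* c ℤ.* Q)
        (RingFacts.second-order-difference ℤᴿ {u ℤK.^ suc n} {v ℤK.^ suc n} {+ p} {v ℤK.^ n} {c} {Q}
          (≡.trans (≡.cong (ℤK._^ suc n) u≡) (≡.trans e (≡.cong (λ z → (v ℤK.^ suc n ℤ.+ z ℤ.* (v ℤK.^ n ℤ.* (c ℤ.* (+ p)))) ℤ.+ ((c ℤ.*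
            (+ p)) ℤ.* (c ℤ.* (+ p))) ℤ.* Q) (≡.trans (ℤ-·1 (suc n)) (≡.cong +_ 1+n≡p))))))
        where
        u≡ : u ≡ v ℤ.+ c ℤ.* (+ p)
        u≡ = ≡.trans (≡.sym (RingFacts.+-cancel ℤᴿ u v)) (≡.trans (≡.cong (ℤ._+ v) u-v≡) (ℤₚ.+-comm (c ℤ.* (+ p)) v))

  private
    𝔽 : Ring
    𝔽 = Quot ℤᴿ (+ p)

    char-𝔽 : CommutativeRing._≈_ 𝔽 (RingKit._·_ 𝔽 p (+ 1)) (+ 0)
    char-𝔽 = CommutativeRing.trans 𝔽 (CommutativeRing.sym 𝔽 (hom-·1 (project ℤᴿ (+ p)) p))
      (CommutativeRing.trans 𝔽 (Hom.cong (project ℤᴿ (+ p)) (ℤ-·1 p)) (modulus≈0 ℤᴿ (+ p)))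

  fermat-∣ : ∀ b → (+ p) ∣ b ℤK.^ p ℤ.- b
  fermat-∣ b = from (CommutativeRing.trans 𝔽 (Hom.^-homo (project ℤᴿ (+ p)) b p) (Frobenius.fermat 𝔽 p-prime char-𝔽 (project ℤᴿ (+ p)) b))
    where
    from : CommutativeRing._≈_ 𝔽 (b ℤK.^ p) b → (+ p) ∣ b ℤK.^ p ℤ.- b
    from (c , e) = divides c (RingFacts.move ℤᴿ {b ℤK.^ p} {b} e)

  itℤ : ℕ → ℤ → ℤ
  itℤ = it ℤᴿ p a

  -- Modulo `p` each application of `f` subtracts `a`, so from `b ≡ (j+1) a` the value before the
  -- last application is congruent to `a`. Its p-th power is then `a^p` even modulo `p²`.
  it-mod-p² : ∀ j b → (+ p) ∣ b ℤ.- (+ suc j) ℤ.* a → ((+ p) ℤ.* (+ p)) ∣ itℤ (suc j) b ℤ.- (a ℤK.^ p ℤ.- a)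
  it-mod-p² zero b p∣b-a = ≡.subst (((+ p) ℤ.* (+ p)) ∣_) (≡.sym (RingFacts.cancel-common ℤᴿ (b ℤK.^ p) (a ℤK.^ p) a))
    (lift-congruence (≡.subst (λ z → (+ p) ∣ b ℤ.- z) (ℤₚ.*-identityˡ a) p∣b-a))
  it-mod-p² (suc j) b (divides c e) = ≡.subst (λ z → ((+ p) ℤ.* (+ p)) ∣ z ℤ.- (a ℤK.^ p ℤ.- a)) (it-comm ℤᴿ p a (suc j) b)
    (it-mod-p² j (b ℤK.^ p ℤ.- a) (next (fermat-∣ b)))
    where
    next : (+ p) ∣ b ℤK.^ p ℤ.- b → (+ p) ∣ (b ℤK.^ p ℤ.- a) ℤ.- (+ suc j) ℤ.* a
    next (divides d e′) = divides (d ℤ.+ c) (RingFacts.combine ℤᴿ {b ℤK.^ p} {b} {a} {(+ suc j) ℤ.* a} {d} {c} {+ p} e′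
      (≡.trans (≡.cong (λ z → b ℤ.- z) (≡.sym (ℤₚ.suc-* (+ suc j) a))) e))

  open Tower p p-prime a using (module Step)

  monic-F : ∀ n → MonicOfDegree (p ℕ.^ n) (F p a n)
  monic-F zero    = monic-∷ monic-1
  monic-F (suc n) = monic-+const′ {{ℕₚ.m^n≢0 p (suc n)}} (ℤ.- a) (monic-^ p (monic-F n))

  eval-F : ∀ b n → eval b (F p a n) ≡ itℤ n b
  eval-F b n = Tower.ev-F p p-prime a (idHom ℤᴿ) b n

  record ClosedAt (q n : ℕ) : Set where
    field
      divide : ∀ e₀ C → e₀ ≢ 0 → AlmostIntegral.AlmostInt (ℤ[x]/ F p a n) (const (+ q)) (const (+ e₀)) C →
               MultipleOf (ℤ[x]/ F p a n) (const (+ q)) C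

  F-mod-p : ∀ n → ∃ λ w → F p a n ≋ addP ((X Zx.- const ((+ n) ℤ.* a)) Zx.^ (p ℕ.^ n)) (mulP w (const (+ p)))
  F-mod-p n = from (E.trans (hom-it πE p (const a) n X) (E.trans (Frobenius.it-frobenius E p-prime char-E (πE ∘ₕ constHom) a n X)
                (E.sym (Hom.^-homo πE (X Zx.- const ((+ n) ℤ.* a)) (p ℕ.^ n)))))
    where
    E : Ring
    E = Quot ℤ[x]ᴿ (const (+ p))
    module E = CommutativeRing E
    πE : Hom ℤ[x]ᴿ E
    πE = project ℤ[x]ᴿ (const (+ p))
    char-E : RingKit._·_ E p E.1# E.≈ E.0#
    char-E = E.trans (E.sym (hom-·1 (πE ∘ₕ constHom) p)) (E.trans (Hom.cong (πE ∘ₕ constHom) (ℤ-·1 p)) (modulus≈0 ℤ[x]ᴿ (const (+ p))))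
    from : ∀ {u v} → u E.≈ v → ∃ λ w → u ≋ addP v (mulP w (const (+ p)))
    from (w , e) = w , e

  module _ (n : ℕ) where
    private
      b = (+ n) ℤ.* a
      y = X Zx.- const b
      e = ℕ.pred (p ℕ.^ n)
      module A = RingKit (ℤ[x]/ F p a n)
    open MonicQuotient (monic-F n) using (Strippable; strip-regular; strip-^; lift)

    y^pⁿ-multiple : ∀ {w} → F p a n ≋ addP (y Zx.^ (p ℕ.^ n)) (mulP w (const (+ p))) → y A.^ (p ℕ.^ n) A.≈ const (+ p) A.* (A.- w)
    y^pⁿ-multiple {w} F≋ = A.trans (A.sym (Hom.^-homo (π/ (F p a n)) y (p ℕ.^ n)))
      (RingFacts.solve-for (ℤ[x]/ F p a n) {F p a n} {y Zx.^ (p ℕ.^ n)} {const (+ p)} {w} (modulus≈0 ℤ[x]ᴿ (F p a n))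
        (A.trans (lift F≋) (A.+-congˡ {x = y Zx.^ (p ℕ.^ n)} (A.*-comm w (const (+ p))))))

    strippable-at-p : ∀ {w} → F p a n ≋ addP (y Zx.^ (p ℕ.^ n)) (mulP w (const (+ p))) →
                      ¬ ((+ p) ℤ.* (+ p)) ∣ eval b (F p a n) → Strippable p-prime b
    strippable-at-p {w} F≋ = strip-regular p-prime b e (const (+ 1)) w F≋′ (λ p∣ → ∤1 p-prime (≡.subst ((+ p) ∣_) (ev-const (idHom ℤᴿ) b (+ 1)) p∣))
      where
      1+e≡ : suc e ≡ p ℕ.^ n
      1+e≡ = ℕₚ.suc-pred (p ℕ.^ n) {{ℕₚ.m^n≢0 p n}}
      F≋′ : F p a n ≋ addP (mulP (y Zx.^ suc e) (const (+ 1))) (mulP (const (+ p)) w)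
      F≋′ = ≋-trans F≋ (add-cong (≋-trans (Zx.^-congʳ y (≡.sym 1+e≡)) (Zx.sym (Zx.*-identityʳ (y Zx.^ suc e)))) (mul-comm w (const (+ p))))

    -- `y^(p^n)` is itself a multiple of `p`, so `y^(p^n) C` is one for every `C`; almost
    -- integrality serves to remove the factors `y` one by one.
    closed-at-p′ : ¬ ((+ p) ℤ.* (+ p)) ∣ eval b (F p a n) → ClosedAt p n
    closed-at-p′ p²∤Fb .ClosedAt.divide e₀ C e₀≢0 ai = from (F-mod-p n)
      where
      mult : ∀ w → F p a n ≋ addP (y Zx.^ (p ℕ.^ n)) (mulP w (const (+ p))) → MultipleOf (ℤ[x]/ F p a n) (const (+ p)) ((y A.^ (p ℕ.^ n)) A.* C)
      mult w F≋ = (A.- w) A.* C , A.trans {(y A.^ (p ℕ.^ n)) A.* C} {(const (+ p) A.* (A.- w)) A.* C} (A.*-congʳ {x = C} (y^pⁿ-multiple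
        {w} F≋)) (A.*-assoc (const (+ p)) (A.- w) C)
      from : (∃ λ w → F p a n ≋ addP (y Zx.^ (p ℕ.^ n)) (mulP w (const (+ p)))) → MultipleOf (ℤ[x]/ F p a n) (const (+ p)) C
      from (w , F≋) = strip-^ p-prime b (strippable-at-p {w} F≋ p²∤Fb) (p ℕ.^ n) {e₀} {C} e₀≢0 ai (mult w F≋)

  closed-at-p : ∀ n → 1 ℕ.≤ n → ¬ ((+ p) ℤ.* (+ p)) ∣ a ℤK.^ p ℤ.- a → ClosedAt p n
  closed-at-p (suc j) _ p²∤ = closed-at-p′ (suc j) p²∤Fb
    where
    n = suc j
    b = (+ n) ℤ.* a
    transfer : ∀ {c} → eval b (F p a n) ≡ c ℤ.* ((+ p) ℤ.* (+ p)) →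
               ((+ p) ℤ.* (+ p)) ∣ itℤ n b ℤ.- (a ℤK.^ p ℤ.- a) → ((+ p) ℤ.* (+ p)) ∣ a ℤK.^ p ℤ.- a
    transfer {c} Fb≡ (divides d e) = divides (c ℤ.- d) (RingFacts.difference-of-multiples ℤᴿ {itℤ n b} {a ℤK.^ p ℤ.- a} {c} {d} {(+ p) ℤ.*
      (+ p)} (≡.trans (≡.sym (eval-F b n)) Fb≡) e)
    p²∤Fb : ¬ ((+ p) ℤ.* (+ p)) ∣ eval b (F p a n)
    p²∤Fb (divides c Fb≡) = p²∤ (transfer {c} Fb≡ (it-mod-p² j b (divides (+ 0) (ℤₚ.+-inverseʳ b))))

  module _ {q : ℕ} (q-prime : Prime q) (q≢p : q ≢ p) where

    q∤p : ¬ (+ q) ∣ (+ p)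
    q∤p q∣p = [ prime≢1 q-prime , q≢p ]′ (prime⇒irreducible p-prime (∣⇒∣ᵤ q∣p))

    -- The induction starts at `R_0 = ℤ[x]/(x)`, that is at `ℤ`. If `q^s` is the exact power of `q`
    -- in `e₀`, then `q^(s+1) ∣ e₀ c^(s+1)` already forces `q ∣ c`.
    closed-at-zero : ClosedAt q 0
    closed-at-zero .ClosedAt.divide e₀ C e₀≢0 ai = from-residue (C-divisible (prime-part q-prime e₀ e₀≢0))
      where
      module A = RingKit (ℤ[x]/ F p a 0)
      c = at-0 C
      χ : Hom (ℤ[x]/ F p a 0) ℤᴿ
      χ = descend ℤ[x]ᴿ (F p a 0) (evℤ (+ 0)) (ev-X (idHom ℤᴿ) (+ 0))
      aiℤ : AlmostIntegral.AlmostInt ℤᴿ (+ q) (+ e₀) c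
      aiℤ = AlmostIntegral.ai-cong ℤᴿ (ev-const (idHom ℤᴿ) (+ 0) (+ q)) (ev-const (idHom ℤᴿ) (+ 0) (+ e₀)) ≡.refl (ai-hom χ ai)
      C-divisible : (∃₂ λ s m → e₀ ≡ q ℕ.^ s ℕ.* m × ¬ q ℕD.∣ m) → (+ q) ∣ c
      C-divisible (s , e′ , e₀≡ , q∤e′) = reduce (AlmostIntegral.AlmostInt.power aiℤ (suc s))
        where
        reduce : (∃ λ E → (+ e₀) ℤ.* c ℤK.^ suc s ≡ (+ q) ℤK.^ suc s ℤ.* E) → (+ q) ∣ c
        reduce (E , eq) = [ (λ q∣e′ → contradiction (∣⇒∣ᵤ q∣e′) q∤e′) , prime∣^ q-prime c (suc s) ]′
          (prime∣* q-prime (+ e′) (c ℤK.^ suc s) (divides E (ℤₚ.*-cancelˡ-≡ Qs ((+ e′) ℤ.* c ℤK.^ suc s) (E ℤ.* (+ q)) {{Qs≢0}} cancelled)))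
          where
          Qs = (+ q) ℤK.^ s
          Qs≢0 : ℤ.NonZero Qs
          Qs≢0 = ≡.subst ℤ.NonZero (≡.sym (pos-^ q s)) (ℕₚ.m^n≢0 q s {{prime⇒nonZero q-prime}})
          e₀≡ℤ : + e₀ ≡ Qs ℤ.* (+ e′)
          e₀≡ℤ = ≡.trans (≡.cong +_ e₀≡) (≡.trans (ℤₚ.pos-* (q ℕ.^ s) e′) (≡.cong (ℤ._* (+ e′)) (≡.sym (pos-^ q s))))
          cancelled : Qs ℤ.* ((+ e′) ℤ.* c ℤK.^ suc s) ≡ Qs ℤ.* (E ℤ.* (+ q))
          cancelled = RingFacts.regroup ℤᴿ {+ e₀} {Qs} {+ e′} {c ℤK.^ suc s} {+ q} {E} e₀≡ℤ eq
      from-residue : (+ q) ∣ c → MultipleOf (ℤ[x]/ F p a 0) (const (+ q)) C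
      from-residue (divides r c≡) = const r , A.trans (C≈c (expand-at (+ 0) C)) (Hom.cong (π/ (F p a 0)) (≋-trans (Hom.cong constHom
        (≡.trans c≡ (ℤₚ.*-comm r (+ q)))) (Hom.*-homo constHom (+ q) r)))
        where
        C≈c : (∃ λ v → C ≋ addP (const c) (mulP X v)) → C A.≈ const c
        C≈c (v , e) = v , ≋-trans e (add-cong (≋-refl {const c}) (mul-comm X v))

    strip-X^ : ∀ n → ¬ ((+ q) ℤ.* (+ q)) ∣ itℤ n (+ 0) → ∀ k {e₀ C} → e₀ ≢ 0 →
      AlmostIntegral.AlmostInt (ℤ[x]/ F p a n) (const (+ q)) (const (+ e₀)) C →
      MultipleOf (ℤ[x]/ F p a n) (const (+ q)) (RingKit._*_ (ℤ[x]/ F p a n) (RingKit._^_ (ℤ[x]/ F p a n) X k) C) →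
      MultipleOf (ℤ[x]/ F p a n) (const (+ q)) C
    strip-X^ n q²∤ k = MonicQuotient.strip-^ (monic-F n) q-prime (+ 0)
      (strippable-at-0 q-prime (monic-F n) (λ d → q²∤ (≡.subst (((+ q) ℤ.* (+ q)) ∣_) (eval-F (+ 0) n) d))) k

    closed-step : ∀ n → ¬ ((+ q) ℤ.* (+ q)) ∣ itℤ (suc n) (+ 0) → ClosedAt q n → ClosedAt q (suc n)
    closed-step n q²∤ ih .ClosedAt.divide e₀ C e₀≢0 ai = strip-X^ (suc n) q²∤ (ℕ.pred p) {e₀} {C} e₀≢0 ai X^C-divisible
      where
      open Step n
      module A₀ = RingKit (ℤ[x]/ F p a n)
      module A  = RingKit (ℤ[x]/ F p a (suc n))
      open Multiples (ℤ[x]/ F p a n) (const/ (F p a n)) q-prime using (MultipleOfQ; cancel-unit)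
      p≈ : RingKit._·_ (ℤ[x]/ F p a n) p A₀.1# A₀.≈ const (+ p)
      p≈ = A₀.trans (A₀.sym (hom-·1 (const/ (F p a n)) p)) (Hom.cong (const/ (F p a n)) (ℤ-·1 p))
      -- Here `q ≠ p` enters: the factor `p²` acquired by the trace is a unit modulo `q`.
      p²-cancel : ∀ u → MultipleOfQ (p² (ℤ[x]/ F p a n) A₀.* u) → MultipleOfQ u
      p²-cancel u (D , e) = cancel-unit q∤p u (cancel-unit q∤p (const (+ p) A₀.* u)
        (D , A₀.trans (A₀.trans (A₀.sym (A₀.*-assoc (const (+ p)) (const (+ p)) u)) (A₀.*-congʳ {x = u} (A₀.sym (A₀.*-cong p≈ p≈)))) e))
      L-divisible : ∀ j → MultipleOfQ (L ((X A.^ j) A.* C))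
      L-divisible j = p²-cancel (L ((X A.^ j) A.* C)) (ClosedAt.divide ih (e₀ ℕ.^ p) (p² (ℤ[x]/ F p a n) A₀.* L ((X A.^ j) A.* C))
        (ℕ.≢-nonZero⁻¹ (e₀ ℕ.^ p) {{ℕₚ.m^n≢0 e₀ p {{ℕ.≢-nonZero e₀≢0}}}})
        (AlmostIntegral.ai-cong (ℤ[x]/ F p a n) A₀.refl (Hom.cong (const/ (F p a n)) (pos-^ e₀ p)) A₀.refl
          (ai-L (+ q) (+ e₀) (AlmostIntegral.ai-* (ℤ[x]/ F p a (suc n)) (X A.^ j) ai))))
      X^C-divisible : MultipleOf (ℤ[x]/ F p a (suc n)) (const (+ q)) ((X A.^ ℕ.pred p) A.* C)
      X^C-divisible = L-multiple⇒multiple (+ q) C L-divisible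

    closed-away : ∀ n → (∀ j → 1 ℕ.≤ j → j ℕ.≤ n → ¬ ((+ q) ℤ.* (+ q)) ∣ itℤ j (+ 0)) → ClosedAt q n
    closed-away zero    h = closed-at-zero
    closed-away (suc n) h = closed-step n (h (suc n) (s≤s z≤n) ℕₚ.≤-refl) (closed-away n (λ j 1≤j j≤n → h j 1≤j (ℕₚ.m≤n⇒m≤1+n j≤n)))

  closed : ∀ n → 1 ℕ.≤ n → ¬ ((+ p) ℤ.* (+ p)) ∣ a ℤK.^ p ℤ.- a →
           ∀ {q} (q-prime : Prime q) → (∀ j → 1 ℕ.≤ j → j ℕ.≤ n → ¬ ((+ q) ℤ.* (+ q)) ∣ itℤ j (+ 0)) → ClosedAt q n
  closed n 1≤n p²∤ {q} q-prime h = by-cases (q ℕₚ.≟ p)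
    where
    by-cases : Dec (q ≡ p) → ClosedAt q n
    by-cases (yes q≡p) = ≡.subst (λ q → ClosedAt q n) (≡.sym q≡p) (closed-at-p n 1≤n p²∤)
    by-cases (no q≢p)  = closed-away q-prime q≢p n h

-- Passage to ℚ[x]/(g)

ℚᴿ : Ring
ℚᴿ = ℚₚ.+-*-commutativeRing

fromℚᵘ-+ : ∀ x y → ℚ.fromℚᵘ (x ℚᵘ.+ y) ≡ ℚ.fromℚᵘ x ℚ.+ ℚ.fromℚᵘ y
fromℚᵘ-+ x y = ℚₚ.toℚᵘ-injective (ℚᵘₚ.≃-trans (ℚₚ.toℚᵘ-fromℚᵘ (x ℚᵘ.+ y))
  (ℚᵘₚ.≃-sym (ℚᵘₚ.≃-trans (ℚₚ.toℚᵘ-homo-+ (ℚ.fromℚᵘ x) (ℚ.fromℚᵘ y)) (ℚᵘₚ.+-cong (ℚₚ.toℚᵘ-fromℚᵘ x) (ℚₚ.toℚᵘ-fromℚᵘ y)))))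

fromℚᵘ-* : ∀ x y → ℚ.fromℚᵘ (x ℚᵘ.* y) ≡ ℚ.fromℚᵘ x ℚ.* ℚ.fromℚᵘ y
fromℚᵘ-* x y = ℚₚ.toℚᵘ-injective (ℚᵘₚ.≃-trans (ℚₚ.toℚᵘ-fromℚᵘ (x ℚᵘ.* y))
  (ℚᵘₚ.≃-sym (ℚᵘₚ.≃-trans (ℚₚ.toℚᵘ-homo-* (ℚ.fromℚᵘ x) (ℚ.fromℚᵘ y)) (ℚᵘₚ.*-cong (ℚₚ.toℚᵘ-fromℚᵘ x) (ℚₚ.toℚᵘ-fromℚᵘ y)))))

toℚ : ℤ → ℚ
toℚ z = z ℚ./ 1

toℚ-+ : ∀ x y → toℚ (x ℤ.+ y) ≡ toℚ x ℚ.+ toℚ y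
toℚ-+ x y = ≡.trans (ℚₚ.fromℚᵘ-cong {mkℚᵘ (x ℤ.+ y) 0} {mkℚᵘ x 0 ℚᵘ.+ mkℚᵘ y 0} (*≡* (≡.cong (ℤ._* + 1) (≡.sym (≡.cong₂ ℤ._+_
  (ℤₚ.*-identityʳ x) (ℤₚ.*-identityʳ y)))))) (fromℚᵘ-+ (mkℚᵘ x 0) (mkℚᵘ y 0))

toℚ-* : ∀ x y → toℚ (x ℤ.* y) ≡ toℚ x ℚ.* toℚ y
toℚ-* x y = fromℚᵘ-* (mkℚᵘ x 0) (mkℚᵘ y 0)

toℚ-injective : ∀ {x y} → toℚ x ≡ toℚ y → x ≡ y
toℚ-injective {x} {y} e with ℚₚ.fromℚᵘ-injective {mkℚᵘ x 0} {mkℚᵘ y 0} e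
... | *≡* x1≡y1 = ≡.trans (≡.sym (ℤₚ.*-identityʳ x)) (≡.trans x1≡y1 (ℤₚ.*-identityʳ y))

toℚHom : Hom ℤᴿ ℚᴿ
toℚHom = record { ⟦_⟧ = toℚ ; cong = ≡.cong toℚ ; +-homo = toℚ-+ ; *-homo = toℚ-* ; 1-homo = ≡.refl }

reciprocal : ∀ D → D ≢ 0 → ∃ λ r → r ℚ.* toℚ (+ D) ≡ ℚ.1ℚ
reciprocal zero    D≢0 = contradiction ≡.refl D≢0
reciprocal (suc d) _   = ℚ.fromℚᵘ (mkℚᵘ (+ 1) d) , ≡.trans (≡.sym (fromℚᵘ-* (mkℚᵘ (+ 1) d) (mkℚᵘ (+ suc d) 0)))
  (ℚₚ.fromℚᵘ-cong {mkℚᵘ (+ 1) d ℚᵘ.* mkℚᵘ (+ suc d) 0} {mkℚᵘ (+ 1) 0} (*≡* (≡.trans (ℤₚ.*-identityʳ (+ 1 ℤ.* + suc d)) (≡.cong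
    (λ m → + 1 ℤ.* + m) (≡.sym (ℕₚ.*-identityʳ (suc d)))))))

denominator : ∀ r → ∃₂ λ D z → D ≢ 0 × toℚ (+ D) ℚ.* r ≡ toℚ z
denominator r@(mkℚ n d _) = suc d , n , (λ ()) , ≡.trans (≡.cong (toℚ (+ suc d) ℚ.*_) (≡.sym (ℚₚ.fromℚᵘ-toℚᵘ r)))
  (≡.trans (≡.sym (fromℚᵘ-* (mkℚᵘ (+ suc d) 0) (mkℚᵘ n d)))
    (ℚₚ.fromℚᵘ-cong {mkℚᵘ (+ suc d) 0 ℚᵘ.* mkℚᵘ n d} {mkℚᵘ n 0} (*≡* (≡.trans (ℤₚ.*-identityʳ (+ suc d ℤ.* n))
      (≡.trans (ℤₚ.*-comm (+ suc d) n) (≡.cong (λ m → n ℤ.* + m) (≡.sym (ℕₚ.+-identityʳ (suc d)))))))))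

module PolyMap {K B : Ring} (h : Hom K B) where
  private
    module h = Hom h
    module K = PolyBase K
    module B = PolyBase B

  coeff-map : ∀ p i → CommutativeRing._≈_ B (B.coeff (map h.⟦_⟧ p) i) h.⟦ K.coeff p i ⟧
  coeff-map []      i       = CommutativeRing.sym B h.0-homo
  coeff-map (c ∷ p) zero    = CommutativeRing.refl B
  coeff-map (c ∷ p) (suc i) = coeff-map p i

  -- Changing coefficients is evaluation at `X`, so `mapHom` inherits its laws from `evHom`.
  map-as-ev : ∀ p → map h.⟦_⟧ p B.≋ ev (B.constHom ∘ₕ h) B.X p
  map-as-ev []      = B.≋-refl
  map-as-ev (c ∷ p) = B.≋-trans (B.∷-cong (CommutativeRing.refl B) (map-as-ev p)) (B.∷-as-sum h.⟦ c ⟧ _)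

  mapHom : Hom (Poly K) (Poly B)
  mapHom = record
    { ⟦_⟧ = map h.⟦_⟧
    ; cong   = λ {p} {q} e → B.≋-trans (map-as-ev p) (B.≋-trans (E.cong e) (B.≋-sym (map-as-ev q)))
    ; +-homo = λ p q → B.≋-trans (map-as-ev (K.addP p q)) (B.≋-trans (E.+-homo p q) (B.≋-sym (B.add-cong (map-as-ev p) (map-as-ev q))))
    ; *-homo = λ p q → B.≋-trans (map-as-ev (K.mulP p q)) (B.≋-trans (E.*-homo p q) (B.≋-sym (B.mul-cong (map-as-ev p) (map-as-ev q))))
    ; 1-homo = B.≋-trans (map-as-ev _) E.1-homo }
    where module E = Hom (evHom (B.constHom ∘ₕ h) B.X)

module ℤ[X] = PolyBase ℤᴿ
module ℚ[X] = PolyBase ℚᴿ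

ℚ[x]ᴿ : Ring
ℚ[x]ᴿ = Poly ℚᴿ

toℚ[x]Hom : Hom ℤ[x]ᴿ ℚ[x]ᴿ
toℚ[x]Hom = PolyMap.mapHom toℚHom

toℚ[x]-injective : ∀ {p q} → toℚ[x] p ℚ[X].≋ toℚ[x] q → p ℤ[X].≋ q
toℚ[x]-injective {p} {q} e .ℤ[X].at i = toℚ-injective (≡.trans (≡.sym (PolyMap.coeff-map toℚHom p i))
  (≡.trans (ℚ[X].at e i) (PolyMap.coeff-map toℚHom q i)))

clear-denominators : ∀ β → ∃₂ λ D B → D ≢ 0 × ℚ[X].scaleP (toℚ (+ D)) β ℚ[X].≋ toℚ[x] B
clear-denominators []      = 1 , [] , (λ ()) , ℚ[X].≋-refl
clear-denominators (r ∷ β) = combine (denominator r) (clear-denominators β)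
  where
  combine : (∃₂ λ D z → D ≢ 0 × toℚ (+ D) ℚ.* r ≡ toℚ z) → (∃₂ λ D B → D ≢ 0 × ℚ[X].scaleP (toℚ (+ D)) β ℚ[X].≋ toℚ[x] B) →
            ∃₂ λ D B → D ≢ 0 × ℚ[X].scaleP (toℚ (+ D)) (r ∷ β) ℚ[X].≋ toℚ[x] B
  combine (D , z , D≢0 , e) (D′ , B , D′≢0 , e′) = D′ ℕ.* D , (+ D′ ℤ.* z) ∷ ℤ[X].scaleP (+ D) B ,
    (λ DD′≡0 → [ D′≢0 , D≢0 ]′ (ℕₚ.m*n≡0⇒m≡0∨n≡0 D′ DD′≡0)) , ℚ[X].∷-cong head tail
    where
    DD′ : toℚ (+ (D′ ℕ.* D)) ≡ toℚ (+ D′) ℚ.* toℚ (+ D)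
    DD′ = ≡.trans (≡.cong toℚ (ℤₚ.pos-* D′ D)) (toℚ-* (+ D′) (+ D))
    head : toℚ (+ (D′ ℕ.* D)) ℚ.* r ≡ toℚ (+ D′ ℤ.* z)
    head = ≡.trans (≡.cong (ℚ._* r) DD′) (≡.trans (ℚₚ.*-assoc (toℚ (+ D′)) (toℚ (+ D)) r) (≡.trans (≡.cong (toℚ (+ D′) ℚ.*_) e) (≡.sym
      (toℚ-* (+ D′) z))))
    tail : ℚ[X].scaleP (toℚ (+ (D′ ℕ.* D))) β ℚ[X].≋ toℚ[x] (ℤ[X].scaleP (+ D) B)
    tail .ℚ[X].at i = ≡.trans (ℚ[X].coeff-scale (toℚ (+ (D′ ℕ.* D))) β i) (≡.trans (≡.cong (ℚ._* ℚ[X].coeff β i)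
      (≡.trans DD′ (ℚₚ.*-comm (toℚ (+ D′)) (toℚ (+ D)))))
      (≡.trans (ℚₚ.*-assoc (toℚ (+ D)) (toℚ (+ D′)) (ℚ[X].coeff β i)) (≡.trans (≡.cong (toℚ (+ D) ℚ.*_)
        (≡.trans (≡.sym (ℚ[X].coeff-scale (toℚ (+ D′)) β i)) (≡.trans (ℚ[X].at e′ i) (PolyMap.coeff-map toℚHom B i))))
        (≡.trans (≡.sym (toℚ-* (+ D) (ℤ[X].coeff B i))) (≡.trans (≡.cong toℚ (≡.sym (ℤ[X].coeff-scale (+ D) B i))) (≡.sym
          (PolyMap.coeff-map toℚHom (ℤ[X].scaleP (+ D) B) i)))))))

ℚ[x]/_ : List ℤ → Ring
ℚ[x]/ g = Quot ℚ[x]ᴿ (toℚ[x] g)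

π/ℚ : ∀ g → Hom ℚ[x]ᴿ (ℚ[x]/ g)
π/ℚ g = project ℚ[x]ᴿ (toℚ[x] g)

IsZeroP⇒≋[] : ∀ {p} → ℚP.IsZeroP p → p ℚ[X].≋ []
IsZeroP⇒≋[] []       = ℚ[X].≋-refl
IsZeroP⇒≋[] (e ∷ es) = ℚ[X].[]-∷ e (IsZeroP⇒≋[] es)

≋[]⇒IsZeroP : ∀ p → p ℚ[X].≋ [] → ℚP.IsZeroP p
≋[]⇒IsZeroP []      e = []
≋[]⇒IsZeroP (c ∷ p) e = ℚ[X].at e 0 ∷ ≋[]⇒IsZeroP p (ℚ[X].[]-∷⁻ e)

CongMod⇒≈ : ∀ {g β γ} → CongMod g β γ → CommutativeRing._≈_ (ℚ[x]/ g) β γ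
CongMod⇒≈ {g} {β} {γ} (q , z) = q , RingFacts.unmove ℚ[x]ᴿ {β} {γ} (RingFacts.difference-zero⁻ ℚ[x]ᴿ (IsZeroP⇒≋[] z))

≈⇒CongMod : ∀ {g β γ} → CommutativeRing._≈_ (ℚ[x]/ g) β γ → CongMod g β γ
≈⇒CongMod {g} {β} {γ} (q , e) = q , ≋[]⇒IsZeroP _ (CommutativeRing.trans ℚ[x]ᴿ (CommutativeRing.+-congʳ ℚ[x]ᴿ (RingFacts.move ℚ[x]ᴿ {β} {γ}
  {ℚ[X].mulP q (toℚ[x] g)} e)) (ℚ[X].add-negʳ (ℚ[X].mulP q (toℚ[x] g))))

ev-map : ∀ {K L B} (h : Hom K L) (ι : Hom L B) (ι′ : Hom K B) →
  (∀ c → CommutativeRing._≈_ B (Hom.⟦_⟧ ι (Hom.⟦_⟧ h c)) (Hom.⟦_⟧ ι′ c)) →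
  ∀ u p → CommutativeRing._≈_ B (ev ι u (map (Hom.⟦_⟧ h) p)) (ev ι′ u p)
ev-map {B = B} h ι ι′ e u []  = CommutativeRing.refl B
ev-map {B = B} h ι ι′ e u (c ∷ p) = +-cong (e c) (*-cong refl (ev-map h ι ι′ e u p))
  where open CommutativeRing B

module _ (g : List ℤ) where
  embed : Hom (ℤ[x]/ g) (ℚ[x]/ g)
  embed = descend ℤ[x]ᴿ g (π/ℚ g ∘ₕ toℚ[x]Hom) (modulus≈0 ℚ[x]ᴿ (toℚ[x] g))

  ιℚ : Hom ℤᴿ (ℚ[x]/ g)
  ιℚ = embed ∘ₕ const/ g

  private module Q = CommutativeRing (ℚ[x]/ g)

  ev-ιℚ : ∀ h β → ℚP.compP (toℚ[x] h) β Q.≈ ev ιℚ β h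
  ev-ιℚ h β = Q.trans (Q.reflexive (compP≡ev ℚᴿ (toℚ[x] h) β))
    (Q.trans (hom-ev ℚ[X].constHom (π/ℚ g ∘ₕ ℚ[X].constHom) (π/ℚ g) (λ _ → Q.refl) β (toℚ[x] h))
      (ev-map toℚHom (π/ℚ g ∘ₕ ℚ[X].constHom) ιℚ (λ _ → Q.refl) β h))

  module _ {k : ℕ} (g-monic : MonicPoly.MonicOfDegree ℤᴿ k g) where
    private
      module A = CommutativeRing (ℤ[x]/ g)

    -- If `u = q g` over `ℚ` and `D` clears the denominators of `q`, then `D u` is a multiple of `g`
    -- in `ℤ[x]`, and `D` is regular modulo `g`.
    embed-injective₀ : ∀ u → toℚ[x] u Q.≈ [] → u A.≈ []
    embed-injective₀ u (q , e) = finish (clear-denominators q)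
      where
      finish : (∃₂ λ D B → D ≢ 0 × ℚ[X].scaleP (toℚ (+ D)) q ℚ[X].≋ toℚ[x] B) → u A.≈ []
      finish (D , B , D≢0 , eB) = MonicQuotient.torsion-free₀ g-monic (+ D) (D≢0 ∘ ℤₚ.+-injective) u
        (B , ℤ[X].≋-trans (ℤ[X].const-mul (+ D) u) (toℚ[x]-injective {ℤ[X].scaleP (+ D) u} {ℤ[X].mulP B g} scaled))
        where
        scaled : toℚ[x] (ℤ[X].scaleP (+ D) u) ℚ[X].≋ toℚ[x] (ℤ[X].mulP B g)
        scaled = begin
          toℚ[x] (ℤ[X].scaleP (+ D) u)  ≈⟨ Hom.cong toℚ[x]Hom (ℤ[X].const-mul (+ D) u) ⟨
          toℚ[x] (ℤ[X].mulP (ℤ[X].const (+ D)) u)  ≈⟨ Hom.*-homo toℚ[x]Hom (ℤ[X].const (+ D)) u ⟩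
          ℚ[X].const (toℚ (+ D)) * toℚ[x] u  ≈⟨ *-congˡ {x = ℚ[X].const (toℚ (+ D))} e ⟩
          ℚ[X].const (toℚ (+ D)) * (q * toℚ[x] g)  ≈⟨ *-assoc (ℚ[X].const (toℚ (+ D))) q (toℚ[x] g) ⟨
          ℚ[X].const (toℚ (+ D)) * q * toℚ[x] g  ≈⟨ *-congʳ {x = toℚ[x] g} (trans (ℚ[X].const-mul (toℚ (+ D)) q) eB) ⟩
          toℚ[x] B * toℚ[x] g  ≈⟨ Hom.*-homo toℚ[x]Hom B g ⟨
          toℚ[x] (ℤ[X].mulP B g)  ∎
          where open RingKit ℚ[x]ᴿ

    embed-injective : ∀ {u v} → toℚ[x] u Q.≈ toℚ[x] v → u A.≈ v
    embed-injective {u} {v} e = RingFacts.difference-zero⁻ (ℤ[x]/ g) (embed-injective₀ (u A.- v)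
      (Q.trans (Hom.+-homo embed u (A.- v)) (Q.trans (Q.+-cong {toℚ[x] u} {toℚ[x] v} e (Hom.neg-homo embed v)) (Q.-‿inverseʳ (toℚ[x] v)))))

module _ {B : Ring} (ι : Hom ℤᴿ B) (β : CommutativeRing.Carrier B) where
  open RingKit B

  ev-snoc : ∀ p → ev ι β (p ∷ʳ + 1) ≈ ev ι β p + β ^ length p
  ev-snoc []      = trans (+-cong (Hom.1-homo ι) (zeroʳ β)) (+-comm 1# 0#)
  ev-snoc (c ∷ p) = trans (+-congˡ (*-congˡ (ev-snoc p)))
    (solve 4 (λ c b e w → c :+ b :* (e :+ w) := (c :+ b :* e) :+ b :* w) refl _ _ _ _)

-- With k the degree of the monic equation of β, D^k clears the denominators of all powers of β.
module IntegralPowers {A Q : Ring} (ι : Hom ℤᴿ A) (j : Hom A Q) where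
  open RingKit Q
  private
    module A = RingKit A
    module j = Hom j
    module ι = Hom ι

  module _ (j-injective : ∀ {u v} → j.⟦ u ⟧ ≈ j.⟦ v ⟧ → u A.≈ v)
    (D : ℤ) (B : A.Carrier) (β : Carrier) (Dβ≈B : j.⟦ ι.⟦ D ⟧ ⟧ * β ≈ j.⟦ B ⟧)
    (xs : List ℤ) (root : ev (j ∘ₕ ι) β (xs ∷ʳ + 1) ≈ 0#) where
    private
      k = length xs
      δ = j.⟦ ι.⟦ D ⟧ ⟧

      Cleared : Carrier → Set
      Cleared u = ∃ λ E → δ ^ k * u ≈ j.⟦ E ⟧

      cleared-cong : ∀ {u v} → u ≈ v → Cleared u → Cleared v
      cleared-cong e (E , eq) = E , trans (*-congˡ (sym e)) eq

      cleared-neg : ∀ {u} → Cleared u → Cleared (- u)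
      cleared-neg (E , eq) = A.- E , trans (sym (-‿distribʳ-* _ _)) (trans (-‿cong eq) (sym (j.neg-homo E)))

      cleared-ev : ∀ ys m → (∀ i → i ℕ.< length ys → Cleared (β ^ (m ℕ.+ i))) → Cleared (β ^ m * ev (j ∘ₕ ι) β ys)
      cleared-ev []       m h = A.0# , trans (*-congˡ (zeroʳ _)) (trans (zeroʳ _) (sym j.0-homo))
      cleared-ev (c ∷ ys) m h = combine (h 0 (s≤s z≤n)) (cleared-ev ys (suc m) (λ i i<l → ≡.subst (λ t → Cleared (β ^ t)) (ℕₚ.+-suc m i) (h
        (suc i) (s≤s i<l))))
        where
        combine : Cleared (β ^ (m ℕ.+ 0)) → Cleared (β ^ suc m * ev (j ∘ₕ ι) β ys) → Cleared (β ^ m * (j.⟦ ι.⟦ c ⟧ ⟧ + β * ev (j ∘ₕ ι) β ys))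
        combine (E , eq) (E′ , eq′) = ι.⟦ c ⟧ A.* E A.+ E′ , (begin
          δ ^ k * (β ^ m * (j.⟦ ι.⟦ c ⟧ ⟧ + β * ev (j ∘ₕ ι) β ys))
            ≈⟨ solve 5 (λ d w c b e → d :* (w :* (c :+ b :* e)) := c :* (d :* w) :+ d :* ((b :* w) :* e)) refl _ _ _ _ _ ⟩
          j.⟦ ι.⟦ c ⟧ ⟧ * (δ ^ k * β ^ m) + δ ^ k * (β ^ suc m * ev (j ∘ₕ ι) β ys)
            ≈⟨ +-cong (*-congˡ (trans (*-congˡ (^-congʳ β (≡.sym (ℕₚ.+-identityʳ m)))) eq)) eq′ ⟩
          j.⟦ ι.⟦ c ⟧ ⟧ * j.⟦ E ⟧ + j.⟦ E′ ⟧
            ≈⟨ trans (j.+-homo _ _) (+-congʳ (j.*-homo _ _)) ⟨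
          j.⟦ ι.⟦ c ⟧ A.* E A.+ E′ ⟧ ∎)

      small : ∀ i d → i ℕ.+ d ≡ k → Cleared (β ^ i)
      small i d i+d≡k = ι.⟦ D ⟧ A.^ d A.* B A.^ i , (begin
        δ ^ k * β ^ i  ≈⟨ *-congʳ (trans (^-congʳ δ (≡.sym i+d≡k)) (^-homo-* δ i d)) ⟩
        (δ ^ i * δ ^ d) * β ^ i  ≈⟨ solve 3 (λ a b c → (a :* b) :* c := b :* (a :* c)) refl _ _ _ ⟩
        δ ^ d * (δ ^ i * β ^ i)  ≈⟨ *-congˡ (trans (sym (^-distrib-* δ β i)) (^-congˡ i Dβ≈B)) ⟩
        δ ^ d * j.⟦ B ⟧ ^ i  ≈⟨ trans (j.*-homo _ _) (*-cong (j.^-homo _ d) (j.^-homo B i)) ⟨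
        j.⟦ ι.⟦ D ⟧ A.^ d A.* B A.^ i ⟧  ∎)

      -- Below the degree `k` the factor `D^k` suffices outright. From `k` on, the monic equation
      -- rewrites `β^i` through the `k` preceding powers, hence the course-of-values induction.
      cleared-^ : ∀ i → Cleared (β ^ i)
      cleared-^ = <-rec _ step
        where
        step : ∀ i → (∀ {m} → m ℕ.< i → Cleared (β ^ m)) → Cleared (β ^ i)
        step i rec with i ℕₚ.<? k
        ... | yes i<k = small i (k ℕ.∸ i) (ℕₚ.m+[n∸m]≡n (ℕₚ.<⇒≤ i<k))
        ... | no  i≮k = cleared-cong reduce (cleared-neg (cleared-ev xs m (λ l l<k → rec (≡.subst (m ℕ.+ l ℕ.<_) m+k≡i (ℕₚ.+-monoʳ-< m l<k)))))
          where
          m = i ℕ.∸ k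
          m+k≡i : m ℕ.+ k ≡ i
          m+k≡i = ℕₚ.m∸n+n≡m (ℕₚ.≮⇒≥ i≮k)
          reduce : - (β ^ m * ev (j ∘ₕ ι) β xs) ≈ β ^ i
          reduce = begin
            - (β ^ m * ev (j ∘ₕ ι) β xs)
              ≈⟨ solve 3 (λ w e z → :- (w :* e) := w :* z :- w :* (e :+ z)) refl (β ^ m) (ev (j ∘ₕ ι) β xs) (β ^ k) ⟩
            β ^ m * β ^ k - β ^ m * (ev (j ∘ₕ ι) β xs + β ^ k)
              ≈⟨ +-cong (trans (sym (^-homo-* β m k)) (^-congʳ β m+k≡i)) (-‿cong (trans (*-congˡ
                (trans (sym (ev-snoc (j ∘ₕ ι) β xs)) root)) (zeroʳ _))) ⟩
            β ^ i - 0#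
              ≈⟨ trans (+-congˡ -0#≈0#) (+-identityʳ _) ⟩
            β ^ i ∎

    almostInt : AlmostIntegral.AlmostInt A ι.⟦ D ⟧ (ι.⟦ D ⟧ A.^ k) B
    almostInt .AlmostIntegral.AlmostInt.power i = pull (cleared-^ i)
      where
      pull : Cleared (β ^ i) → ∃ λ E → ι.⟦ D ⟧ A.^ k A.* B A.^ i A.≈ ι.⟦ D ⟧ A.^ i A.* E
      pull (E , eq) = E , j-injective (begin
        j.⟦ ι.⟦ D ⟧ A.^ k A.* B A.^ i ⟧  ≈⟨ trans (j.*-homo _ _) (*-cong (j.^-homo _ k) (j.^-homo B i)) ⟩
        δ ^ k * j.⟦ B ⟧ ^ i  ≈⟨ *-congˡ (trans (^-congˡ i (sym Dβ≈B)) (^-distrib-* δ β i)) ⟩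
        δ ^ k * (δ ^ i * β ^ i)  ≈⟨ solve 3 (λ a b c → a :* (b :* c) := b :* (a :* c)) refl _ _ _ ⟩
        δ ^ i * (δ ^ k * β ^ i)  ≈⟨ *-congˡ eq ⟩
        δ ^ i * j.⟦ E ⟧  ≈⟨ trans (j.*-homo _ _) (*-congʳ (j.^-homo _ i)) ⟨
        j.⟦ ι.⟦ D ⟧ A.^ i A.* E ⟧  ∎)

module StripPrimes (A : Ring) (ι : Hom ℤᴿ A) where
  open RingKit A
  open AlmostIntegral A
  private module ι = Hom ι

  module _ (torsion-free : ∀ m → m ≢ + 0 → ∀ {u v} → ι.⟦ m ⟧ * u ≈ ι.⟦ m ⟧ * v → u ≈ v)
    (e : ℕ) (closed : ∀ q → Prime q → ∀ C → AlmostInt ι.⟦ + q ⟧ ι.⟦ + e ⟧ C → MultipleOf A ι.⟦ + q ⟧ C) where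
    private
      q-regular : ∀ {q} → Prime q → ∀ {u v} → ι.⟦ + q ⟧ * u ≈ ι.⟦ + q ⟧ * v → u ≈ v
      q-regular {q} q-prime = torsion-free (+ q) (prime≢0 q-prime ∘ ℤₚ.+-injective)

    -- `B/q` is a multiple of `B/D`, so closedness at `q` gives `B = q B′`. Then `B′/(D/q)` is the
    -- same fraction as `B/D`, so the common denominator `e` stays fixed while the primes of `D` are
    -- removed.
    multiple-of-product : ∀ qs → All Prime qs → ∀ B → AlmostInt ι.⟦ + product qs ⟧ ι.⟦ + e ⟧ B → MultipleOf A ι.⟦ + product qs ⟧ B
    multiple-of-product []       []                   B ai = B , trans (sym (*-identityˡ B)) (*-congʳ (sym ι.1-homo))
    multiple-of-product (q ∷ qs) (q-prime ∷ qs-prime) B ai = first (closed q q-prime B ai-q)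
      where
      Q = ι.⟦ + q ⟧
      P = ι.⟦ + product qs ⟧
      QP : ι.⟦ + (q ℕ.* product qs) ⟧ ≈ Q * P
      QP = trans (ι.cong (ℤₚ.pos-* q (product qs))) (ι.*-homo _ _)
      ai′ : AlmostInt (Q * P) ι.⟦ + e ⟧ B
      ai′ = ai-cong QP refl refl ai
      ai-q : AlmostInt Q ι.⟦ + e ⟧ B
      ai-q .power i with power ai′ i
      ... | E , eq = P ^ i * E , trans eq (trans (*-congʳ (^-distrib-* Q P i)) (*-assoc _ _ _))
      first : MultipleOf A Q B → MultipleOf A ι.⟦ + (q ℕ.* product qs) ⟧ B
      first (B′ , B≈QB′) = rest (multiple-of-product qs qs-prime B′ ai-rest)
        where
        ai-rest : AlmostInt P ι.⟦ + e ⟧ B′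
        ai-rest .power i with power ai′ i
        ... | E , eq = E , RingFacts.cancel-^ A (q-regular q-prime) i (begin
          Q ^ i * (ι.⟦ + e ⟧ * B′ ^ i)  ≈⟨ solve 3 (λ a b c → a :* (b :* c) := b :* (a :* c)) refl _ _ _ ⟩
          ι.⟦ + e ⟧ * (Q ^ i * B′ ^ i)  ≈⟨ *-congˡ (trans (sym (^-distrib-* Q B′ i)) (^-congˡ i (sym B≈QB′))) ⟩
          ι.⟦ + e ⟧ * B ^ i  ≈⟨ eq ⟩
          (Q * P) ^ i * E  ≈⟨ trans (*-congʳ (^-distrib-* Q P i)) (*-assoc _ _ _) ⟩
          Q ^ i * (P ^ i * E)  ∎)
        rest : MultipleOf A P B′ → MultipleOf A ι.⟦ + (q ℕ.* product qs) ⟧ B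
        rest (B″ , B′≈PB″) = B″ , trans B≈QB′ (trans (*-congˡ B′≈PB″) (trans (sym (*-assoc _ _ _)) (*-congʳ (sym QP))))

module _ {g : List ℤ} {k : ℕ} (g-monic : MonicPoly.MonicOfDegree ℤᴿ k g)
  (closed : ∀ q → Prime q → ∀ e → e ≢ 0 → ∀ C → AlmostIntegral.AlmostInt (ℤ[x]/ g) (ℤ[X].const (+ q)) (ℤ[X].const (+ e)) C → MultipleOf
    (ℤ[x]/ g) (ℤ[X].const (+ q)) C) where
  private
    module A = RingKit (ℤ[x]/ g)
    module Q = RingKit (ℚ[x]/ g)

  divide-back : ∀ D → D ≢ 0 → ∀ β B → ℚ[X].const (toℚ (+ D)) Q.* β Q.≈ toℚ[x] B → MultipleOf (ℤ[x]/ g) (ℤ[X].const (+ D)) B → InZα g β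
  divide-back D D≢0 β B Dβ≈B (B′ , B≈DB′) = B′ , ≈⇒CongMod {g} {β} {toℚ[x] B′} (finish (reciprocal D D≢0))
    where
    δ = ℚ[X].const (toℚ (+ D))
    δβ≈δB′ : δ Q.* β Q.≈ δ Q.* toℚ[x] B′
    δβ≈δB′ = Q.trans Dβ≈B (Q.trans (Hom.cong (embed g) B≈DB′) (Hom.*-homo (embed g) (ℤ[X].const (+ D)) B′))
    finish : (∃ λ r → r ℚ.* toℚ (+ D) ≡ ℚ.1ℚ) → β Q.≈ toℚ[x] B′
    finish (r , rD≡1) = RingFacts.cancel-invertible (ℚ[x]/ g) {ℚ[X].const r} {δ} {β} {toℚ[x] B′} unit δβ≈δB′
      where
      unit : ℚ[X].const r Q.* δ Q.≈ Q.1#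
      unit = Hom.cong (π/ℚ g) (ℚ[X].≋-trans (ℚ[X].≋-sym (Hom.*-homo ℚ[X].constHom r (toℚ (+ D)))) (Hom.cong ℚ[X].constHom rD≡1))

  -- With `β = B/D` and `B` in `ℤ[α]`, membership of `β` in `ℤ[α]` is the divisibility of `B` by
  -- `D`, which is settled prime by prime over a factorisation of `D`.
  integrally-closed : RingOfIntegersIsZα g
  integrally-closed β (h , (xs , h≡) , hβ) = from-denominator (clear-denominators β)
    where
    root : ev (ιℚ g) β (xs ∷ʳ + 1) Q.≈ Q.0#
    root = ≡.subst (λ h → ev (ιℚ g) β h Q.≈ Q.0#) h≡ (Q.trans (Q.sym (ev-ιℚ g h β)) (CongMod⇒≈ {g} {ℚP.compP (toℚ[x] h) β} {[]} hβ))
    from-denominator : (∃₂ λ D B → D ≢ 0 × ℚ[X].scaleP (toℚ (+ D)) β ℚ[X].≋ toℚ[x] B) → InZα g β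
    from-denominator (D , B , D≢0 , DB) = divide-back D D≢0 β B Dβ≈B
        (≡.subst (λ d → MultipleOf (ℤ[x]/ g) (ℤ[X].const (+ d)) B) (≡.sym D≡)
          (StripPrimes.multiple-of-product (ℤ[x]/ g) (const/ g) (MonicQuotient.torsion-free g-monic) (D ℕ.^ length xs)
            (λ q q-prime → closed q q-prime (D ℕ.^ length xs) (ℕ.≢-nonZero⁻¹ (D ℕ.^ length xs) {{ℕₚ.m^n≢0 D (length xs)}}))
            factors factorsPrime B (≡.subst (λ d → AlmostIntegral.AlmostInt (ℤ[x]/ g) (ℤ[X].const (+ d)) (ℤ[X].const (+
              (D ℕ.^ length xs))) B) D≡ ai)))
      where
      instance D-nonZero = ℕ.≢-nonZero D≢0
      open PrimeFactorisation (factorise D) renaming (isFactorisation to D≡)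
      Dβ≈B : ℚ[X].const (toℚ (+ D)) Q.* β Q.≈ toℚ[x] B
      Dβ≈B = Hom.cong (π/ℚ g) (ℚ[X].≋-trans (ℚ[X].const-mul (toℚ (+ D)) β) DB)
      ai : AlmostIntegral.AlmostInt (ℤ[x]/ g) (ℤ[X].const (+ D)) (ℤ[X].const (+ (D ℕ.^ length xs))) B
      ai = AlmostIntegral.ai-cong (ℤ[x]/ g) A.refl (A.trans (A.sym (Hom.^-homo (const/ g) (+ D) (length xs))) (Hom.cong (const/ g) (pos-^ D
        (length xs)))) A.refl
        (IntegralPowers.almostInt (const/ g) (embed g) (embed-injective g g-monic) (+ D) B β Dβ≈B xs root)

-- An integral element outside ℤ[α]

module ReciprocalRoot {Q : Ring} (ι : Hom ℤᴿ Q) where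
  open RingKit Q
  private module ι = Hom ι

  module _ {d : ℤ} (cancel-d : ∀ {u v} → ι.⟦ d ⟧ * u ≈ ι.⟦ d ⟧ * v → u ≈ v)
    {y β : Carrier} {m c₁ : ℤ} (yβ : y * β ≈ - (ι.⟦ d ⟧ * ι.⟦ m ⟧))
    (c : List ℤ) (dβ : ι.⟦ d ⟧ * β ≈ ι.⟦ d ⟧ * ι.⟦ c₁ ⟧ + y * ev ι y c) where
    private
      evβ = ev ι β

      monomial : ℕ → ℤ → List ℤ
      monomial zero    z = z ∷ []
      monomial (suc n) z = + 0 ∷ monomial n z

      ev-monomial : ∀ n z → evβ (monomial n z) ≈ β ^ n * ι.⟦ z ⟧
      ev-monomial zero    z = trans (ev-const ι β z) (sym (*-identityˡ _))
      ev-monomial (suc n) z = begin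
        ι.⟦ + 0 ⟧ + β * evβ (monomial n z)  ≈⟨ +-cong ι.0-homo (*-congˡ (ev-monomial n z)) ⟩
        0# + β * (β ^ n * ι.⟦ z ⟧)  ≈⟨ trans (+-identityˡ _) (sym (*-assoc _ _ _)) ⟩
        β ^ suc n * ι.⟦ z ⟧  ∎

      length-monomial : ∀ n z → length (monomial n z) ≡ suc n
      length-monomial zero    z = ≡.refl
      length-monomial (suc n) z = ≡.cong suc (length-monomial n z)

      length-add : ∀ (p q : List ℤ) → length q ℕ.≤ length p → length (addP p q) ≡ length p
      length-add []      []      _         = ≡.refl
      length-add (x ∷ p) []      _         = ≡.refl
      length-add (x ∷ p) (z ∷ q) (s≤s q≤p) = ≡.cong suc (length-add p q q≤p)

      length-scale : ∀ z (p : List ℤ) → length (scaleP z p) ≡ length p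
      length-scale z []      = ≡.refl
      length-scale z (x ∷ p) = ≡.cong suc (length-scale z p)

      -- β^{length c} c(y) as a polynomial in β, obtained from yβ ∈ ℤ.
      Reversed : List ℤ → Set
      Reversed c = ∃ λ W → length W ℕ.≤ suc (length c) × evβ W ≈ β ^ length c * ev ι y c

      -- Each further coefficient brings one more `β` and one more `y`; the product `y β` is the
      -- integer `-(d m)`, so `y` disappears.
      reverse : ∀ c → Reversed c
      reverse []      = [] , z≤n , sym (zeroʳ _)
      reverse (z ∷ c) = extend (reverse c)
        where
        extend : Reversed c → Reversed (z ∷ c)
        extend (W , |W| , eW) = addP (monomial n z) (scaleP (ℤ.- (d ℤ.* m)) W) , bound , (begin
          evβ (addP (monomial n z) (scaleP (ℤ.- (d ℤ.* m)) W))
            ≈⟨ Evaluation.ev-add ι β (monomial n z) (scaleP (ℤ.- (d ℤ.* m)) W) ⟩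
          evβ (monomial n z) + evβ (scaleP (ℤ.- (d ℤ.* m)) W)
            ≈⟨ +-cong (ev-monomial n z) (trans (Evaluation.ev-scale ι β (ℤ.- (d ℤ.* m)) W) (*-cong
              (trans (ι.neg-homo _) (-‿cong (ι.*-homo d m))) eW)) ⟩
          β ^ n * ι.⟦ z ⟧ + - (ι.⟦ d ⟧ * ι.⟦ m ⟧) * (β ^ length c * ev ι y c)
            ≈⟨ +-congˡ (*-congʳ yβ) ⟨
          β ^ n * ι.⟦ z ⟧ + (y * β) * (β ^ length c * ev ι y c)
            ≈⟨ solve 5 (λ b w z y e → (b :* w) :* z :+ (y :* b) :* (w :* e) := (b :* w) :* (z :+ y :* e)) refl β (β ^ length c) ι.⟦ z ⟧ y (ev ι y c) ⟩
          β ^ n * (ι.⟦ z ⟧ + y * ev ι y c) ∎)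
          where
          n = suc (length c)
          bound : length (addP (monomial n z) (scaleP (ℤ.- (d ℤ.* m)) W)) ℕ.≤ suc n
          bound = ℕₚ.≤-reflexive (≡.trans (length-add (monomial n z) (scaleP (ℤ.- (d ℤ.* m)) W) (≡.subst₂ ℕ._≤_ (≡.sym (length-scale (ℤ.-
            (d ℤ.* m)) W)) (≡.sym (length-monomial n z)) (ℕₚ.≤-trans |W| (ℕₚ.n≤1+n n)))) (length-monomial n z))

    -- Let `n = 1 + length c`. Then `d (β^(n+1) - c₁ β^n) = β^n y c(y) = (y β) β^(n-1) c(y) = -d m
    -- W(β)`, and cancelling `d` leaves `β^(n+1) - c₁ β^n + m W(β) = 0`.
    monic-equation : ∃ λ P → ev ι β (P ∷ʳ + 1) ≈ 0#
    monic-equation = finish (reverse c)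
      where
      n = suc (length c)
      finish : Reversed c → ∃ λ P → ev ι β (P ∷ʳ + 1) ≈ 0#
      finish (W , |W| , eW) = P , (begin
        ev ι β (P ∷ʳ + 1)  ≈⟨ ev-snoc ι β P ⟩
        evβ P + β ^ length P  ≈⟨ +-cong evP (^-congʳ β |P|) ⟩
        (- (β ^ n * ι.⟦ c₁ ⟧) + ι.⟦ m ⟧ * evβ W) + β ^ suc n  ≈⟨ vanishing ⟩
        0#  ∎)
        where
        -- The padded list `monomial n` has length `n + 1` and `W` is no longer, so the appended 1
        -- is the coefficient of exactly `β^(n+1)`.
        P = addP (monomial n (ℤ.- c₁)) (scaleP m W)
        |P| : length P ≡ suc n
        |P| = ≡.trans (length-add (monomial n (ℤ.- c₁)) (scaleP m W) (≡.subst₂ ℕ._≤_ (≡.sym (length-scale m W)) (≡.sym (length-monomial n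
          (ℤ.- c₁))) (ℕₚ.≤-trans |W| (ℕₚ.n≤1+n n)))) (length-monomial n (ℤ.- c₁))
        evP : evβ P ≈ - (β ^ n * ι.⟦ c₁ ⟧) + ι.⟦ m ⟧ * evβ W
        evP = trans (Evaluation.ev-add ι β (monomial n (ℤ.- c₁)) (scaleP m W)) (+-cong (trans (ev-monomial n (ℤ.- c₁))
          (trans (*-congˡ (ι.neg-homo c₁)) (sym (-‿distribʳ-* _ _)))) (Evaluation.ev-scale ι β m W))
        δ = ι.⟦ d ⟧
        V = ev ι y c
        w = β ^ length c
        vanishing : (- (β ^ n * ι.⟦ c₁ ⟧) + ι.⟦ m ⟧ * evβ W) + β ^ suc n ≈ 0#
        vanishing = cancel-d (begin
          δ * ((- ((β * w) * ι.⟦ c₁ ⟧) + ι.⟦ m ⟧ * evβ W) + β * (β * w))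
            ≈⟨ *-congˡ (+-congʳ (+-congˡ (*-congˡ eW))) ⟩
          δ * ((- ((β * w) * ι.⟦ c₁ ⟧) + ι.⟦ m ⟧ * (w * V)) + β * (β * w))
            ≈⟨ solve 6 (λ δ b w c m V → δ :* ((:- ((b :* w) :* c) :+ m :* (w :* V)) :+ b :* (b :* w)) := (b :* w) :* (δ :* b) :- (b :* w) :*
              (δ :* c) :+ (δ :* m) :* (w :* V)) refl δ β w ι.⟦ c₁ ⟧ ι.⟦ m ⟧ V ⟩
          (β * w) * (δ * β) - (β * w) * (δ * ι.⟦ c₁ ⟧) + (δ * ι.⟦ m ⟧) * (w * V)
            ≈⟨ +-congʳ (+-congʳ (*-congˡ dβ)) ⟩
          (β * w) * (δ * ι.⟦ c₁ ⟧ + y * V) - (β * w) * (δ * ι.⟦ c₁ ⟧) + (δ * ι.⟦ m ⟧) * (w * V)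
            ≈⟨ solve 6 (λ b w t y V s → (b :* w) :* (t :+ y :* V) :- (b :* w) :* t :+ s :* (w :* V) := (y :* b :+ s) :* (w :* V)) refl β w
              (δ * ι.⟦ c₁ ⟧) y V (δ * ι.⟦ m ⟧) ⟩
          (y * β + δ * ι.⟦ m ⟧) * (w * V)
            ≈⟨ *-congʳ (trans (+-congʳ yβ) (-‿inverseˡ _)) ⟩
          0# * (w * V)
            ≈⟨ trans (zeroˡ _) (sym (zeroʳ δ)) ⟩
          δ * 0# ∎)

-- Here β = −m/(dy), where m + y (c₁ + y c(y)) = 0.
module ScaledReciprocal {Q : Ring} (ι : Hom ℤᴿ Q) where
  open RingKit Q
  private module ι = Hom ι

  module Root {d : ℤ} {ρ : Carrier} (ρd≈1 : ρ * ι.⟦ d ⟧ ≈ 1#) (y : Carrier)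
    {m m′ c₁ c₁′ : ℤ} (m≡ : m ≡ m′ ℤ.* (d ℤ.* d)) (c₁≡ : c₁ ≡ c₁′ ℤ.* d)
    (c : List ℤ) (m≈ : ι.⟦ m ⟧ ≈ y * (- ev ι y (c₁ ∷ c))) where

    β : Carrier
    β = ρ * ev ι y (c₁ ∷ c)

    dβ : ι.⟦ d ⟧ * β ≈ ev ι y (c₁ ∷ c)
    dβ = RingFacts.invert Q _ ρd≈1

    private
      cancel-d : ∀ {u v} → ι.⟦ d ⟧ * u ≈ ι.⟦ d ⟧ * v → u ≈ v
      cancel-d = RingFacts.cancel-invertible Q ρd≈1

      yβ : y * β ≈ - (ι.⟦ d ⟧ * ι.⟦ m′ ⟧)
      yβ = cancel-d (RingFacts.yβ-relation Q dβ m≈ (trans (ι.cong m≡) (trans (ι.*-homo _ _) (*-congˡ (ι.*-homo d d)))))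

      dβ′ : ι.⟦ d ⟧ * β ≈ ι.⟦ d ⟧ * ι.⟦ c₁′ ⟧ + y * ev ι y c
      dβ′ = trans dβ (+-congʳ (trans (ι.cong (≡.trans c₁≡ (ℤₚ.*-comm c₁′ d))) (ι.*-homo d c₁′)))

    equation : ∃ λ P → ev ι β (P ∷ʳ + 1) ≈ 0#
    equation = ReciprocalRoot.monic-equation ι cancel-d yβ c dβ′

ev-id : ∀ p → ev constHom X p ≋ p
ev-id []      = ≋-refl
ev-id (c ∷ p) = ≋-trans (add-cong (≋-refl {const c}) (mul-congˡ X (ev-id p))) (≋-sym (∷-as-sum c p))

monic-X+const : ∀ b → MonicOfDegree 1 (addP X (const b))
monic-X+const b = monic-+const {0} {X} b (monic-∷ {0} {+ 0} {const (+ 1)} monic-1)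

shift-back : ∀ b g → ev constHom (X Zx.- const b) (ev constHom (addP X (const b)) g) ≋ g
shift-back b g = ≋-trans (hom-ev constHom constHom h (ev-const constHom (X Zx.- const b)) (addP X (const b)) g)
  (≋-trans (ev-congʳ constHom image g) (ev-id g))
  where
  h = evHom constHom (X Zx.- const b)
  image : ev constHom (X Zx.- const b) (addP X (const b)) ≋ X
  image = ≋-trans (Hom.+-homo h X (const b)) (≋-trans (add-cong (ev-X constHom (X Zx.- const b)) (ev-const constHom (X Zx.- const b) b))
    (RingFacts.+-cancel ℤ[x]ᴿ X (const b)))

module _ {g : List ℤ} {k : ℕ} (g-monic : MonicOfDegree (suc k) g) where
  private
    module Q = RingKit (ℚ[x]/ g)
    module A = RingKit (ℤ[x]/ g)
    module j = Hom (embed g)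

  -- In `H = d r + U g` the degrees above `k` show that `d` divides the high coefficients of `U g`;
  -- as `g` is monic, `d` divides `U`. Then `d` divides the leading coefficient 1 of `H`.
  quotient-not-integral : ∀ {H} → MonicOfDegree k H → ∀ d r → H A.≈ const (+ d) A.* r → d ≡ 1
  quotient-not-integral {H} H-monic d r (U , e) = finish (monic-cofactor-divisible (+ d) g-monic U high)
    where
    coeff-e : ∀ i → coeff H i ≡ (+ d) ℤ.* coeff r i ℤ.+ coeff (mulP U g) i
    coeff-e i = ≡.trans (at e i) (≡.trans (coeff-add (mulP (const (+ d)) r) (mulP U g) i) (≡.cong (ℤ._+ coeff (mulP U g) i)
      (≡.trans (at (const-mul (+ d) r) i) (coeff-scale (+ d) r i))))
    high : ∀ {i} → suc k ℕ.≤ i → (+ d) ∣ coeff (mulP U g) i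
    high {i} k<i = divides (ℤ.- coeff r i) (RingFacts.solve-multiple ℤᴿ {+ d} {coeff r i} {coeff (mulP U g) i}
      (≡.trans (≡.sym (coeff-e i)) (above H-monic k<i)))
    finish : (∃ λ U′ → U ≋ scaleP (+ d) U′) → d ≡ 1
    finish (U′ , eU) = ℕD.∣1⇒≡1 (∣⇒∣ᵤ (divides (coeff r k ℤ.+ coeff (mulP U′ g) k) one))
      where
      one : + 1 ≡ (coeff r k ℤ.+ coeff (mulP U′ g) k) ℤ.* (+ d)
      one = ≡.trans (≡.sym (lead H-monic)) (≡.trans (coeff-e k) (≡.trans (≡.cong (λ z → (+ d) ℤ.* coeff r k ℤ.+ z)
              (≡.trans (at (≋-trans (mul-cong eU (≋-refl {g})) (PolyBase.scale-mul ℤᴿ (+ d) U′ g)) k) (coeff-scale (+ d) (mulP U′ g) k)))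
              (RingFacts.factor-out ℤᴿ (+ d) (coeff r k) (coeff (mulP U′ g) k))))

  module _ (roi : RingOfIntegersIsZα g) (b : ℤ) {d : ℕ} (d≢0 : d ≢ 0) where
    private
      y = X Zx.- const b
      δ : List ℚ
      δ = ℚ[X].const (toℚ (+ d))

    from-expansion : ∀ m c₁ c → ev constHom y (m ∷ c₁ ∷ c) ≋ g → MonicOfDegree k (c₁ ∷ c) →
                     ((+ d) ℤ.* (+ d)) ∣ m → (+ d) ∣ c₁ → d ≡ 1
    from-expansion m c₁ c e c-monic (divides m′ m≡) (divides c₁′ c₁≡) = conclude (reciprocal d d≢0)
      where
      H : List ℤ
      H = ev constHom y (c₁ ∷ c)
      jy : List ℚ
      jy = j.⟦ y ⟧
      jH : j.⟦ H ⟧ Q.≈ ev (ιℚ g) jy (c₁ ∷ c)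
      jH = Q.trans (j.cong (hom-ev constHom (const/ g) (π/ g) (λ _ → A.refl) y (c₁ ∷ c))) (hom-ev (const/ g) (ιℚ g) (embed g)
        (λ _ → Q.refl) y (c₁ ∷ c))
      m-relation : const m A.≈ y A.* (A.- H)
      m-relation = RingFacts.solve-for (ℤ[x]/ g) {g} {const m} {y} {H} (modulus≈0 ℤ[x]ᴿ g) (Hom.cong (π/ g) (≋-sym e))
      jm-relation : Hom.⟦_⟧ (ιℚ g) m Q.≈ jy Q.* (Q.- ev (ιℚ g) jy (c₁ ∷ c))
      jm-relation = Q.trans (j.cong m-relation) (Q.trans (j.*-homo y (A.- H)) (Q.*-congˡ {x = jy} (Q.trans (j.neg-homo H) (Q.-‿cong jH))))
      module _ {ρ : ℚ} (unit : ℚ[X].const ρ Q.* Hom.⟦_⟧ (ιℚ g) (+ d) Q.≈ Q.1#) where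
        open ScaledReciprocal.Root (ιℚ g) {+ d} {ℚ[X].const ρ} unit jy {m} {m′} {c₁} {c₁′} m≡ c₁≡ c jm-relation
        integral : InZα g β → d ≡ 1
        integral (r , βr) = quotient-not-integral (monic-comp (c₁ ∷ c) (monic-X+const (ℤ.- b)) c-monic) d r
          (embed-injective g g-monic {H} {const (+ d) A.* r} (Q.trans jH (Q.trans (Q.sym dβ)
            (Q.trans (Q.*-congˡ {x = δ} (CongMod⇒≈ {g} {β} {toℚ[x] r} βr)) (Q.sym (j.*-homo (const (+ d)) r))))))
        apply-roi : (∃ λ P → ev (ιℚ g) β (P ∷ʳ + 1) Q.≈ Q.0#) → d ≡ 1
        apply-roi (P , P-root) = integral (roi β (P ∷ʳ + 1 , (P , ≡.refl) , ≈⇒CongMod {g} {ℚP.compP (toℚ[x] (P ∷ʳ + 1)) β} {[]}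
          (Q.trans (ev-ιℚ g (P ∷ʳ + 1) β) P-root)))
        d≡1 : d ≡ 1
        d≡1 = apply-roi equation
      conclude : (∃ λ r → r ℚ.* toℚ (+ d) ≡ ℚ.1ℚ) → d ≡ 1
      conclude (ρ , ρd≡1) = d≡1 {ρ} (Hom.cong (π/ℚ g) (ℚ[X].≋-trans (ℚ[X].≋-sym (Hom.*-homo ℚ[X].constHom ρ (toℚ (+ d))))
        (Hom.cong ℚ[X].constHom ρd≡1)))

    -- The two coefficients are `g(b)` and `g′(b)`: the hypotheses describe a double root of `g`
    -- modulo `d` at which `g` vanishes even modulo `d²`.
    necessity : ((+ d) ℤ.* (+ d)) ∣ coeff (ev constHom (addP X (const b)) g) 0 → (+ d) ∣ coeff (ev constHom (addP X (const b)) g) 1 → d ≡ 1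
    necessity = split (ev constHom (addP X (const b)) g) (shift-back b g) (monic-comp g (monic-X+const b) g-monic)
      where
      split : ∀ F → ev constHom y F ≋ g → MonicOfDegree (suc k) F → ((+ d) ℤ.* (+ d)) ∣ coeff F 0 → (+ d) ∣ coeff F 1 → d ≡ 1
      split []           e m = contradiction (lead m) λ ()
      split (z ∷ [])     e m = contradiction (lead m) λ ()
      split (z ∷ c₁ ∷ c) e m = from-expansion z c₁ c e (monic-tail m)

-- The iterates of the statement and their values and derivatives

quot-cong : ∀ {R : Ring} {g h} → CommutativeRing._≈_ R g h → ∀ {x y} → _≈ᵍ_ R g x y → _≈ᵍ_ R h x y
quot-cong {R} e (u , eq) = u , trans eq (+-cong refl (*-cong refl e))
  where open CommutativeRing R

CongMod-cong : ∀ {g h} → g ≋ h → ∀ {β γ} → CongMod g β γ → CongMod h β γ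
CongMod-cong {g} {h} e {β} {γ} c = ≈⇒CongMod {h} {β} {γ} (quot-cong {ℚ[x]ᴿ} (Hom.cong toℚ[x]Hom e) (CongMod⇒≈ {g} {β} {γ} c))

roi-cong : ∀ {g h} → g ≋ h → RingOfIntegersIsZα g → RingOfIntegersIsZα h
roi-cong {g} {h} e roi β (P , monic , Pβ≈0) = finish (roi β (P , monic , CongMod-cong (≋-sym e) {ℚP.compP (toℚ[x] P) β} {[]} Pβ≈0))
  where
  finish : InZα g β → InZα h β
  finish (r , βr) = r , CongMod-cong e {β} {toℚ[x] r} βr

module _ {B : Ring} (ι : Hom ℤᴿ B) (u : CommutativeRing.Carrier B) where
  open RingKit B

  ev-fPoly : ∀ p .{{_ : ℕ.NonZero p}} a → ev ι u (fPoly p a) ≈ u ^ p - Hom.⟦_⟧ ι a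
  ev-fPoly (suc k) a = trans (+-cong (Hom.neg-homo ι a) (*-cong refl (tail k))) (+-comm _ _)
    where
    tail : ∀ k → ev ι u (replicate k (+ 0) ++ + 1 ∷ []) ≈ u ^ k
    tail zero    = trans (ev-const ι u (+ 1)) (Hom.1-homo ι)
    tail (suc k) = trans (+-cong (Hom.0-homo ι) (*-cong refl (tail k))) (+-identityˡ _)

evalP≡ev : ∀ p x → ℤP.evalP p x ≡ eval x p
evalP≡ev []      x = ≡.refl
evalP≡ev (c ∷ p) x = ≡.cong (λ z → c ℤ.+ x ℤ.* z) (evalP≡ev p x)

coeff-0≡ev : ∀ p → coeff p 0 ≡ eval (+ 0) p
coeff-0≡ev []      = ≡.refl
coeff-0≡ev (c ∷ p) = ≡.sym (ℤₚ.+-identityʳ c)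

^≡ℤ^ : ∀ x n → x ℤK.^ n ≡ x ℤ.^ n
^≡ℤ^ x zero    = ≡.refl
^≡ℤ^ x (suc n) = ≡.cong (x ℤ.*_) (^≡ℤ^ x n)

coeff-1-mul : ∀ U V → coeff (mulP U V) 1 ≡ coeff U 0 ℤ.* coeff V 1 ℤ.+ coeff U 1 ℤ.* coeff V 0
coeff-1-mul []      V = ≡.refl
coeff-1-mul (c ∷ U) V = ≡.trans (coeff-∷-mul c U V 1) (≡.cong (λ z → c ℤ.* coeff V 1 ℤ.+ z) (coeff-0-mul U))
  where
  coeff-0-mul : ∀ U → coeff (mulP U V) 0 ≡ coeff U 0 ℤ.* coeff V 0
  coeff-0-mul []      = ≡.refl
  coeff-0-mul (c ∷ U) = ≡.trans (coeff-∷-mul c U V 0) (ℤₚ.+-identityʳ (c ℤ.* coeff V 0))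

coeff-0-^ : ∀ U n → coeff (U Zx.^ n) 0 ≡ coeff U 0 ℤK.^ n
coeff-0-^ U n = ≡.trans (coeff-0≡ev (U Zx.^ n)) (≡.trans (Hom.^-homo (evHom (idHom ℤᴿ) (+ 0)) U n) (≡.cong (ℤK._^ n) (≡.sym (coeff-0≡ev U))))

-- The power rule for derivatives at 0: the coefficient of `x` stands for the derivative there and
-- obeys the product rule `coeff-1-mul`.
coeff-1-^ : ∀ U n → coeff (U Zx.^ suc n) 1 ≡ (+ suc n) ℤ.* (coeff U 0 ℤK.^ n ℤ.* coeff U 1)
coeff-1-^ U zero    = ≡.trans (coeff-1-mul U (const (+ 1))) (RingFacts.derivative-base ℤᴿ (coeff U 0) (coeff U 1))
coeff-1-^ U (suc n) = ≡.trans (coeff-1-mul U (U Zx.^ suc n)) (≡.trans (≡.cong₂ (λ s t → coeff U 0 ℤ.* s ℤ.+ coeff U 1 ℤ.* t) (coeff-1-^ U n)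
  (coeff-0-^ U (suc n)))
  (RingFacts.derivative-step ℤᴿ (coeff U 0) (coeff U 1) (+ suc n) (coeff U 0 ℤK.^ n)))

square : ∀ {d m} → (d ℕ.* d) ℕD.∣ ℤ.∣ m ∣ → ((+ d) ℤ.* (+ d)) ∣ m
square {d} {m} h = ∣ᵤ⇒∣ (≡.subst (ℕD._∣ ℤ.∣ m ∣) (≡.sym (ℤₚ.abs-* (+ d) (+ d))) h)

square⁻ : ∀ {d m} → ((+ d) ℤ.* (+ d)) ∣ m → (d ℕ.* d) ℕD.∣ ℤ.∣ m ∣
square⁻ {d} {m} h = ≡.subst (ℕD._∣ ℤ.∣ m ∣) (ℤₚ.abs-* (+ d) (+ d)) (∣⇒∣ᵤ h)

module _ (p : ℕ) (p-prime : Prime p) (a : ℤ) where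
  private
    instance _ = prime⇒nonZero p-prime
    p≡2+ : ∃ λ n → p ≡ suc (suc n)
    p≡2+ = ℕ.pred (ℕ.pred p) , 2+pred p (ℕ.nonTrivial⇒n>1 p {{prime⇒nonTrivial p-prime}})
      where
      2+pred : ∀ p → 1 ℕ.< p → p ≡ suc (suc (ℕ.pred (ℕ.pred p)))
      2+pred (suc (suc n)) _ = ≡.refl
      2+pred (suc zero) (s≤s ())

  fIter≋F : ∀ n → fIter p a n ≋ F p a n
  fIter≋F zero    = ≋-refl
  fIter≋F (suc n) = ≋-trans (Zx.reflexive (compP≡ev ℤᴿ (fPoly p a) (fIter p a n)))
    (≋-trans (ev-fPoly constHom (fIter p a n) p a) (add-cong (Zx.^-congˡ p (fIter≋F n)) (≋-refl {const (ℤ.- a)})))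

  fIter-0 : ∀ n → ℤP.evalP (fIter p a n) (+ 0) ≡ it ℤᴿ p a n (+ 0)
  fIter-0 n = ≡.trans (evalP≡ev (fIter p a n) (+ 0)) (≡.trans (Hom.cong (evHom (idHom ℤᴿ) (+ 0)) (fIter≋F n)) (eval-F p p-prime a (+ 0) n))

  Shifted : ℤ → ℕ → List ℤ
  Shifted b n = ev constHom (addP X (const b)) (F p a n)

  shifted : ∀ b n → Shifted b n ≋ it ℤ[x]ᴿ p (const a) n (addP X (const b))
  shifted b n = Tower.ev-F p p-prime a constHom (addP X (const b)) n

  coeff-0-shifted : ∀ b n → coeff (Shifted b n) 0 ≡ it ℤᴿ p a n b
  coeff-0-shifted b n = begin
    coeff (Shifted b n) 0  ≡⟨ at (shifted b n) 0 ⟩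
    coeff (it ℤ[x]ᴿ p (const a) n (addP X (const b))) 0  ≡⟨ coeff-0≡ev (it ℤ[x]ᴿ p (const a) n (addP X (const b))) ⟩
    eval (+ 0) (it ℤ[x]ᴿ p (const a) n (addP X (const b)))  ≡⟨ hom-it (evℤ (+ 0)) p (const a) n (addP X (const b)) ⟩
    it ℤᴿ p (eval (+ 0) (const a)) n (eval (+ 0) (addP X (const b)))
      ≡⟨ it-cong₂ ℤᴿ p n (ev-const (idHom ℤᴿ) (+ 0) a) (≡.trans (ℤₚ.+-identityʳ (+ 0 ℤ.+ b)) (ℤₚ.+-identityˡ b)) ⟩
    it ℤᴿ p a n b  ∎
    where open ≡.≡-Reasoning

  -- The chain rule for `f` applied to `f^n` at the point `b`. It supplies the divisibility by `p`
  -- at `b = a` and the vanishing at `b = 0`.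
  coeff-1-shifted : ∀ b n → coeff (Shifted b (suc n)) 1 ≡ (+ p) ℤ.* (coeff (Shifted b n) 0 ℤK.^ ℕ.pred p ℤ.* coeff (Shifted b n) 1)
  coeff-1-shifted b n = begin
    coeff (Shifted b (suc n)) 1  ≡⟨ at (shifted b (suc n)) 1 ⟩
    coeff (addP (U Zx.^ p) (const (ℤ.- a))) 1  ≡⟨ ≡.trans (coeff-add (U Zx.^ p) (const (ℤ.- a)) 1) (ℤₚ.+-identityʳ _) ⟩
    coeff (U Zx.^ p) 1  ≡⟨ derivative p ⟩
    (+ p) ℤ.* (coeff U 0 ℤK.^ ℕ.pred p ℤ.* coeff U 1)
      ≡⟨ ≡.cong₂ (λ s t → (+ p) ℤ.* (s ℤK.^ ℕ.pred p ℤ.* t)) (at (shifted b n) 0) (at (shifted b n) 1) ⟨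
    (+ p) ℤ.* (coeff (Shifted b n) 0 ℤK.^ ℕ.pred p ℤ.* coeff (Shifted b n) 1) ∎
    where
    open ≡.≡-Reasoning
    U = it ℤ[x]ᴿ p (const a) n (addP X (const b))
    derivative : ∀ m .{{_ : ℕ.NonZero m}} → coeff (U Zx.^ m) 1 ≡ (+ m) ℤ.* (coeff U 0 ℤK.^ ℕ.pred m ℤ.* coeff U 1)
    derivative (suc m) = coeff-1-^ U m

  coeff-1-at-0 : ∀ n → coeff (Shifted (+ 0) (suc n)) 1 ≡ + 0
  coeff-1-at-0 zero = ≡.trans (coeff-1-shifted (+ 0) 0) (≡.trans (≡.cong (λ z → (+ p) ℤ.* (z ℤ.* coeff (Shifted (+ 0) 0) 1)) vanishing)
    (ℤₚ.*-zeroʳ (+ p)))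
    where
    power-of-0 : ∀ {z} → z ≡ + 0 → ∀ n → z ℤK.^ suc n ≡ + 0
    power-of-0 ≡.refl n = ≡.refl
    -- The exponent `p - 1` is positive because `p ≥ 2`; with exponent 0 this power of 0 would be 1.
    vanishing : coeff (Shifted (+ 0) 0) 0 ℤK.^ ℕ.pred p ≡ + 0
    vanishing = ≡.trans (≡.cong (λ m → coeff (Shifted (+ 0) 0) 0 ℤK.^ ℕ.pred m) (proj₂ p≡2+)) (power-of-0 (coeff-0-shifted (+ 0) 0) (proj₁ p≡2+))
  coeff-1-at-0 (suc n) = ≡.trans (coeff-1-shifted (+ 0) (suc n)) (≡.trans (≡.cong (λ z → (+ p) ℤ.* (coeff (Shifted (+ 0)
    (suc n)) 0 ℤK.^ ℕ.pred p ℤ.* z)) (coeff-1-at-0 n))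
    (≡.trans (≡.cong ((+ p) ℤ.*_) (ℤₚ.*-zeroʳ (coeff (Shifted (+ 0) (suc n)) 0 ℤK.^ ℕ.pred p))) (ℤₚ.*-zeroʳ (+ p))))

  monic-F⁺ : ∀ n → MonicOfDegree (suc (ℕ.pred (p ℕ.^ n))) (F p a n)
  monic-F⁺ n = ≡.subst (λ k → MonicOfDegree k (F p a n)) (≡.sym (ℕₚ.suc-pred (p ℕ.^ n) {{ℕₚ.m^n≢0 p n}})) (monic-F p p-prime a n)

  -- At `b = a` the two coefficients are `f(a) = a^p - a` and `f′(a) = p a^(p-1)`, the second always
  -- divisible by `p`.
  not-congruent : RingOfIntegersIsZα (fIter p a 1) → ¬ ((a ℤ.^ p) ≡ a [mod p ℕ.* p ])
  not-congruent roi a^p≡a = prime≢1 p-prime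
    (necessity (monic-F⁺ 1) (roi-cong (fIter≋F 1) roi) a {p} (ℕ.≢-nonZero⁻¹ p)
      (≡.subst (((+ p) ℤ.* (+ p)) ∣_) (≡.sym (≡.trans (coeff-0-shifted a 1) (≡.cong (ℤ._- a) (^≡ℤ^ a p)))) (square {p} {a ℤ.^ p ℤ.- a} a^p≡a))
      (≡.subst ((+ p) ∣_) (≡.sym (coeff-1-shifted a 0)) (divides c (ℤₚ.*-comm (+ p) c))))
    where c = coeff (Shifted a 0) 0 ℤK.^ ℕ.pred p ℤ.* coeff (Shifted a 0) 1

  squarefree : ∀ n → 1 ℕ.≤ n → RingOfIntegersIsZα (fIter p a n) → Squarefree (ℤP.evalP (fIter p a n) (+ 0))
  squarefree (suc n) _ roi = λ
    -- `necessity` requires `d ≠ 0`. If 0 divides the value, the value is 0, hence divisible by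
    -- `2²`, and the case `d = 2` would give `2 = 1`.
    { zero 0∣m → contradiction (square-divisor 2 (λ ()) (≡.subst (4 ℕD.∣_) (≡.sym (ℕD.0∣⇒≡0 0∣m)) (4 ℕD.∣0))) λ ()
    ; d@(suc _) d²∣m → square-divisor d (λ ()) d²∣m }
    where
    m = ℤP.evalP (fIter p a (suc n)) (+ 0)
    square-divisor : ∀ d → d ≢ 0 → (d ℕ.* d) ℕD.∣ ℤ.∣ m ∣ → d ≡ 1
    square-divisor d d≢0 d²∣m = necessity (monic-F⁺ (suc n)) (roi-cong (fIter≋F (suc n)) roi) (+ 0) {d} d≢0
      (≡.subst (((+ d) ℤ.* (+ d)) ∣_) (≡.trans (fIter-0 (suc n)) (≡.sym (coeff-0-shifted (+ 0) (suc n)))) (square {d} {m} d²∣m))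
      (divides (+ 0) (coeff-1-at-0 n))

  sufficient : ∀ n → 1 ℕ.≤ n → ¬ ((a ℤ.^ p) ≡ a [mod p ℕ.* p ]) →
    (∀ j → 1 ℕ.≤ j → j ℕ.≤ n → Squarefree (ℤP.evalP (fIter p a j) (+ 0))) → RingOfIntegersIsZα (fIter p a n)
  sufficient n 1≤n a^p≢a sqfree = roi-cong (≋-sym (fIter≋F n)) (integrally-closed (monic-F p p-prime a n) closed-at)
    where
    p²∤ : ¬ ((+ p) ℤ.* (+ p)) ∣ a ℤK.^ p ℤ.- a
    p²∤ h = a^p≢a (square⁻ {p} {a ℤ.^ p ℤ.- a} (≡.subst (λ z → ((+ p) ℤ.* (+ p)) ∣ z ℤ.- a) (^≡ℤ^ a p) h))
    q²∤ : ∀ {q} → Prime q → ∀ j → 1 ℕ.≤ j → j ℕ.≤ n → ¬ ((+ q) ℤ.* (+ q)) ∣ it ℤᴿ p a j (+ 0)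
    q²∤ {q} q-prime j 1≤j j≤n h = prime≢1 q-prime
      (sqfree j 1≤j j≤n q (square⁻ {q} {ℤP.evalP (fIter p a j) (+ 0)} (≡.subst (((+ q) ℤ.* (+ q)) ∣_) (≡.sym (fIter-0 j)) h)))
    closed-at : ∀ q → Prime q → ∀ e → e ≢ 0 → ∀ C → AlmostIntegral.AlmostInt (ℤ[x]/ F p a n) (const (+ q)) (const (+ e)) C → MultipleOf
      (ℤ[x]/ F p a n) (const (+ q)) C
    closed-at q q-prime e e≢0 C = ClosedAt.divide (closed p p-prime a n 1≤n p²∤ q-prime (q²∤ q-prime)) e C e≢0

open import Data.Nat using (_≤_; _*_)

theorem1p1 : (p : ℕ) → Prime p → (a : ℤ) → IrreducibleZ (fPoly p a) →
    (N : ℕ) → 1 ≤ N →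
    ((∀ n → 1 ≤ n → n ≤ N → RingOfIntegersIsZα (fIter p a n))
    ⇔ ((¬ ((a ℤ.^ p) ≡ a [mod p * p ]))
    × (∀ n → 1 ≤ n → n ≤ N → Squarefree (ℤP.evalP (fIter p a n) (ℤ.+ 0)))))
theorem1p1 p p-prime a _ N 1≤N = mk⇔
  (λ roi → not-congruent p p-prime a (roi 1 ℕₚ.≤-refl 1≤N) , λ n 1≤n n≤N → squarefree p p-prime a n 1≤n (roi n 1≤n n≤N))
  (λ (a^p≢a , sqfree) n 1≤n n≤N → sufficient p p-prime a n 1≤n a^p≢a (λ j 1≤j j≤n → sqfree j 1≤j (ℕₚ.≤-trans j≤n n≤N)))
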